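{- Let $X$ be a simplicial complex, and let $1\le r\le \dim(X)$. Then, for all $1\le k\le f_{r-1}(X)$, \[ \sum_{i=1}^{k} \lambda_i(L_{r-1}^{+}(X)) \le f_{r}(X) + \binom{(r+1)k}{2}. \]
   Context: A simplicial complex $X$ on a finite vertex set $V$ is a family of subsets of $V$ closed under inclusion; its elements are called simplices (or faces), $\dim(\sigma)=|\sigma|-1$ for $\sigma\in X$, and $\dim(X)$ is the maximal dimension of a simplex. $X(i)$ is the set of $i$-dimensional simplices (with $X(-1)=\{\emptyset\}$) and $f_i(X)=|X(i)|$. For $\sigma\in X$ and $1\le r\le\dim(X)$, the $r$-degree $\deg_X^{(r)}(\sigma)$ is the number of $r$-dimensional simplices of $X$ containing $\sigma$. Fix an arbitrary linear order $<$ on $V$. For $\sigma\in X(s-1)$, $\tau\in X(s)$ with $\sigma\subset\tau$ ($0\le s\le \dim(X)$), let $u$ be the unique vertex of $\tau\setminus\sigma$ and set $(\tau:\sigma)=(-1)^{|\{v\in\tau:\,v<u\}|}$. For $1\le r\le\dim(X)$, the upper Laplacian $L_{r-1}^+(X)\in\mathbb{R}^{f_{r-1}(X)\times f_{r-1}(X)}$ is the matrix indexed by $X(r-1)$ with $L_{r-1}^+(X)_{\tau,\tau}=\deg_X^{(r)}(\tau)$; $L_{r-1}^+(X)_{\tau,\eta}=-(\tau:\tau\cap\eta)(\eta:\tau\cap\eta)$ if $|\tau\cap\eta|=r-1$ and $\tau\cup\eta\in X$; and all other entries $0$. For a symmetric real matrix $M$, $\lambda_i(M)$ is its $i$-th largest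 eigenvalue (with multiplicity). -}

module Defs where

open import Level using (0ℓ)
open import Data.Bool using (if_then_else_)
import Data.Bool.Properties as Bool
open import Data.Nat as ℕ using (ℕ; zero; suc; _∸_)
import Data.Nat.Properties as ℕ
open import Data.Integer as ℤ using (ℤ; +_; 0ℤ; 1ℤ; -1ℤ)
open import Data.Rational as ℚ using (ℚ; 0ℚ; 1ℚ; ½)
import Data.Rational.Properties as ℚ
open import Data.Rational.Solver using (module +-*-Solver)
open import Data.Fin as Fin using (Fin)
open import Data.Fin.Subset
  using (Subset; inside; outside; ∣_∣; _∩_; _∪_; _─_; _⊆_) renaming (⊥ to ∅)
open import Data.Fin.Subset.Properties using (_⊆?_; nonempty?)
open import Data.Vec as Vec using ([]; _∷_)
open import Data.Vec.Functional using (Vector)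
import Data.Vec.Properties as Vec
open import Data.List as List using (List; [_]; _++_; filter; length)
open import Data.Product using (∃-syntax; _×_; _,_)
open import Relation.Nullary using (does; yes; no; _×-dec_)
open import Relation.Unary using (Pred; Decidable)
open import Relation.Binary using (Rel; IsStrictTotalOrder)
open import Relation.Binary.PropositionalEquality
  using (_≡_; refl; sym; trans; cong; subst)
open import Algebra.Bundles.Raw using (RawMonoid)
import Algebra.Definitions.RawMonoid as RawMonoidDefs

------------------------------------------------------------------------
-- Real numbers: Cauchy sequences of rationals, compared by the setoid
-- equality _≈ᵣ_.

IsCauchy : (ℕ → ℚ) → Set
IsCauchy s = ∀ ε → 0ℚ ℚ.< ε →
  ∃[ N ] (∀ m n → N ℕ.≤ m → N ℕ.≤ n → ℚ.∣ s m ℚ.- s n ∣ ℚ.≤ ε)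

record ℝ : Set where
  constructor mkℝ
  field
    seq    : ℕ → ℚ
    cauchy : IsCauchy seq

open ℝ public

infix 4 _≈ᵣ_ _≤ᵣ_

_≈ᵣ_ : Rel ℝ 0ℓ
x ≈ᵣ y = ∀ ε → 0ℚ ℚ.< ε →
  ∃[ N ] (∀ n → N ℕ.≤ n → ℚ.∣ seq x n ℚ.- seq y n ∣ ℚ.≤ ε)

_≤ᵣ_ : Rel ℝ 0ℓ
x ≤ᵣ y = ∀ ε → 0ℚ ℚ.< ε →
  ∃[ N ] (∀ n → N ℕ.≤ n → seq x n ℚ.≤ seq y n ℚ.+ ε)

abstract

  const-cauchy : ∀ q → IsCauchy (λ _ → q)
  const-cauchy q ε 0<ε = 0 , λ _ _ _ _ →
    subst (ℚ._≤ ε) (sym (cong ℚ.∣_∣ (ℚ.+-inverseʳ q))) (ℚ.<⇒≤ 0<ε)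

  private
    0<half : ∀ {ε} → 0ℚ ℚ.< ε → 0ℚ ℚ.< ½ ℚ.* ε
    0<half {ε} 0<ε =
      subst (ℚ._< ½ ℚ.* ε) (ℚ.*-zeroʳ ½) (ℚ.*-monoʳ-<-pos ½ {0ℚ} {ε} 0<ε)

    halves : ∀ ε → ½ ℚ.* ε ℚ.+ ½ ℚ.* ε ≡ ε
    halves ε = trans (sym (ℚ.*-distribʳ-+ ε ½ ½))
                     (trans (cong (ℚ._* ε) ½+½≡1) (ℚ.*-identityˡ ε))
      where
      ½+½≡1 : ½ ℚ.+ ½ ≡ 1ℚ
      ½+½≡1 = refl

  +-cauchy : ∀ {s t} → IsCauchy s → IsCauchy t → IsCauchy (λ n → s n ℚ.+ t n)
  +-cauchy {s} {t} cs ct ε 0<ε =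
    let M , hs = cs (½ ℚ.* ε) (0<half 0<ε)
        N , ht = ct (½ ℚ.* ε) (0<half 0<ε)
    in M ℕ.⊔ N , λ m n p q → begin
    ℚ.∣ (s m ℚ.+ t m) ℚ.- (s n ℚ.+ t n) ∣
      ≡⟨ cong ℚ.∣_∣ (solve 4 (λ a b c d → (a :+ b) :- (c :+ d) := (a :- c) :+ (b :- d))
                       refl (s m) (t m) (s n) (t n)) ⟩
    ℚ.∣ (s m ℚ.- s n) ℚ.+ (t m ℚ.- t n) ∣
      ≤⟨ ℚ.∣p+q∣≤∣p∣+∣q∣ (s m ℚ.- s n) (t m ℚ.- t n) ⟩
    ℚ.∣ s m ℚ.- s n ∣ ℚ.+ ℚ.∣ t m ℚ.- t n ∣
      ≤⟨ ℚ.+-mono-≤ (hs m n (ℕ.m⊔n≤o⇒m≤o M N p) (ℕ.m⊔n≤o⇒m≤o M N q))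
                    (ht m n (ℕ.m⊔n≤o⇒n≤o M N p) (ℕ.m⊔n≤o⇒n≤o M N q)) ⟩
    ½ ℚ.* ε ℚ.+ ½ ℚ.* ε
      ≡⟨ halves ε ⟩
    ε ∎
    where
    open ℚ.≤-Reasoning
    open +-*-Solver

  private
    bound : ∀ {s} → IsCauchy s →
      ∃[ M ] ∃[ N ] (∀ n → N ℕ.≤ n → ℚ.∣ s n ∣ ℚ.≤ 1ℚ ℚ.+ ℚ.∣ s M ∣)
    bound {s} cs =
      let N , h = cs 1ℚ (ℚ.positive⁻¹ 1ℚ)
      in N , N , λ n p → begin
      ℚ.∣ s n ∣
        ≡⟨ cong ℚ.∣_∣ (solve 2 (λ a b → a := (a :- b) :+ b) refl (s n) (s N)) ⟩
      ℚ.∣ (s n ℚ.- s N) ℚ.+ s N ∣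
        ≤⟨ ℚ.∣p+q∣≤∣p∣+∣q∣ (s n ℚ.- s N) (s N) ⟩
      ℚ.∣ s n ℚ.- s N ∣ ℚ.+ ℚ.∣ s N ∣
        ≤⟨ ℚ.+-monoˡ-≤ ℚ.∣ s N ∣ (h n N p ℕ.≤-refl) ⟩
      1ℚ ℚ.+ ℚ.∣ s N ∣ ∎
      where
      open ℚ.≤-Reasoning
      open +-*-Solver

    scaled : ∀ c → 0ℚ ℚ.≤ c → ∀ ε → 0ℚ ℚ.< ε →
      ∃[ δ ] (0ℚ ℚ.< δ) ×
             (∀ a b → ℚ.∣ b ∣ ℚ.≤ 1ℚ ℚ.+ c → ℚ.∣ a ∣ ℚ.≤ δ → ℚ.∣ b ℚ.* a ∣ ℚ.≤ ε)
    scaled c 0≤c ε 0<ε = δ , 0<δ , small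
      where
      open ℚ.≤-Reasoning
      C : ℚ
      C = 1ℚ ℚ.+ c
      instance
        C-pos : ℚ.Positive C
        C-pos = ℚ.positive (ℚ.+-mono-<-≤ (ℚ.positive⁻¹ 1ℚ) 0≤c)
        C-nonNeg : ℚ.NonNegative C
        C-nonNeg = ℚ.pos⇒nonNeg C
        C-nonZero : ℚ.NonZero C
        C-nonZero = ℚ.pos⇒nonZero C
        1/C-pos : ℚ.Positive (ℚ.1/ C)
        1/C-pos = ℚ.1/pos⇒pos C
      δ : ℚ
      δ = ℚ.1/ C ℚ.* ε
      0<δ : 0ℚ ℚ.< δ
      0<δ = subst (ℚ._< δ) (ℚ.*-zeroʳ (ℚ.1/ C)) (ℚ.*-monoʳ-<-pos (ℚ.1/ C) {0ℚ} {ε} 0<ε)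
      small : ∀ a b → ℚ.∣ b ∣ ℚ.≤ C → ℚ.∣ a ∣ ℚ.≤ δ → ℚ.∣ b ℚ.* a ∣ ℚ.≤ ε
      small a b p q = begin
        ℚ.∣ b ℚ.* a ∣          ≡⟨ ℚ.∣p*q∣≡∣p∣*∣q∣ b a ⟩
        ℚ.∣ b ∣ ℚ.* ℚ.∣ a ∣    ≤⟨ ℚ.*-monoʳ-≤-nonNeg ℚ.∣ a ∣
                                    {{ℚ.nonNegative (ℚ.0≤∣p∣ a)}} p ⟩
        C ℚ.* ℚ.∣ a ∣          ≤⟨ ℚ.*-monoˡ-≤-nonNeg C q ⟩
        C ℚ.* (ℚ.1/ C ℚ.* ε)   ≡⟨ sym (ℚ.*-assoc C (ℚ.1/ C) ε) ⟩
        (C ℚ.* ℚ.1/ C) ℚ.* ε   ≡⟨ cong (ℚ._* ε) (ℚ.*-inverseʳ C) ⟩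
        1ℚ ℚ.* ε               ≡⟨ ℚ.*-identityˡ ε ⟩
        ε ∎

  *-cauchy : ∀ {s t} → IsCauchy s → IsCauchy t → IsCauchy (λ n → s n ℚ.* t n)
  *-cauchy {s} {t} cs ct ε 0<ε =
    let B , K , bs = bound cs
        D , L , bt = bound ct
        δ , 0<δ , small  = scaled ℚ.∣ s B ∣ (ℚ.0≤∣p∣ (s B)) (½ ℚ.* ε) (0<half 0<ε)
        γ , 0<γ , small′ = scaled ℚ.∣ t D ∣ (ℚ.0≤∣p∣ (t D)) (½ ℚ.* ε) (0<half 0<ε)
        M , hs = cs γ 0<γ
        N , ht = ct δ 0<δ
    in (K ℕ.⊔ L) ℕ.⊔ (M ℕ.⊔ N) , λ m n p q →
    let pKL = ℕ.m⊔n≤o⇒m≤o (K ℕ.⊔ L) (M ℕ.⊔ N) p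
        qKL = ℕ.m⊔n≤o⇒m≤o (K ℕ.⊔ L) (M ℕ.⊔ N) q
        pMN = ℕ.m⊔n≤o⇒n≤o (K ℕ.⊔ L) (M ℕ.⊔ N) p
        qMN = ℕ.m⊔n≤o⇒n≤o (K ℕ.⊔ L) (M ℕ.⊔ N) q
    in begin
    ℚ.∣ s m ℚ.* t m ℚ.- s n ℚ.* t n ∣
      ≡⟨ cong ℚ.∣_∣ (solve 4 (λ a b c d → a :* b :- c :* d
                                          := a :* (b :- d) :+ d :* (a :- c))
                       refl (s m) (t m) (s n) (t n)) ⟩
    ℚ.∣ s m ℚ.* (t m ℚ.- t n) ℚ.+ t n ℚ.* (s m ℚ.- s n) ∣
      ≤⟨ ℚ.∣p+q∣≤∣p∣+∣q∣ (s m ℚ.* (t m ℚ.- t n)) (t n ℚ.* (s m ℚ.- s n)) ⟩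
    ℚ.∣ s m ℚ.* (t m ℚ.- t n) ∣ ℚ.+ ℚ.∣ t n ℚ.* (s m ℚ.- s n) ∣
      ≤⟨ ℚ.+-mono-≤
           (small (t m ℚ.- t n) (s m) (bs m (ℕ.m⊔n≤o⇒m≤o K L pKL))
              (ht m n (ℕ.m⊔n≤o⇒n≤o M N pMN) (ℕ.m⊔n≤o⇒n≤o M N qMN)))
           (small′ (s m ℚ.- s n) (t n) (bt n (ℕ.m⊔n≤o⇒n≤o K L qKL))
              (hs m n (ℕ.m⊔n≤o⇒m≤o M N pMN) (ℕ.m⊔n≤o⇒m≤o M N qMN))) ⟩
    ½ ℚ.* ε ℚ.+ ½ ℚ.* ε
      ≡⟨ halves ε ⟩
    ε ∎
    where
    open ℚ.≤-Reasoning
    open +-*-Solver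

infixl 6 _+ᵣ_
infixl 7 _*ᵣ_

_+ᵣ_ : ℝ → ℝ → ℝ
seq    (x +ᵣ y) n = seq x n ℚ.+ seq y n
cauchy (x +ᵣ y)   = +-cauchy {seq x} {seq y} (cauchy x) (cauchy y)

_*ᵣ_ : ℝ → ℝ → ℝ
seq    (x *ᵣ y) n = seq x n ℚ.* seq y n
cauchy (x *ᵣ y)   = *-cauchy {seq x} {seq y} (cauchy x) (cauchy y)

fromℤ : ℤ → ℝ
seq    (fromℤ i) _ = i ℚ./ 1
cauchy (fromℤ i)   = const-cauchy (i ℚ./ 1)

fromℕ : ℕ → ℝ
fromℕ k = fromℤ (+ k)

0ᵣ : ℝ
0ᵣ = fromℕ 0

+ᵣ-rawMonoid : RawMonoid 0ℓ 0ℓ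
+ᵣ-rawMonoid = record { Carrier = ℝ ; _≈_ = _≈ᵣ_ ; _∙_ = _+ᵣ_ ; ε = 0ᵣ }

∑ : ∀ {n} → Vector ℝ n → ℝ
∑ = RawMonoidDefs.sum +ᵣ-rawMonoid

------------------------------------------------------------------------
-- Eigenvalues

Matrix : ℕ → Set
Matrix n = Fin n → Fin n → ℝ

infixr 7 _*ᵥ_

_*ᵥ_ : ∀ {n} → Matrix n → Vector ℝ n → Vector ℝ n
(M *ᵥ v) i = ∑ (λ j → M i j *ᵣ v j)

LinearlyIndependent : ∀ {k n} → (Fin k → Vector ℝ n) → Set
LinearlyIndependent {k} v = (c : Vector ℝ k) →
  (∀ j → ∑ (λ i → c i *ᵣ v i j) ≈ᵣ 0ᵣ) → ∀ i → c i ≈ᵣ 0ᵣ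

-- The eigenvalues of the diagonalisable n × n matrix M, listed with
-- multiplicity from largest to smallest (the i-th largest has index i - 1).
-- The n independent eigenvectors form a basis of ℝⁿ, so a number occurs in
-- the list exactly as often as the dimension of its eigenspace.
record IsEigenvalueList {n : ℕ} (M : Matrix n) (μ : Vector ℝ n) : Set where
  field
    nonincreasing : ∀ i j → i Fin.≤ j → μ j ≤ᵣ μ i
    eigenvector   : Fin n → Vector ℝ n
    independent   : LinearlyIndependent eigenvector
    isEigenvector : ∀ i j → (M *ᵥ eigenvector i) j ≈ᵣ μ i *ᵣ eigenvector i j

------------------------------------------------------------------------
-- Simplicial complexes

-- ∅ is required to be a simplex, in accordance with X(-1) = {∅}.
record SimplicialComplex (n : ℕ) : Set₁ where
  field
    Face        : Pred (Subset n) 0ℓ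
    face?       : Decidable Face
    ∅-face      : Face ∅
    down-closed : ∀ {σ τ} → σ ⊆ τ → Face τ → Face σ

-- Every subset of Fin n, each exactly once.
subsets : ∀ n → List (Subset n)
subsets zero    = [ [] ]
subsets (suc n) = List.map (outside ∷_) (subsets n) ++ List.map (inside ∷_) (subsets n)

dimension : ∀ {n} → Subset n → ℤ
dimension σ = + ∣ σ ∣ ℤ.- 1ℤ

module _ {n : ℕ} (X : SimplicialComplex n) where

  open SimplicialComplex X

  dim : ℤ
  dim = List.foldr ℤ._⊔_ -1ℤ (List.map dimension (filter face? (subsets n)))

  simplices : ℕ → List (Subset n)
  simplices i = filter (λ σ → face? σ ×-dec (dimension σ ℤ.≟ + i)) (subsets n)

  f : ℕ → ℕ
  f i = length (simplices i)

  degree : ℕ → Subset n → ℕ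
  degree r σ = length (filter (σ ⊆?_) (simplices r))

module _ {n : ℕ} {_<_ : Rel (Fin n) 0ℓ} (ord : IsStrictTotalOrder _≡_ _<_) where

  open IsStrictTotalOrder ord using (_<?_)

  below : Fin n → Subset n
  below u = Vec.tabulate (λ v → does (v <? u))

  -- (τ : σ).  It is only meaningful when σ ⊂ τ and ∣ τ ∣ = ∣ σ ∣ + 1; then
  -- nonempty? can only return the unique vertex u of τ ─ σ.
  incidence : Subset n → Subset n → ℤ
  incidence τ σ with nonempty? (τ ─ σ)
  ... | yes (u , _) = -1ℤ ℤ.^ ∣ τ ∩ below u ∣
  ... | no _        = 0ℤ

  module _ (X : SimplicialComplex n) (r : ℕ) where

    open SimplicialComplex X

    entry : Subset n → Subset n → ℤ
    entry τ η =
      if does (Vec.≡-dec Bool._≟_ τ η) then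
        + degree X r τ
      else if does ((∣ τ ∩ η ∣ ℕ.≟ r ∸ 1) ×-dec face? (τ ∪ η)) then
        ℤ.- (incidence τ (τ ∩ η) ℤ.* incidence η (τ ∩ η))
      else
        0ℤ

    -- For r ≥ 1 this is the matrix with subscript r - 1, whose rows and
    -- columns are indexed by the (r - 1)-simplices.
    upperLaplacian : Matrix (f X (r ∸ 1))
    upperLaplacian i j =
      fromℤ (entry (List.lookup (simplices X (r ∸ 1)) i)
                   (List.lookup (simplices X (r ∸ 1)) j))

{-# OPTIONS --safe #-}
module Submission where

-- Write L = BᵀB with B the signed incidence matrix of r- and (r - 1)-faces, with rows b_τ, and put m = (r + 1)k.
-- For the orthogonal projection P onto the span of k eigenvectors, the sum of the eigenvalues is the sum of
-- q_τ = ⟨P b_τ , b_τ⟩ over the r-faces τ, and the numbers p_σ = P_σσ add up to k. There are two estimates.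
-- By Cauchy–Schwarz, q_τ is at most the total weight of the facets of τ, where w_σ = (r + 1)p_σ. For a star of
-- d faces τ around a common facet σ, ∑ b_τ b_τᵀ is at most r times the identity of the star plus a form zzᵀ / (d + r)
-- with |z|² = d(d + r), so that ∑ (q_τ - 1) ≤ r p_σ + r ∑ p_η over the other facets η.
--
-- Faces with a heavy facet (w_σ > 1) are estimated by stars. For the others, ∑ (w(τ) - 1) is linear in the weights
-- 0 ≤ w ≤ 1, hence maximal at the indicator of a set S of facets, where it is at most ∑ C(|τ ∩ S|, 2) ≤ C(|S|, 2),
-- because two facets lie in at most one common face. Both contributions add up to at most C(m, 2) if k ≥ 2;
-- for k = 1 Schur's test for BBᵀ suffices.
--
-- As L is symmetric, Gram–Schmidt without divisions makes the given eigenvectors orthogonal. The estimate is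
-- applied to their rational approximations, with P replaced by a slightly smaller form that still satisfies Bessel's
-- inequality exactly. Since ≤ᵣ is stable under double negation, the norms may be assumed to be bounded away from 0.

open import Level using (0ℓ)
open import Algebra.Bundles using (CommutativeRing)
open import Algebra.Structures using (IsCommutativeRing)
import Algebra.Properties.AbelianGroup
import Algebra.Properties.Ring
import Algebra.Properties.Semiring.Mult
import Algebra.Properties.Semiring.Sum
import Algebra.Solver.Ring as RingSolver
open import Algebra.Solver.Ring.AlmostCommutativeRing using (fromCommutativeRing; _-Raw-AlmostCommutative⟶_)
open import Data.Bool using (Bool; true; if_then_else_)
open import Data.Fin as Fin using (Fin; zero; suc; inject≤)
import Data.Fin.Properties as Fin
open import Data.Integer as ℤ using (ℤ; 0ℤ; 1ℤ; -1ℤ)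
import Data.Integer.Properties as ℤ
open import Data.Maybe using (Maybe; just; nothing; is-just)
open import Data.Nat as ℕ using (ℕ; zero; suc)
open import Data.Nat.Combinatorics as ℕ using (_C_)
import Data.Nat.Properties as ℕ
import Data.Nat.Solver as ℕSolver
open import Data.Product using (∃-syntax; _×_; _,_; proj₁; proj₂)
import Data.Sign as Sign
open import Data.Sum using (_⊎_; inj₁; inj₂)
open import Data.Vec as Vec using (Vec; []; _∷_; here; there)
open import Data.Vec.N-ary using (N-ary; Eq; curryⁿ; curryⁿ-cong; _$ⁿ_)
open import Function using (_∘_)
open import Relation.Binary using (Rel; IsDecTotalOrder; IsStrictTotalOrder; IsEquivalence; Tri; tri<; tri≈; tri>)
open import Relation.Binary.PropositionalEquality as ≡ using (_≡_; _≢_)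
open import Relation.Nullary using (¬_; Dec; yes; no; does; ¬?; contradiction; _×-dec_)
open import Relation.Nullary.Decidable using (decidable-stable; dec-true; dec-false)
open import Relation.Unary using (Pred; Decidable)

-- The weights w add up to at most m, and a heavy facet uses up more than 1 of this. So a heavy
-- facets leave at most m - a for the light ones, and the stars have to fit into the difference of
-- C(m, 2) and C(m - a, 2). The threshold 1 is also the upper bound on w under which a linear
-- function is maximal at an indicator. Passing to an indicator is essential: l ≤ 1 + C(l, 2) holds
-- for natural numbers l, but not between 1 and 2. Such arguments decide whether a weight exceeds 1,
-- whether a sum vanishes and which entry is largest, and Cauchy reals do not allow these decisions.
-- The combinatorial part therefore works over an ordered field with decidable order and is applied
-- to ℚ. The Laplacian has integer entries, so that only eigenvectors and eigenvalues are
-- approximated. Orthogonality is then lost, and the squared norms are enlarged by k times the total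
-- orthogonality error to keep Bessel's inequality exact. Inequalities with binomial coefficients
-- are doubled, since 2 C(m, 2) = m² - m is a polynomial.

2*[nC2]+n : ∀ n → 2 ℕ.* (n C 2) ℕ.+ n ≡ n ℕ.* n
2*[nC2]+n zero    = ≡.refl
2*[nC2]+n (suc n) = begin
  2 ℕ.* (suc n C 2) ℕ.+ suc n                 ≡⟨ ≡.cong (λ c → 2 ℕ.* c ℕ.+ suc n) (ℕ.nCk+nC[k+1]≡[n+1]C[k+1] n 1) ⟨
  2 ℕ.* (n C 1 ℕ.+ n C 2) ℕ.+ suc n           ≡⟨ ≡.cong (λ c → 2 ℕ.* (c ℕ.+ n C 2) ℕ.+ suc n) (ℕ.nC1≡n n) ⟩
  2 ℕ.* (n ℕ.+ n C 2) ℕ.+ suc n               ≡⟨ solve 2 (λ n c → con 2 :* (n :+ c) :+ (con 1 :+ n) :=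
                                                   (con 2 :* c :+ n) :+ (con 1 :+ con 2 :* n)) ≡.refl n (n C 2) ⟩
  (2 ℕ.* (n C 2) ℕ.+ n) ℕ.+ (1 ℕ.+ 2 ℕ.* n)   ≡⟨ ≡.cong (ℕ._+ (1 ℕ.+ 2 ℕ.* n)) (2*[nC2]+n n) ⟩
  n ℕ.* n ℕ.+ (1 ℕ.+ 2 ℕ.* n)                 ≡⟨ solve 1 (λ n → n :* n :+ (con 1 :+ con 2 :* n) := (con 1 :+ n) :* (con 1 :+ n)) ≡.refl n ⟩
  suc n ℕ.* suc n                             ∎
  where
  open ≡.≡-Reasoning
  open ℕSolver.+-*-Solver

-- Polynomial identities in commutative rings

infix  9 :-_
infixl 8 _:*_
infixl 7 _:+_ _:-_
infix  4 _:=_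

-- Expressions do not mention a ring, so that one notation serves the integers, the ordered field
-- and the Cauchy reals.
data Expr (n : ℕ) : Set where
  var            : Fin n → Expr n
  :ι             : ℕ → Expr n
  _:+_ _:*_ _:-_ : Expr n → Expr n → Expr n
  :-_            : Expr n → Expr n

_:=_ : ∀ {n} → Expr n → Expr n → Expr n × Expr n
_:=_ = _,_

module IntegerSolver {c ℓ} (R : CommutativeRing c ℓ) where
  open CommutativeRing R
  open Algebra.Properties.Ring ring
  open Algebra.Properties.AbelianGroup +-abelianGroup using (⁻¹-∙-comm)
  open Algebra.Properties.Semiring.Mult semiring renaming (_×_ to _·_)
  open import Relation.Binary.Reasoning.Setoid setoid

  -- The canonical homomorphism from ℤ. Besides interpreting the coefficients of the solver, it
  -- carries incidence numbers and Laplacian entries into the field.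
  ⟦_⟧ℤ : ℤ → Carrier
  ⟦ ℤ.+ n ⟧ℤ      = n · 1#
  ⟦ ℤ.-[1+ n ] ⟧ℤ = - (suc n · 1#)

  -‿homo : ∀ i → ⟦ ℤ.- i ⟧ℤ ≈ - ⟦ i ⟧ℤ
  -‿homo (ℤ.+ zero)  = sym -0#≈0#
  -‿homo (ℤ.+ suc n) = refl
  -‿homo ℤ.-[1+ n ]  = sym (-‿involutive (suc n · 1#))

  ⊖-homo : ∀ m n → ⟦ m ℤ.⊖ n ⟧ℤ ≈ m · 1# - n · 1#
  ⊖-homo m zero = begin
    m · 1#        ≈⟨ +-identityʳ _ ⟨
    m · 1# + 0#   ≈⟨ +-congˡ -0#≈0# ⟨
    m · 1# - 0#   ∎
  ⊖-homo zero (suc n) = sym (+-identityˡ _)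
  ⊖-homo (suc m) (suc n) = begin
    ⟦ suc m ℤ.⊖ suc n ⟧ℤ                    ≡⟨ ≡.cong ⟦_⟧ℤ (ℤ.[1+m]⊖[1+n]≡m⊖n m n) ⟩
    ⟦ m ℤ.⊖ n ⟧ℤ                            ≈⟨ ⊖-homo m n ⟩
    m · 1# - n · 1#                         ≈⟨ +-congʳ (+-identityʳ (m · 1#)) ⟨
    m · 1# + 0# - n · 1#                    ≈⟨ +-congʳ (+-congˡ (-‿inverseʳ 1#)) ⟨
    m · 1# + (1# - 1#) - n · 1#             ≈⟨ +-congʳ (+-assoc _ _ _) ⟨
    m · 1# + 1# - 1# - n · 1#               ≈⟨ +-assoc _ _ _ ⟩
    m · 1# + 1# + (- 1# - n · 1#)           ≈⟨ +-cong (+-comm _ _) (⁻¹-∙-comm 1# (n · 1#)) ⟩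
    suc m · 1# - suc n · 1#                 ∎

  +-homo : ∀ i j → ⟦ i ℤ.+ j ⟧ℤ ≈ ⟦ i ⟧ℤ + ⟦ j ⟧ℤ
  +-homo (ℤ.+ m)    (ℤ.+ n)    = ×-homo-+ 1# m n
  +-homo (ℤ.+ m)    ℤ.-[1+ n ] = ⊖-homo m (suc n)
  +-homo ℤ.-[1+ m ] (ℤ.+ n)    = trans (⊖-homo n (suc m)) (+-comm _ _)
  +-homo ℤ.-[1+ m ] ℤ.-[1+ n ] = begin
    - (suc (suc (m ℕ.+ n)) · 1#)       ≡⟨ ≡.cong (λ l → - (suc l · 1#)) (ℕ.+-suc m n) ⟨
    - ((suc m ℕ.+ suc n) · 1#)         ≈⟨ -‿cong (×-homo-+ 1# (suc m) (suc n)) ⟩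
    - (suc m · 1# + suc n · 1#)        ≈⟨ ⁻¹-∙-comm _ _ ⟨
    - (suc m · 1#) - suc n · 1#        ∎

  private
    ×-homo-*′ : ∀ m n → (m · 1#) * (n · 1#) ≈ (m ℕ.* n) · 1#
    ×-homo-*′ m n = idem-×-homo-* m n (*-identityˡ 1#)

    -◃-homo : ∀ n → ⟦ Sign.- ℤ.◃ n ⟧ℤ ≈ - (n · 1#)
    -◃-homo zero    = sym -0#≈0#
    -◃-homo (suc n) = refl

    +◃-homo : ∀ n → ⟦ Sign.+ ℤ.◃ n ⟧ℤ ≈ n · 1#
    +◃-homo zero    = refl
    +◃-homo (suc n) = refl

  *-homo : ∀ i j → ⟦ i ℤ.* j ⟧ℤ ≈ ⟦ i ⟧ℤ * ⟦ j ⟧ℤ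
  *-homo (ℤ.+ m) (ℤ.+ n) = trans (+◃-homo (m ℕ.* n)) (sym (×-homo-*′ m n))
  *-homo (ℤ.+ m) ℤ.-[1+ n ] = begin
    ⟦ Sign.- ℤ.◃ (m ℕ.* suc n) ⟧ℤ    ≈⟨ -◃-homo (m ℕ.* suc n) ⟩
    - ((m ℕ.* suc n) · 1#)           ≈⟨ -‿cong (×-homo-*′ m (suc n)) ⟨
    - ((m · 1#) * (suc n · 1#))      ≈⟨ -‿distribʳ-* _ _ ⟩
    (m · 1#) * - (suc n · 1#)        ∎
  *-homo ℤ.-[1+ m ] (ℤ.+ n) = begin
    ⟦ Sign.- ℤ.◃ (suc m ℕ.* n) ⟧ℤ    ≈⟨ -◃-homo (suc m ℕ.* n) ⟩
    - ((suc m ℕ.* n) · 1#)           ≈⟨ -‿cong (×-homo-*′ (suc m) n) ⟨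
    - ((suc m · 1#) * (n · 1#))      ≈⟨ -‿distribˡ-* _ _ ⟩
    - (suc m · 1#) * (n · 1#)        ∎
  *-homo ℤ.-[1+ m ] ℤ.-[1+ n ] = begin
    ⟦ Sign.+ ℤ.◃ (suc m ℕ.* suc n) ⟧ℤ   ≈⟨ +◃-homo (suc m ℕ.* suc n) ⟩
    (suc m ℕ.* suc n) · 1#              ≈⟨ ×-homo-*′ (suc m) (suc n) ⟨
    (suc m · 1#) * (suc n · 1#)         ≈⟨ -‿involutive _ ⟨
    - - ((suc m · 1#) * (suc n · 1#))   ≈⟨ -‿cong (-‿distribʳ-* _ _) ⟩
    - ((suc m · 1#) * - (suc n · 1#))   ≈⟨ -‿distribˡ-* _ _ ⟩
    - (suc m · 1#) * - (suc n · 1#)     ∎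

  -- Agrees with ⟦_⟧ℤ, but makes the constant 1 of the solver denote 1# instead of 1# + 0#.
  ⟦_⟧₁ : ℤ → Carrier
  ⟦ ℤ.+ 1 ⟧₁ = 1#
  ⟦ i ⟧₁   = ⟦ i ⟧ℤ

  ⟦⟧₁≈⟦⟧ℤ : ∀ i → ⟦ i ⟧₁ ≈ ⟦ i ⟧ℤ
  ⟦⟧₁≈⟦⟧ℤ (ℤ.+ 0)           = refl
  ⟦⟧₁≈⟦⟧ℤ (ℤ.+ 1)           = sym (+-identityʳ 1#)
  ⟦⟧₁≈⟦⟧ℤ (ℤ.+ suc (suc n)) = refl
  ⟦⟧₁≈⟦⟧ℤ ℤ.-[1+ n ]        = refl

  private
    coeff≟ : ∀ i j → Maybe (⟦ i ⟧₁ ≈ ⟦ j ⟧₁)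
    coeff≟ i j with i ℤ.≟ j
    ... | yes ≡.refl = just refl
    ... | no  _      = nothing

  private
    ℤ⟶R : ℤ.+-*-rawRing -Raw-AlmostCommutative⟶ fromCommutativeRing R
    ℤ⟶R = record
      { ⟦_⟧    = ⟦_⟧₁
      ; +-homo = λ i j → trans (⟦⟧₁≈⟦⟧ℤ (i ℤ.+ j)) (trans (+-homo i j)
                   (sym (+-cong (⟦⟧₁≈⟦⟧ℤ i) (⟦⟧₁≈⟦⟧ℤ j))))
      ; *-homo = λ i j → trans (⟦⟧₁≈⟦⟧ℤ (i ℤ.* j)) (trans (*-homo i j)
                   (sym (*-cong (⟦⟧₁≈⟦⟧ℤ i) (⟦⟧₁≈⟦⟧ℤ j))))
      ; -‿homo = λ i → trans (⟦⟧₁≈⟦⟧ℤ (ℤ.- i)) (trans (-‿homo i) (sym (-‿cong (⟦⟧₁≈⟦⟧ℤ i))))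
      ; 0-homo = refl
      ; 1-homo = refl
      }

    module Ring = RingSolver ℤ.+-*-rawRing (fromCommutativeRing R) ℤ⟶R coeff≟

  private
    polynomial : ∀ {n} → Expr n → Ring.Polynomial n
    polynomial (var i)  = Ring.var i
    polynomial (:ι k)   = Ring.con (ℤ.+ k)
    polynomial (p :+ q) = polynomial p Ring.:+ polynomial q
    polynomial (p :* q) = polynomial p Ring.:* polynomial q
    polynomial (p :- q) = polynomial p Ring.:- polynomial q
    polynomial (:- p)   = Ring.:- polynomial p

  eval : ∀ {n} → Expr n → Vec Carrier n → Carrier
  eval (var i)  ρ = Vec.lookup ρ i
  eval (:ι k)   ρ = ⟦ ℤ.+ k ⟧₁
  eval (p :+ q) ρ = eval p ρ + eval q ρ
  eval (p :* q) ρ = eval p ρ * eval q ρ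
  eval (p :- q) ρ = eval p ρ - eval q ρ
  eval (:- p)   ρ = - eval p ρ

  private
    polynomial-correct : ∀ {n} (p : Expr n) ρ → Ring.⟦ polynomial p ⟧ ρ ≡ eval p ρ
    polynomial-correct (var i)  ρ = ≡.refl
    polynomial-correct (:ι k)   ρ = ≡.refl
    polynomial-correct (p :+ q) ρ = ≡.cong₂ _+_ (polynomial-correct p ρ) (polynomial-correct q ρ)
    polynomial-correct (p :* q) ρ = ≡.cong₂ _*_ (polynomial-correct p ρ) (polynomial-correct q ρ)
    polynomial-correct (p :- q) ρ = ≡.cong₂ _-_ (polynomial-correct p ρ) (polynomial-correct q ρ)
    polynomial-correct (:- p)   ρ = ≡.cong -_ (polynomial-correct p ρ)

  sameNormalForm : ∀ {n} → Expr n × Expr n → Bool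
  sameNormalForm (p , q) = is-just (Ring.normalise (polynomial p) Ring.≟N Ring.normalise (polynomial q))

  private
    sound : ∀ {n} (e : Expr n × Expr n) → sameNormalForm e ≡ true → ∀ ρ → eval (proj₁ e) ρ ≈ eval (proj₂ e) ρ
    sound (p , q) same ρ with Ring.normalise (polynomial p) Ring.≟N Ring.normalise (polynomial q)
    ... | just p≈q = begin
      eval p ρ                                 ≡⟨ polynomial-correct p ρ ⟨
      Ring.⟦ polynomial p ⟧ ρ                  ≈⟨ Ring.correct (polynomial p) ρ ⟨
      Ring.⟦ Ring.normalise (polynomial p) ⟧N ρ ≈⟨ Ring.⟦ p≈q ⟧N-cong ρ ⟩
      Ring.⟦ Ring.normalise (polynomial q) ⟧N ρ ≈⟨ Ring.correct (polynomial q) ρ ⟩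
      Ring.⟦ polynomial q ⟧ ρ                  ≡⟨ polynomial-correct q ρ ⟩
      eval q ρ                                 ∎
    sound (p , q) () ρ | nothing

  close : ∀ n → N-ary n (Expr n) (Expr n × Expr n) → Expr n × Expr n
  close n f = f $ⁿ Vec.map var (Vec.allFin n)

  -- The normal forms are compared by evaluation, so that large normal forms never occur in types.
  solve : ∀ n (f : N-ary n (Expr n) (Expr n × Expr n)) → sameNormalForm (close n f) ≡ true →
    Eq n _≈_ (curryⁿ (eval (proj₁ (close n f)))) (curryⁿ (eval (proj₂ (close n f))))
  solve n f same = curryⁿ-cong _≈_ (eval (proj₁ (close n f))) (eval (proj₂ (close n f))) (sound (close n f) same)

-- Orthogonal eigenvectors of a symmetric matrix

module GramSchmidt (R : CommutativeRing 0ℓ 0ℓ) where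

  open CommutativeRing R hiding (zero)
  open Algebra.Properties.Semiring.Sum semiring
  open IntegerSolver R using (solve)
  open import Relation.Binary.Reasoning.Setoid setoid

  -- The ring will be that of the Cauchy reals, where a mere proof of `¬ a ≈ 0#` yields no inverse.
  -- Cancellation and definiteness take the place of division.
  module Eigenvectors
    (1≉0 : ¬ 1# ≈ 0#) (cancel : ∀ a b → ¬ a ≈ 0# → a * b ≈ 0# → b ≈ 0#)
    {N : ℕ}
    (definite : (x : Fin N → Carrier) → ∑[ a < N ] (x a * x a) ≈ 0# → ∀ a → x a ≈ 0#)
    (L : Fin N → Fin N → Carrier) (L-sym : ∀ a b → L a b ≈ L b a)
    where

    V : Set
    V = Fin N → Carrier

    ⟨_,_⟩ : V → V → Carrier
    ⟨ x , y ⟩ = ∑[ a < N ] (x a * y a)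

    apply : V → V
    apply x a = ⟨ L a , x ⟩

    Eigen : Carrier → V → Set
    Eigen μ x = ∀ a → apply x a ≈ μ * x a

    span : ∀ {m} → (Fin m → Carrier) → (Fin m → V) → V
    span {m} c v a = ∑[ i < m ] (c i * v i a)

    Independent : ∀ {m} → (Fin m → V) → Set
    Independent {m} v = (c : Fin m → Carrier) → (∀ a → span c v a ≈ 0#) → ∀ i → c i ≈ 0#

    sum-linear : ∀ {n} p q (x y : Fin n → Carrier) →
      ∑[ i < n ] (p * x i - q * y i) ≈ p * sum x - q * sum y
    sum-linear {n} p q x y = begin
      ∑[ i < n ] (p * x i - q * y i)                     ≈⟨ sum-cong-≋ (λ i → solve 4 (λ p q x y → p :* x :- q :* y := p :* x :+ (:- q) :* y) ≡.refl p q (x i) (y i)) ⟩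
      ∑[ i < n ] (p * x i + (- q) * y i)                 ≈⟨ ∑-distrib-+ (λ i → p * x i) (λ i → (- q) * y i) ⟩
      ∑[ i < n ] (p * x i) + ∑[ i < n ] ((- q) * y i)    ≈⟨ +-cong (*-distribˡ-sum p x) (*-distribˡ-sum (- q) y) ⟨
      p * sum x + (- q) * sum y                          ≈⟨ solve 4 (λ p q x y → p :* x :+ (:- q) :* y := p :* x :- q :* y) ≡.refl p q (sum x) (sum y) ⟩
      p * sum x - q * sum y                              ∎

    ⟨⟩-comm : ∀ x y → ⟨ x , y ⟩ ≈ ⟨ y , x ⟩
    ⟨⟩-comm x y = sum-cong-≋ (λ a → *-comm (x a) (y a))

    ⟨⟩-linear : ∀ z p q x y → ⟨ z , (λ a → p * x a - q * y a) ⟩ ≈ p * ⟨ z , x ⟩ - q * ⟨ z , y ⟩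
    ⟨⟩-linear z p q x y = trans
      (sum-cong-≋ (λ a → solve 5 (λ z p q x y → z :* (p :* x :- q :* y) := p :* (z :* x) :- q :* (z :* y)) ≡.refl (z a) p q (x a) (y a)))
      (sum-linear p q (λ a → z a * x a) (λ a → z a * y a))

    self-adjoint : ∀ x y → ⟨ apply x , y ⟩ ≈ ⟨ x , apply y ⟩
    self-adjoint x y = begin
      ∑[ a < N ] (apply x a * y a)                      ≈⟨ sum-cong-≋ (λ a → *-distribʳ-sum (y a) (λ b → L a b * x b)) ⟩
      ∑[ a < N ] ∑[ b < N ] (L a b * x b * y a)         ≈⟨ ∑-comm (λ a b → L a b * x b * y a) ⟩
      ∑[ b < N ] ∑[ a < N ] (L a b * x b * y a)         ≈⟨ sum-cong-≋ (λ b → sum-cong-≋ (λ a → trans (*-congʳ (*-congʳ (L-sym a b)))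
                                                            (solve 3 (λ l x y → l :* x :* y := x :* (l :* y)) ≡.refl (L b a) (x b) (y a)))) ⟩
      ∑[ b < N ] ∑[ a < N ] (x b * (L b a * y a))       ≈⟨ sum-cong-≋ (λ b → *-distribˡ-sum (x b) (λ a → L b a * y a)) ⟨
      ∑[ b < N ] (x b * apply y b)                      ∎

    eigen-⟨⟩ : ∀ {μ x} → Eigen μ x → ∀ y → ⟨ y , apply x ⟩ ≈ μ * ⟨ y , x ⟩
    eigen-⟨⟩ {μ} {x} eig y = trans
      (sum-cong-≋ (λ a → trans (*-congˡ (eig a)) (solve 3 (λ y m x → y :* (m :* x) := m :* (y :* x)) ≡.refl (y a) μ (x a))))
      (sym (*-distribˡ-sum μ (λ a → y a * x a)))

    -- As `L` is symmetric, it can be moved from one argument of the inner product to the other, so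
    -- both eigenvalues give the same multiple of `⟨ x , y ⟩`.
    eigen-gap : ∀ {μ ν x y} → Eigen μ x → Eigen ν y → (μ - ν) * ⟨ x , y ⟩ ≈ 0#
    eigen-gap {μ} {ν} {x} {y} eμ eν = begin
      (μ - ν) * ⟨ x , y ⟩              ≈⟨ solve 3 (λ m n d → (m :- n) :* d := m :* d :- n :* d) ≡.refl μ ν ⟨ x , y ⟩ ⟩
      μ * ⟨ x , y ⟩ - ν * ⟨ x , y ⟩    ≈⟨ +-cong (trans (*-congˡ (⟨⟩-comm x y)) (sym (eigen-⟨⟩ eμ y))) (-‿cong (sym (eigen-⟨⟩ eν x))) ⟩
      ⟨ y , apply x ⟩ - ⟨ x , apply y ⟩ ≈⟨ +-congʳ (trans (⟨⟩-comm y (apply x)) (self-adjoint x y)) ⟩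
      ⟨ x , apply y ⟩ - ⟨ x , apply y ⟩ ≈⟨ -‿inverseʳ _ ⟩
      0#                               ∎

    -- The last four fields record that `w` is a nonzero multiple of `w₀` modulo the span of `u`.
    -- Together with independence this will show that `w` has nonzero norm.
    record Reduced {m} (μ₀ : Carrier) (w₀ : V) (u : Fin m → V) : Set where
      field
        w          : V
        eigen      : Eigen μ₀ w
        orthogonal : ∀ i → ⟨ w , u i ⟩ ≈ 0#
        scale      : Carrier
        scale≉0    : ¬ scale ≈ 0#
        coeff      : Fin m → Carrier
        expansion  : ∀ a → w a ≈ scale * w₀ a + span coeff u a

    -- Subtracting a projection from an eigenvector gives an eigenvector: by eigen-gap, either the eigenvalues
    -- agree or the projection vanishes, and no case distinction is needed to see this.
    reduce : ∀ {m} (μ : Fin m → Carrier) (u : Fin m → V) → (∀ i → Eigen (μ i) (u i)) →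
      (∀ i j → i ≢ j → ⟨ u i , u j ⟩ ≈ 0#) → (∀ i → ¬ ⟨ u i , u i ⟩ ≈ 0#) →
      ∀ μ₀ w₀ → Eigen μ₀ w₀ → Reduced μ₀ w₀ u
    reduce {zero} μ u eig orth nz μ₀ w₀ eig₀ = record
      { w = w₀ ; eigen = eig₀ ; orthogonal = λ () ; scale = 1# ; scale≉0 = 1≉0 ; coeff = λ ()
      ; expansion = λ a → solve 1 (λ x → x := :ι 1 :* x :+ :ι 0) ≡.refl (w₀ a) }
    reduce {suc m} μ u eig orth nz μ₀ w₀ eig₀ = record
      { w = w′ ; eigen = eigen′ ; orthogonal = orthogonal′ ; scale = n₀ * scale
      ; scale≉0 = λ e → scale≉0 (cancel n₀ scale (nz zero) e)
      ; coeff = coeff′ ; expansion = expansion′ }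
      where
      orth-tail : ∀ i j → i ≢ j → ⟨ u (suc i) , u (suc j) ⟩ ≈ 0#
      orth-tail i j i≢j = orth (suc i) (suc j) (λ { ≡.refl → i≢j ≡.refl })
      open Reduced (reduce (μ ∘ suc) (u ∘ suc) (eig ∘ suc) orth-tail (nz ∘ suc) μ₀ w₀ eig₀)
      u₀ : V
      u₀ = u zero
      n₀ b : Carrier
      n₀ = ⟨ u₀ , u₀ ⟩
      b  = ⟨ w , u₀ ⟩
      w′ : V
      w′ a = n₀ * w a - b * u₀ a

      eigen′ : Eigen μ₀ w′
      eigen′ a = begin
        apply w′ a                                   ≈⟨ ⟨⟩-linear (L a) n₀ b w u₀ ⟩
        n₀ * apply w a - b * apply u₀ a              ≈⟨ +-cong (*-congˡ (eigen a)) (-‿cong (*-congˡ (eig zero a))) ⟩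
        n₀ * (μ₀ * w a) - b * (μ zero * u₀ a)        ≈⟨ solve 6 (λ n m w b k u → n :* (m :* w) :- b :* (k :* u) := m :* (n :* w :- b :* u) :+ (m :- k) :* b :* u)
                                                          ≡.refl n₀ μ₀ (w a) b (μ zero) (u₀ a) ⟩
        μ₀ * w′ a + (μ₀ - μ zero) * b * u₀ a         ≈⟨ +-congˡ (*-congʳ (eigen-gap eigen (eig zero))) ⟩
        μ₀ * w′ a + 0# * u₀ a                        ≈⟨ solve 2 (λ x y → x :+ :ι 0 :* y := x) ≡.refl (μ₀ * w′ a) (u₀ a) ⟩
        μ₀ * w′ a                                    ∎

      ⟨w′⟩ : ∀ z → ⟨ w′ , z ⟩ ≈ n₀ * ⟨ w , z ⟩ - b * ⟨ u₀ , z ⟩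
      ⟨w′⟩ z = begin
        ⟨ w′ , z ⟩                            ≈⟨ ⟨⟩-comm w′ z ⟩
        ⟨ z , w′ ⟩                            ≈⟨ ⟨⟩-linear z n₀ b w u₀ ⟩
        n₀ * ⟨ z , w ⟩ - b * ⟨ z , u₀ ⟩        ≈⟨ +-cong (*-congˡ (⟨⟩-comm z w)) (-‿cong (*-congˡ (⟨⟩-comm z u₀))) ⟩
        n₀ * ⟨ w , z ⟩ - b * ⟨ u₀ , z ⟩        ∎

      orthogonal′ : ∀ i → ⟨ w′ , u i ⟩ ≈ 0#
      orthogonal′ zero    = trans (⟨w′⟩ u₀) (solve 2 (λ n b → n :* b :- b :* n := :ι 0) ≡.refl n₀ b)
      orthogonal′ (suc i) = begin
        ⟨ w′ , u (suc i) ⟩                                     ≈⟨ ⟨w′⟩ (u (suc i)) ⟩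
        n₀ * ⟨ w , u (suc i) ⟩ - b * ⟨ u₀ , u (suc i) ⟩        ≈⟨ +-cong (*-congˡ (orthogonal i)) (-‿cong (*-congˡ (orth zero (suc i) λ ()))) ⟩
        n₀ * 0# - b * 0#                                       ≈⟨ solve 2 (λ n b → n :* :ι 0 :- b :* :ι 0 := :ι 0) ≡.refl n₀ b ⟩
        0#                                                     ∎

      coeff′ : Fin (suc m) → Carrier
      coeff′ zero    = - b
      coeff′ (suc i) = n₀ * coeff i

      expansion′ : ∀ a → w′ a ≈ n₀ * scale * w₀ a + span coeff′ u a
      expansion′ a = begin
        n₀ * w a - b * u₀ a
          ≈⟨ +-congʳ (*-congˡ (expansion a)) ⟩
        n₀ * (scale * w₀ a + span coeff (u ∘ suc) a) - b * u₀ a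
          ≈⟨ solve 6 (λ n s w t b u → n :* (s :* w :+ t) :- b :* u := n :* s :* w :+ ((:- b) :* u :+ n :* t)) ≡.refl
               n₀ scale (w₀ a) (span coeff (u ∘ suc) a) b (u₀ a) ⟩
        n₀ * scale * w₀ a + ((- b) * u₀ a + n₀ * span coeff (u ∘ suc) a)
          ≈⟨ +-congˡ (+-congˡ (trans (*-distribˡ-sum n₀ (λ i → coeff i * u (suc i) a))
               (sum-cong-≋ (λ i → sym (*-assoc n₀ (coeff i) (u (suc i) a)))))) ⟩
        n₀ * scale * w₀ a + span coeff′ u a ∎

    record OrthogonalEigenvectors {m} (μ : Fin m → Carrier) (v : Fin m → V) : Set where
      field
        u          : Fin m → V
        eigen      : ∀ i → Eigen (μ i) (u i)
        orthogonal : ∀ i j → i ≢ j → ⟨ u i , u j ⟩ ≈ 0#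
        nonzero    : ∀ i → ¬ ⟨ u i , u i ⟩ ≈ 0#
        coeff      : Fin m → Fin m → Carrier
        expansion  : ∀ i a → u i a ≈ span (coeff i) v a

    -- The tail is made orthogonal before `v zero` is reduced against it. A reduction keeps the
    -- eigenvalue, so the new vectors belong to the same list `μ` in the same order.
    gramSchmidt : ∀ {m} (μ : Fin m → Carrier) (v : Fin m → V) → (∀ i → Eigen (μ i) (v i)) → Independent v →
      OrthogonalEigenvectors μ v
    gramSchmidt {zero} μ v eig ind = record
      { u = λ () ; eigen = λ () ; orthogonal = λ () ; nonzero = λ () ; coeff = λ () ; expansion = λ () }
    gramSchmidt {suc m} μ v eig ind = record
      { u = u′ ; eigen = λ { zero → R₀.eigen ; (suc i) → eigen i } ; orthogonal = orthogonal′
      ; nonzero = λ { zero → nonzero₀ ; (suc i) → nonzero i }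
      ; coeff = λ { zero → coeff₀ ; (suc i) → λ { zero → 0# ; (suc l) → coeff i l } }
      ; expansion = λ { zero → expansion₀ ; (suc i) a → trans (expansion i a)
          (solve 2 (λ x y → x := :ι 0 :* y :+ x) ≡.refl (span (coeff i) (v ∘ suc) a) (v zero a)) } }
      where
      ind-tail : Independent (v ∘ suc)
      ind-tail c h i = ind (λ { zero → 0# ; (suc l) → c l })
        (λ a → trans (solve 2 (λ x y → :ι 0 :* y :+ x := x) ≡.refl (span c (v ∘ suc) a) (v zero a)) (h a)) (suc i)

      open OrthogonalEigenvectors (gramSchmidt (μ ∘ suc) (v ∘ suc) (eig ∘ suc) ind-tail)
      module R₀ = Reduced (reduce (μ ∘ suc) u eigen orthogonal nonzero (μ zero) (v zero) (eig zero))

      u′ : Fin (suc m) → V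
      u′ zero    = R₀.w
      u′ (suc i) = u i

      orthogonal′ : ∀ i j → i ≢ j → ⟨ u′ i , u′ j ⟩ ≈ 0#
      orthogonal′ zero    zero    i≢j = contradiction ≡.refl i≢j
      orthogonal′ zero    (suc j) _   = R₀.orthogonal j
      orthogonal′ (suc i) zero    _   = trans (⟨⟩-comm (u i) R₀.w) (R₀.orthogonal i)
      orthogonal′ (suc i) (suc j) i≢j = orthogonal i j (i≢j ∘ ≡.cong suc)

      coeff₀ : Fin (suc m) → Carrier
      coeff₀ zero    = R₀.scale
      coeff₀ (suc l) = ∑[ i < m ] (R₀.coeff i * coeff i l)

      expansion₀ : ∀ a → R₀.w a ≈ span coeff₀ v a
      expansion₀ a = trans (R₀.expansion a) (+-congˡ (begin
        ∑[ i < m ] (R₀.coeff i * u i a)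
          ≈⟨ sum-cong-≋ (λ i → trans (*-congˡ (expansion i a)) (*-distribˡ-sum (R₀.coeff i) (λ l → coeff i l * v (suc l) a))) ⟩
        ∑[ i < m ] ∑[ l < m ] (R₀.coeff i * (coeff i l * v (suc l) a))
          ≈⟨ ∑-comm (λ i l → R₀.coeff i * (coeff i l * v (suc l) a)) ⟩
        ∑[ l < m ] ∑[ i < m ] (R₀.coeff i * (coeff i l * v (suc l) a))
          ≈⟨ sum-cong-≋ (λ l → trans (sum-cong-≋ (λ i → sym (*-assoc (R₀.coeff i) (coeff i l) (v (suc l) a))))
               (sym (*-distribʳ-sum (v (suc l) a) (λ i → R₀.coeff i * coeff i l)))) ⟩
        ∑[ l < m ] ((∑[ i < m ] (R₀.coeff i * coeff i l)) * v (suc l) a) ∎))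

      nonzero₀ : ¬ ⟨ R₀.w , R₀.w ⟩ ≈ 0#
      -- By `definite`, a vector of norm 0 would be a vanishing combination of the independent `v`,
      -- whose leading coefficient is `scale`.
      nonzero₀ e = R₀.scale≉0 (ind coeff₀ (λ a → trans (sym (expansion₀ a)) (definite R₀.w e a)) zero)

open ≡ using (refl; sym; trans; cong; cong₂; subst; subst₂; module ≡-Reasoning)

-- Finite sums over an ordered field

record OrderedField : Set₁ where
  infix  8 -_
  infixl 7 _*_
  infixl 6 _+_
  infix  4 _≤_
  field
    Carrier           : Set
    _+_ _*_           : Carrier → Carrier → Carrier
    -_                : Carrier → Carrier
    0# 1#             : Carrier
    isCommutativeRing : IsCommutativeRing _≡_ _+_ _*_ -_ 0# 1#
    _≤_               : Rel Carrier 0ℓ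
    isDecTotalOrder   : IsDecTotalOrder _≡_ _≤_
    +-monoˡ-≤         : ∀ z {x y} → x ≤ y → x + z ≤ y + z
    *-nonNeg          : ∀ {x y} → 0# ≤ x → 0# ≤ y → 0# ≤ x * y
    1≰0               : ¬ 1# ≤ 0#
    inverse           : ∀ x → ¬ x ≡ 0# → ∃[ y ] x * y ≡ 1#

  commutativeRing : CommutativeRing 0ℓ 0ℓ
  commutativeRing = record { isCommutativeRing = isCommutativeRing }

module OrderedFieldProperties (K : OrderedField) where
  open OrderedField K public
  open CommutativeRing commutativeRing public
    using (_-_; +-comm; +-assoc; *-comm; *-assoc; +-identityˡ; +-identityʳ; *-identityˡ;
           *-identityʳ; zeroˡ; zeroʳ; distribˡ; semiring)
  open IsDecTotalOrder isDecTotalOrder public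
    using (_≟_; _≤?_; total; antisym) renaming (refl to ≤-refl; reflexive to ≤-reflexive; trans to ≤-trans)
  open Algebra.Properties.Semiring.Sum semiring public
    using (sum; sum-cong-≗; ∑-distrib-+; ∑-comm; *-distribˡ-sum; *-distribʳ-sum; sum-syntax; sum-replicate-zero)
  open Algebra.Properties.Semiring.Mult semiring public using (×-homo-+; idem-×-homo-*) renaming (_×_ to _·_)
  open IntegerSolver commutativeRing public

  ι : ℕ → Carrier
  ι n = n · 1#

  infix 9 _²
  _² : Carrier → Carrier
  x ² = x * x

  ≤-by : ∀ {x y} d → 0# ≤ d → x + d ≡ y → x ≤ y
  ≤-by {x} {y} d 0≤d refl = subst (_≤ x + d) (+-identityˡ x)
    (subst (0# + x ≤_) (+-comm d x) (+-monoˡ-≤ x 0≤d))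

  x≤y⇒0≤y-x : ∀ {x y} → x ≤ y → 0# ≤ y - x
  x≤y⇒0≤y-x {x} {y} x≤y =
    subst (_≤ y - x) (solve 1 (λ x → x :- x := :ι 0) refl x) (+-monoˡ-≤ (- x) x≤y)

  +-nonNeg : ∀ {x y} → 0# ≤ x → 0# ≤ y → 0# ≤ x + y
  +-nonNeg {x} {y} p q = ≤-trans p (≤-by y q refl)

  +-mono-≤ : ∀ {x y u v} → x ≤ y → u ≤ v → x + u ≤ y + v
  +-mono-≤ {x} {y} {u} {v} p q = ≤-by (y - x + (v - u)) (+-nonNeg (x≤y⇒0≤y-x p) (x≤y⇒0≤y-x q))
    (solve 4 (λ x y u v → x :+ u :+ (y :- x :+ (v :- u)) := y :+ v) refl x y u v)

  *-monoˡ-≤ : ∀ z {x y} → 0# ≤ z → x ≤ y → z * x ≤ z * y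
  *-monoˡ-≤ z {x} {y} 0≤z p = ≤-by (z * (y - x)) (*-nonNeg 0≤z (x≤y⇒0≤y-x p))
    (solve 3 (λ z x y → z :* x :+ z :* (y :- x) := z :* y) refl z x y)

  neg-nonNeg : ∀ {x} → x ≤ 0# → 0# ≤ - x
  neg-nonNeg {x} p = subst (0# ≤_) (+-identityˡ (- x)) (x≤y⇒0≤y-x p)

  ²-nonNeg : ∀ x → 0# ≤ x ²
  ²-nonNeg x with total 0# x
  ... | inj₁ p = *-nonNeg p p
  ... | inj₂ p = subst (0# ≤_) (solve 1 (λ x → :- x :* :- x := x :* x) refl x)
                   (*-nonNeg (neg-nonNeg p) (neg-nonNeg p))

  0≤1 : 0# ≤ 1#
  0≤1 = subst (0# ≤_) (*-identityˡ 1#) (²-nonNeg 1#)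

  ι-nonNeg : ∀ n → 0# ≤ ι n
  ι-nonNeg zero    = ≤-refl
  ι-nonNeg (suc n) = +-nonNeg 0≤1 (ι-nonNeg n)

  ι-mono-≤ : ∀ {m n} → m ℕ.≤ n → ι m ≤ ι n
  ι-mono-≤ {n = n} ℕ.z≤n       = ι-nonNeg n
  ι-mono-≤         (ℕ.s≤s m≤n) = +-mono-≤ ≤-refl (ι-mono-≤ m≤n)

  ι-cancel-≤ : ∀ {m n} → ι m ≤ ι n → m ℕ.≤ n
  ι-cancel-≤ {m} {n} p with m ℕ.≤? n
  ... | yes q = q
  ... | no ¬q = contradiction
    (≤-by (ι n - ι (suc n) + 0#)
      (subst (0# ≤_) (sym (+-identityʳ _)) (x≤y⇒0≤y-x (≤-trans (ι-mono-≤ (ℕ.≰⇒> ¬q)) p)))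
      (solve 1 (λ x → :ι 1 :+ (x :- (:ι 1 :+ x) :+ :ι 0) := :ι 0) refl (ι n))) 1≰0

  ι-+ : ∀ m n → ι (m ℕ.+ n) ≡ ι m + ι n
  ι-+ m n = ×-homo-+ 1# m n

  ι-* : ∀ m n → ι (m ℕ.* n) ≡ ι m * ι n
  ι-* m n = sym (idem-×-homo-* m n (*-identityˡ 1#))

  inverse-nonNeg : ∀ {x y} → 0# ≤ x → x * y ≡ 1# → 0# ≤ y
  inverse-nonNeg {x} {y} 0≤x xy≡1 = subst (0# ≤_) eq (*-nonNeg 0≤x (²-nonNeg y))
    where
    eq : x * (y * y) ≡ y
    eq = trans (sym (*-assoc x y y)) (trans (cong (_* y) xy≡1) (*-identityˡ y))

  *-cancelˡ-≤ : ∀ z {x y} → 0# ≤ z → z ≢ 0# → z * x ≤ z * y → x ≤ y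
  *-cancelˡ-≤ z {x} {y} 0≤z z≢0 p with inverse z z≢0
  ... | v , zv≡1 = subst₂ _≤_ (eq x) (eq y) (*-monoˡ-≤ v (inverse-nonNeg 0≤z zv≡1) p)
    where
    eq : ∀ u → v * (z * u) ≡ u
    eq u = trans (solve 3 (λ v z u → v :* (z :* u) := z :* v :* u) refl v z u)
             (trans (cong (_* u) zv≡1) (*-identityˡ u))

  1≤x⇒x≢0 : ∀ {x} → 1# ≤ x → x ≢ 0#
  1≤x⇒x≢0 p refl = 1≰0 p

  1≤ι : ∀ n → 1# ≤ ι (suc n)
  1≤ι n = ≤-by (ι n) (ι-nonNeg n) refl

  sum-mono : ∀ {n} {f g : Fin n → Carrier} → (∀ i → f i ≤ g i) → sum f ≤ sum g
  sum-mono {zero}  h = ≤-refl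
  sum-mono {suc n} h = +-mono-≤ (h zero) (sum-mono (h ∘ suc))

  sum-nonNeg : ∀ {n} {f : Fin n → Carrier} → (∀ i → 0# ≤ f i) → 0# ≤ sum f
  sum-nonNeg {zero}  h = ≤-refl
  sum-nonNeg {suc n} h = +-nonNeg (h zero) (sum-nonNeg (h ∘ suc))

  sum-zero : ∀ {n} {f : Fin n → Carrier} → (∀ i → f i ≡ 0#) → sum f ≡ 0#
  sum-zero {n} h = trans (sum-cong-≗ h) (sum-replicate-zero n)

  sum-sub : ∀ {n} (f g : Fin n → Carrier) → ∑[ i < n ] (f i - g i) ≡ sum f - sum g
  sum-sub {zero}  f g = solve 0 (:ι 0 := :ι 0 :- :ι 0) refl
  sum-sub {suc n} f g = trans (cong ((f zero - g zero) +_) (sum-sub (f ∘ suc) (g ∘ suc)))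
    (solve 4 (λ a b c d → a :- b :+ (c :- d) := a :+ c :- (b :+ d)) refl
       (f zero) (g zero) (sum (f ∘ suc)) (sum (g ∘ suc)))

  sum-const : ∀ n x → ∑[ i < n ] x ≡ ι n * x
  sum-const zero    x = sym (zeroˡ x)
  sum-const (suc n) x = trans (cong (x +_) (sum-const n x))
    (solve 2 (λ x y → x :+ y :* x := (:ι 1 :+ y) :* x) refl x (ι n))

  sum-* : ∀ {m n} (f : Fin m → Carrier) (g : Fin n → Carrier) →
          ∑[ i < m ] ∑[ j < n ] (f i * g j) ≡ sum f * sum g
  sum-* f g = trans (sum-cong-≗ (λ i → sym (*-distribˡ-sum (f i) g))) (sym (*-distribʳ-sum (sum g) f))

  sum-single : ∀ {n} (f : Fin n → Carrier) i → (∀ j → j ≢ i → f j ≡ 0#) → sum f ≡ f i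
  sum-single f zero    h = trans (cong (f zero +_) (sum-zero (λ j → h (suc j) λ ())))
                             (+-identityʳ (f zero))
  sum-single f (suc i) h = trans
    (cong₂ _+_ (h zero λ ()) (sum-single (f ∘ suc) i (λ j j≢i → h (suc j) (j≢i ∘ Fin.suc-injective))))
    (+-identityˡ (f (suc i)))

  AtMostOne : ∀ {n} → (Fin n → Carrier) → Set
  AtMostOne f = ∀ i j → f i ≢ 0# → f j ≢ 0# → i ≡ j

  atMostOne : ∀ {n} (f : Fin n → Carrier) → AtMostOne f →
              (∀ i → f i ≡ 0#) ⊎ (∃[ i ] (∀ j → j ≢ i → f j ≡ 0#))
  atMostOne f h with Fin.any? (λ i → ¬? (f i ≟ 0#))
  ... | no ¬∃       = inj₁ (λ i → decidable-stable (f i ≟ 0#) (λ p → ¬∃ (i , p)))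
  ... | yes (i , p) = inj₂ (i , λ j j≢i → decidable-stable (f j ≟ 0#) (λ q → j≢i (h j i q p)))

  sum-atMostOne-≤ : ∀ {n} (f : Fin n → Carrier) {c} → AtMostOne f → 0# ≤ c → (∀ i → f i ≤ c) → sum f ≤ c
  sum-atMostOne-≤ f h 0≤c f≤c with atMostOne f h
  ... | inj₁ z       = subst (_≤ _) (sym (sum-zero z)) 0≤c
  ... | inj₂ (i , z) = subst (_≤ _) (sym (sum-single f i z)) (f≤c i)

  sum-atMostOne-² : ∀ {n} (f : Fin n → Carrier) → AtMostOne f → (sum f) ² ≡ ∑[ i < n ] ((f i) ²)
  sum-atMostOne-² f h with atMostOne f h
  ... | inj₁ z       = trans (cong _² (sum-zero z)) (trans (zeroˡ 0#)
                         (sym (sum-zero (λ i → trans (cong _² (z i)) (zeroˡ 0#)))))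
  ... | inj₂ (i , z) = trans (cong _² (sum-single f i z))
                         (sym (sum-single (_² ∘ f) i (λ j p → trans (cong _² (z j p)) (zeroˡ 0#))))

  term≤sum : ∀ {n} (f : Fin n → Carrier) → (∀ i → 0# ≤ f i) → ∀ i → f i ≤ sum f
  term≤sum f h zero    = ≤-by (sum (f ∘ suc)) (sum-nonNeg (h ∘ suc)) refl
  term≤sum f h (suc i) = ≤-trans (term≤sum (f ∘ suc) (h ∘ suc) i) (≤-by (f zero) (h zero) (+-comm _ _))

  δ : ∀ {n} → Fin n → Fin n → Carrier
  δ i j = if does (i Fin.≟ j) then 1# else 0#

  δ-refl : ∀ {n} (i : Fin n) → δ i i ≡ 1#
  δ-refl i = cong (if_then 1# else 0#) (dec-true (i Fin.≟ i) refl)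

  δ-≢ : ∀ {n} {i j : Fin n} → i ≢ j → δ i j ≡ 0#
  δ-≢ {i = i} {j} i≢j = cong (if_then 1# else 0#) (dec-false (i Fin.≟ j) i≢j)

  sum-δ : ∀ {n} (i : Fin n) (f : Fin n → Carrier) → ∑[ j < n ] (δ i j * f j) ≡ f i
  sum-δ i f = trans
    (sum-single (λ j → δ i j * f j) i (λ j j≢i → trans (cong (_* f j) (δ-≢ (j≢i ∘ sym))) (zeroˡ (f j))))
    (trans (cong (_* f i) (δ-refl i)) (*-identityˡ (f i)))

  -- Inner products, Cauchy-Schwarz and indicators

  dot : ∀ {n} → (Fin n → Carrier) → (Fin n → Carrier) → Carrier
  dot {n} x y = ∑[ i < n ] (x i * y i)

  dot-nonNeg : ∀ {n} (x : Fin n → Carrier) → 0# ≤ dot x x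
  dot-nonNeg x = sum-nonNeg (λ i → ²-nonNeg (x i))

  -- Lagrange's identity: the sum `D` of squares over all ordered pairs is twice the difference of
  -- the two sides.
  cauchySchwarz : ∀ {n} (x y : Fin n → Carrier) → (dot x y) ² ≤ dot x x * dot y y
  cauchySchwarz {n} x y = *-cancelˡ-≤ (ι 2) (ι-nonNeg 2) (1≤x⇒x≢0 (1≤ι 1))
    (≤-by D (sum-nonNeg (λ i → sum-nonNeg (λ j → ²-nonNeg (x i * y j - x j * y i)))) eq)
    where
    open ≡-Reasoning
    D = ∑[ i < n ] ∑[ j < n ] ((x i * y j - x j * y i) ²)
    f g h : Fin n → Carrier
    f i = x i * x i
    g i = y i * y i
    h i = x i * y i
    Deq : D ≡ (sum f * sum g + sum g * sum f) - ι 2 * (sum h * sum h)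
    Deq = begin
      D ≡⟨ sum-cong-≗ (λ i → sum-cong-≗ (λ j →
             solve 4 (λ a b c d → (a :* b :- c :* d) :* (a :* b :- c :* d) :=
                        (a :* a :* (b :* b) :+ d :* d :* (c :* c)) :- :ι 2 :* (a :* d) :* (c :* b))
               refl (x i) (y j) (x j) (y i))) ⟩
      ∑[ i < n ] ∑[ j < n ] ((f i * g j + g i * f j) - ι 2 * h i * h j)
        ≡⟨ sum-cong-≗ (λ i → trans (sum-sub (λ j → f i * g j + g i * f j) (λ j → ι 2 * h i * h j))
             (cong₂ _-_ (∑-distrib-+ (λ j → f i * g j) (λ j → g i * f j)) refl)) ⟩
      ∑[ i < n ] ((∑[ j < n ] (f i * g j) + ∑[ j < n ] (g i * f j)) - ∑[ j < n ] (ι 2 * h i * h j))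
        ≡⟨ trans (sum-sub (λ i → ∑[ j < n ] (f i * g j) + ∑[ j < n ] (g i * f j)) _)
             (cong₂ _-_ (∑-distrib-+ (λ i → ∑[ j < n ] (f i * g j)) (λ i → ∑[ j < n ] (g i * f j))) refl) ⟩
      (∑[ i < n ] ∑[ j < n ] (f i * g j) + ∑[ i < n ] ∑[ j < n ] (g i * f j))
        - ∑[ i < n ] ∑[ j < n ] (ι 2 * h i * h j)
        ≡⟨ cong₂ _-_ (cong₂ _+_ (sum-* f g) (sum-* g f))
             (trans (sum-* (λ i → ι 2 * h i) h)
               (trans (cong (_* sum h) (sym (*-distribˡ-sum (ι 2) h))) (*-assoc (ι 2) (sum h) (sum h)))) ⟩
      (sum f * sum g + sum g * sum f) - ι 2 * (sum h * sum h) ∎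
    eq : ι 2 * (dot x y) ² + D ≡ ι 2 * (dot x x * dot y y)
    eq = trans (cong (ι 2 * (dot x y) ² +_) Deq)
      (solve 3 (λ a b c → :ι 2 :* (c :* c) :+ ((a :* b :+ b :* a) :- :ι 2 :* (c :* c))
                  := :ι 2 :* (a :* b)) refl (sum f) (sum g) (sum h))

  -- In a field these are 0 and 1. Indicators are handled through this equation because it survives
  -- products and complements and removes squares from polynomial identities.
  Idempotent : Carrier → Set
  Idempotent x = x * x ≡ x

  idem-nonNeg : ∀ {x} → Idempotent x → 0# ≤ x
  idem-nonNeg {x} h = subst (0# ≤_) h (²-nonNeg x)

  idem-1- : ∀ {x} → Idempotent x → Idempotent (1# - x)
  idem-1- {x} h = trans (solve 1 (λ x → (:ι 1 :- x) :* (:ι 1 :- x) := :ι 1 :- x :- x :+ x :* x) refl x)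
    (trans (cong (1# - x - x +_) h) (solve 1 (λ x → :ι 1 :- x :- x :+ x := :ι 1 :- x) refl x))

  idem-≤1 : ∀ {x} → Idempotent x → x ≤ 1#
  idem-≤1 {x} h = ≤-by (1# - x) (idem-nonNeg (idem-1- h))
    (solve 1 (λ x → x :+ (:ι 1 :- x) := :ι 1) refl x)

  idem-≢0 : ∀ {x} → Idempotent x → x ≢ 0# → x ≡ 1#
  idem-≢0 {x} h x≢0 with inverse x x≢0
  ... | y , xy≡1 = begin
    x            ≡⟨ *-identityʳ x ⟨
    x * 1#       ≡⟨ cong (x *_) xy≡1 ⟨
    x * (x * y)  ≡⟨ *-assoc x x y ⟨
    x * x * y    ≡⟨ cong (_* y) h ⟩
    x * y        ≡⟨ xy≡1 ⟩
    1#           ∎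
    where open ≡-Reasoning

  idem-* : ∀ {x y} → Idempotent x → Idempotent y → Idempotent (x * y)
  idem-* {x} {y} h k = trans (solve 2 (λ x y → x :* y :* (x :* y) := x :* x :* (y :* y)) refl x y)
                         (cong₂ _*_ h k)

  idem-δ : ∀ {n} (i j : Fin n) → Idempotent (δ i j)
  idem-δ i j with i Fin.≟ j
  ... | yes _ = *-identityˡ 1#
  ... | no _  = zeroˡ 0#

  -- recip 0# = 0#.
  recip : Carrier → Carrier
  recip x with x ≟ 0#
  ... | yes _  = 0#
  ... | no x≢0 = proj₁ (inverse x x≢0)

  recip-nonNeg : ∀ {x} → 0# ≤ x → 0# ≤ recip x
  recip-nonNeg {x} 0≤x with x ≟ 0#
  ... | yes _  = ≤-refl
  ... | no x≢0 = inverse-nonNeg 0≤x (proj₂ (inverse x x≢0))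

  recip-≢0 : ∀ {x} → x ≢ 0# → x * recip x ≡ 1#
  recip-≢0 {x} x≢0 with x ≟ 0#
  ... | yes x≡0 = contradiction x≡0 x≢0
  ... | no x≢0′ = proj₂ (inverse x x≢0′)

  -- By the convention for `recip 0#`, the product is the indicator of `x ≢ 0#`. In this role it
  -- will mark the faces with a heavy facet.
  recip-idem : ∀ x → Idempotent (x * recip x)
  recip-idem x with x ≟ 0#
  ... | yes x≡0 = trans (cong₂ _*_ eq eq) (trans (zeroˡ 0#) (sym eq))
    where
    eq : x * 0# ≡ 0#
    eq = zeroʳ x
  ... | no x≢0 = trans (cong₂ _*_ eq eq) (trans (*-identityˡ 1#) (sym eq))
    where
    eq : x * proj₁ (inverse x x≢0) ≡ 1#
    eq = proj₂ (inverse x x≢0)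

  two-terms≤sum : ∀ {n} (f : Fin n → Carrier) → (∀ i → 0# ≤ f i) → ∀ {i j} → i ≢ j → f i + f j ≤ sum f
  two-terms≤sum f h {zero}  {zero}  p = contradiction refl p
  two-terms≤sum f h {zero}  {suc j} p = +-mono-≤ ≤-refl (term≤sum (f ∘ suc) (h ∘ suc) j)
  two-terms≤sum f h {suc i} {zero}  p = subst (_≤ sum f) (+-comm (f zero) (f (suc i)))
    (+-mono-≤ ≤-refl (term≤sum (f ∘ suc) (h ∘ suc) i))
  two-terms≤sum f h {suc i} {suc j} p = ≤-trans (two-terms≤sum (f ∘ suc) (h ∘ suc) (p ∘ cong suc))
    (≤-by (f zero) (h zero) (+-comm _ _))

  idem-sum : ∀ {n} (f : Fin n → Carrier) → (∀ i → Idempotent (f i)) → ∃[ l ] sum f ≡ ι l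
  idem-sum {zero}  f h = 0 , refl
  idem-sum {suc n} f h with f zero ≟ 0# | idem-sum (f ∘ suc) (h ∘ suc)
  ... | yes p | l , eq = l , trans (cong₂ _+_ p eq) (+-identityˡ (ι l))
  ... | no ¬p | l , eq = suc l , cong₂ _+_ (idem-≢0 (h zero) ¬p) eq

  -- Greedy selection of the largest entries

  argmax : ∀ {n} (f : Fin n → Carrier) {Q : Fin n → Set} → (∀ i → Dec (Q i)) →
    (∀ i → ¬ Q i) ⊎ (∃[ i ] (Q i × (∀ j → Q j → f j ≤ f i)))
  argmax {zero}  f Q? = inj₁ λ ()
  argmax {suc n} f {Q} Q? with Q? zero | argmax (f ∘ suc) (Q? ∘ suc)
  ... | no ¬p | inj₁ none = inj₁ λ { zero → ¬p ; (suc i) → none i }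
  ... | no ¬p | inj₂ (i , Qi , max) = inj₂ (suc i , Qi , λ { zero Q₀ → contradiction Q₀ ¬p ; (suc j) → max j })
  ... | yes p | inj₁ none = inj₂ (zero , p , λ { zero _ → ≤-refl ; (suc j) Qj → contradiction Qj (none j) })
  ... | yes p | inj₂ (i , Qi , max) with total (f zero) (f (suc i))
  ...   | inj₁ le = inj₂ (suc i , Qi , λ { zero _ → le ; (suc j) → max j })
  ...   | inj₂ ge = inj₂ (zero , p , λ { zero _ → ≤-refl ; (suc j) Qj → ≤-trans (max j Qj) ge })

  -- An optimal solution of the linear program "maximise `dot d w` for 0 ≤ w ≤ 1 and `sum w ≤ ι l`".
  -- `threshold` is the dual variable of the last constraint, and `exhaustive` is complementary
  -- slackness for it.
  record TopSelection {n} (l : ℕ) (d : Fin n → Carrier) : Set where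
    field
      s             : Fin n → Carrier
      threshold     : Carrier
      s-idem        : ∀ i → Idempotent (s i)
      selected      : ∀ i → s i ≢ 0# → threshold ≤ d i
      unselected    : ∀ i → s i ≡ 0# → d i ≤ threshold
      0≤threshold   : 0# ≤ threshold
      size≤         : sum s ≤ ι l
      exhaustive    : sum s ≡ ι l ⊎ threshold ≡ 0#

  topSelection : ∀ {n} l (d : Fin n → Carrier) → (∀ i → 0# ≤ d i) → TopSelection l d
  -- Nothing is selected, so any upper bound of the entries can be the threshold.
  topSelection {n} zero d h = record
    { s = λ _ → 0# ; threshold = sum d ; s-idem = λ _ → zeroˡ 0# ; selected = λ _ p → contradiction refl p
    ; unselected = λ i _ → term≤sum d h i ; 0≤threshold = sum-nonNeg h
    ; size≤ = ≤-reflexive (sum-replicate-zero n) ; exhaustive = inj₁ (sum-replicate-zero n) }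
  topSelection {n} (suc l) d h with topSelection l d h
  ... | record { s = s ; threshold = t ; s-idem = s-idem ; selected = sel ; unselected = unsel
               ; 0≤threshold = 0≤t ; size≤ = size≤ ; exhaustive = exh } with argmax d (λ i → s i ≟ 0#)
  ... | inj₁ none = record
    { s = s ; threshold = 0# ; s-idem = s-idem ; selected = λ i _ → h i
    ; unselected = λ i p → contradiction p (none i) ; 0≤threshold = ≤-refl
    ; size≤ = ≤-trans size≤ (≤-by 1# 0≤1 (+-comm _ _)) ; exhaustive = inj₂ refl }
  ... | inj₂ (i , sᵢ≡0 , max) = record
    { s = s′ ; threshold = d i ; s-idem = idem′ ; selected = sel′ ; unselected = unsel′ ; 0≤threshold = h i
    ; size≤ = ≤-trans (≤-reflexive sum-s′) (+-mono-≤ ≤-refl size≤) ; exhaustive = exh′ exh }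
    where
    s′ : Fin n → Carrier
    s′ j = δ i j + s j

    idem′ : ∀ j → Idempotent (s′ j)
    idem′ j with i Fin.≟ j
    ... | yes refl = trans (cong (λ e → (1# + e) * (1# + e)) sᵢ≡0)
                       (trans (solve 0 ((:ι 1 :+ :ι 0) :* (:ι 1 :+ :ι 0) := :ι 1 :+ :ι 0) refl) (cong (1# +_) (sym sᵢ≡0)))
    ... | no _     = trans (cong₂ _*_ (+-identityˡ (s j)) (+-identityˡ (s j))) (trans (s-idem j) (sym (+-identityˡ (s j))))

    sel′ : ∀ j → s′ j ≢ 0# → d i ≤ d j
    sel′ j p with i Fin.≟ j
    ... | yes refl = ≤-refl
    ... | no _     = ≤-trans (unsel i sᵢ≡0) (sel j (λ e → p (trans (+-identityˡ (s j)) e)))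

    unsel′ : ∀ j → s′ j ≡ 0# → d j ≤ d i
    unsel′ j p with i Fin.≟ j
    ... | yes refl = ≤-refl
    ... | no _     = max j (trans (sym (+-identityˡ (s j))) p)

    sum-s′ : sum s′ ≡ 1# + sum s
    sum-s′ = trans (∑-distrib-+ (δ i) s) (cong (_+ sum s)
      (trans (sum-cong-≗ (λ j → sym (*-identityʳ (δ i j)))) (sum-δ i (λ _ → 1#))))

    exh′ : sum s ≡ ι l ⊎ t ≡ 0# → sum s′ ≡ ι (suc l) ⊎ d i ≡ 0#
    exh′ (inj₁ eq)   = inj₁ (trans sum-s′ (cong (1# +_) eq))
    exh′ (inj₂ refl) = inj₂ (antisym (unsel i sᵢ≡0) (h i))

  -- Linear programming duality: with t the threshold, the difference of the two values is the sum
  -- of all `(d i - t) * (s i - w i)` and of `t * (sum s - sum w)`, and none of these is negative.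
  topSelection-max : ∀ {n l} {d : Fin n → Carrier} (S : TopSelection l d) (w : Fin n → Carrier) →
    (∀ i → 0# ≤ w i) → (∀ i → w i ≤ 1#) → sum w ≤ ι l → dot d w ≤ dot d (TopSelection.s S)
  topSelection-max {n} {l} {d} S w 0≤w w≤1 w≤l = ≤-by (E + t * (sum s - sum w)) (+-nonNeg (sum-nonNeg e-nonNeg) (slack exhaustive)) eq
    where
    open TopSelection S renaming (threshold to t)
    e : Fin n → Carrier
    e i = (d i - t) * (s i - w i)
    E = sum e
    e-nonNeg : ∀ i → 0# ≤ e i
    e-nonNeg i with s i ≟ 0#
    ... | yes p = subst (0# ≤_) (trans (solve 3 (λ d t w → (t :- d) :* w := (d :- t) :* (:ι 0 :- w)) refl (d i) t (w i))
                    (cong (λ y → (d i - t) * (y - w i)) (sym p)))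
                    (*-nonNeg (x≤y⇒0≤y-x (unselected i p)) (0≤w i))
    ... | no ¬p = *-nonNeg (x≤y⇒0≤y-x (selected i ¬p))
                    (subst (λ y → 0# ≤ y - w i) (sym (idem-≢0 (s-idem i) ¬p)) (x≤y⇒0≤y-x (w≤1 i)))
    slack : sum s ≡ ι l ⊎ t ≡ 0# → 0# ≤ t * (sum s - sum w)
    slack (inj₁ eq) = *-nonNeg 0≤threshold (x≤y⇒0≤y-x (subst (sum w ≤_) (sym eq) w≤l))
    slack (inj₂ eq) = ≤-reflexive (sym (trans (cong (_* (sum s - sum w)) eq) (zeroˡ _)))
    E-eq : E ≡ dot d s - dot d w - t * (sum s - sum w)
    E-eq = trans (sum-cong-≗ (λ i → solve 4 (λ d t s w → (d :- t) :* (s :- w) := (d :* s :- d :* w) :- t :* (s :- w)) refl (d i) t (s i) (w i)))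
      (trans (sum-sub _ (λ i → t * (s i - w i)))
        (cong₂ _-_ (sum-sub (λ i → d i * s i) (λ i → d i * w i))
          (trans (sym (*-distribˡ-sum t (λ i → s i - w i))) (cong (t *_) (sum-sub s w)))))
    eq : dot d w + (E + t * (sum s - sum w)) ≡ dot d s
    eq = trans (cong (λ y → dot d w + (y + t * (sum s - sum w))) E-eq)
      (solve 4 (λ a b t x → b :+ (a :- b :- t :* x :+ t :* x) := a) refl (dot d s) (dot d w) t (sum s - sum w))

  -- Either the first factor is 0, or `x` is 0 and squeezes `y`. For a sum `x` of nonnegative terms,
  -- this makes every single term vanish where the sum does.
  1-recip-* : ∀ {x y} → 0# ≤ y → y ≤ x → (1# - x * recip x) * y ≡ 0#
  1-recip-* {x} {y} 0≤y y≤x = helper (x ≟ 0#)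
    where
    helper : Dec (x ≡ 0#) → (1# - x * recip x) * y ≡ 0#
    helper (yes e) = trans (cong ((1# - x * recip x) *_) (antisym (subst (y ≤_) e y≤x) 0≤y))
                       (zeroʳ (1# - x * recip x))
    helper (no ¬e) = trans (cong (λ z → (1# - z) * y) (recip-≢0 ¬e)) (solve 1 (λ y → (:ι 1 :- :ι 1) :* y := :ι 0) refl y)

  -- For an approximate eigenvector with squared norm `N` and quadratic form `Q`: the lower bound
  -- `δ` of the norm controls the error when the eigenvalue equation is divided by `N`.
  rayleigh : ∀ {μ N Q ε δ} → 0# ≤ δ → δ ≢ 0# → 0# ≤ ε → δ ≤ N → μ * N - Q ≤ δ * ε → μ ≤ recip N * Q + ε
  rayleigh {μ} {N} {Q} {ε} {d} 0≤d d≢0 0≤ε d≤N h = *-cancelˡ-≤ N 0≤N N≢0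
    (≤-by (d * ε - (μ * N - Q) + (N - d) * ε) (+-nonNeg (x≤y⇒0≤y-x h) (*-nonNeg (x≤y⇒0≤y-x d≤N) 0≤ε))
      (trans (solve 5 (λ μ N Q ε d → N :* μ :+ (d :* ε :- (μ :* N :- Q) :+ (N :- d) :* ε) := :ι 1 :* Q :+ N :* ε) refl μ N Q ε d)
        (trans (cong (λ y → y * Q + N * ε) (sym (recip-≢0 N≢0)))
          (solve 4 (λ N v Q ε → N :* v :* Q :+ N :* ε := N :* (v :* Q :+ ε)) refl N (recip N) Q ε))))
    where
    0≤N : 0# ≤ N
    0≤N = ≤-trans 0≤d d≤N
    N≢0 : N ≢ 0#
    N≢0 refl = d≢0 (antisym d≤N 0≤d)

-- The bound for the trace of the compressed Laplacian

module TraceBound (K : OrderedField) where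

  open OrderedFieldProperties K

  -- This is all that the estimates use of a complex: `B³≡B` makes the entries 0, 1 or -1, a face
  -- has at most r + 1 facets, and two facets have at most one common face. The signs are arbitrary.
  module SignedHypergraph
    {F T : ℕ} (r : ℕ) (B : Fin T → Fin F → Carrier)
    (B³≡B : ∀ τ σ → B τ σ * B τ σ * B τ σ ≡ B τ σ)
    (size : ∀ τ → ∑[ σ < F ] ((B τ σ) ²) ≤ 1# + ι r)
    (linear : ∀ {σ η τ ρ} → σ ≢ η → B τ σ ≢ 0# → B τ η ≢ 0# → B ρ σ ≢ 0# → B ρ η ≢ 0# → τ ≡ ρ)
    where

    m : Fin T → Fin F → Carrier
    m τ σ = (B τ σ) ²

    m-idem : ∀ τ σ → Idempotent (m τ σ)
    m-idem τ σ = trans (sym (*-assoc (m τ σ) (B τ σ) (B τ σ))) (cong (_* B τ σ) (B³≡B τ σ))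

    m-nonNeg : ∀ τ σ → 0# ≤ m τ σ
    m-nonNeg τ σ = ²-nonNeg (B τ σ)

    m-≢0 : ∀ {τ σ} → B τ σ ≢ 0# → m τ σ ≡ 1#
    m-≢0 {τ} {σ} p = idem-≢0 (m-idem τ σ) λ q →
      p (trans (sym (B³≡B τ σ)) (trans (cong (_* B τ σ) q) (zeroˡ (B τ σ))))

    m-≢0⁻ : ∀ {τ σ} → m τ σ ≢ 0# → B τ σ ≢ 0#
    m-≢0⁻ {τ} {σ} p q = p (trans (cong₂ _*_ q q) (zeroˡ 0#))

    O : Fin F → Fin F → Carrier
    O σ η = 1# - δ σ η

    O-idem : ∀ σ η → Idempotent (O σ η)
    O-idem σ η = idem-1- (idem-δ σ η)

    sum-O : ∀ σ f → ∑[ η < F ] (O σ η * f η) ≡ sum f - f σ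
    sum-O σ f = trans
      (sum-cong-≗ (λ η → solve 2 (λ e x → (:ι 1 :- e) :* x := x :- e :* x) refl (δ σ η) (f η)))
      (trans (sum-sub f (λ η → δ σ η * f η)) (cong (λ e → sum f - e) (sum-δ σ f)))

    -- Cauchy-Schwarz is applied to `b` and `b²x`, which have the same inner product as `b` and `x`.
    -- On the right only the coordinates in the support of `b` are left.
    signed-cauchySchwarz : ∀ {n} (b x : Fin n → Carrier) → (∀ i → b i * b i * b i ≡ b i) →
      (dot b x) ² ≤ (∑[ i < n ] ((b i) ²)) * (∑[ i < n ] ((b i) ² * (x i) ²))
    signed-cauchySchwarz {n} b x b³≡b = subst₂ _≤_
      (cong _² (sum-cong-≗ λ i → trans
        (solve 2 (λ b x → b :* (b :* b :* x) := b :* b :* b :* x) refl (b i) (x i)) (cong (_* x i) (b³≡b i))))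
      (cong (dot b b *_) (sum-cong-≗ λ i → trans
        (solve 2 (λ b x → b :* b :* x :* (b :* b :* x) := b :* b :* b :* b :* (x :* x)) refl (b i) (x i))
        (cong (λ e → e * b i * (x i) ²) (b³≡b i))))
      (cauchySchwarz b (λ i → b i * b i * x i))

    -- Weighted stars around a facet

    module Star (σ : Fin F) (g : Fin T → Carrier) (g-nonNeg : ∀ τ → 0# ≤ g τ) (g≤1 : ∀ τ → g τ ≤ 1#)
                (support : ∀ τ → g τ ≢ 0# → B τ σ ≢ 0#) (1≤r : 1 ℕ.≤ r) where

      d : Carrier
      d = sum g

      d-nonNeg : 0# ≤ d
      d-nonNeg = sum-nonNeg g-nonNeg

      rest : Fin T → Fin F → Carrier
      rest τ η = O σ η * m τ η

      z : Fin F → Carrier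
      z η = ∑[ τ < T ] (g τ * (B τ σ * B τ η))

      gm : ∀ τ → g τ * m τ σ ≡ g τ
      gm τ with g τ ≟ 0#
      ... | yes p = trans (cong (_* m τ σ) p) (trans (zeroˡ (m τ σ)) (sym p))
      ... | no ¬p = trans (cong (g τ *_) (m-≢0 (support τ ¬p))) (*-identityʳ (g τ))

      g*-mono : ∀ τ {x y} → (m τ σ ≡ 1# → x ≤ y) → g τ * x ≤ g τ * y
      g*-mono τ {x} {y} h with g τ ≟ 0#
      ... | yes p = ≤-reflexive (trans (cong (_* x) p) (trans (zeroˡ x) (sym (trans (cong (_* y) p) (zeroˡ y)))))
      ... | no ¬p = *-monoˡ-≤ (g τ) (g-nonNeg τ) (h (m-≢0 (support τ ¬p)))

      sum-rest : ∀ τ → m τ σ ≡ 1# → ∑[ η < F ] (rest τ η) ≤ ι r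
      sum-rest τ h = subst (_≤ ι r) (sym (sum-O σ (m τ)))
        (subst₂ _≤_ (cong (λ e → sum (m τ) - e) (sym h)) (solve 1 (λ x → :ι 1 :+ x :- :ι 1 := x) refl (ι r))
          (+-monoˡ-≤ (- 1#) (size τ)))

      -- At `σ` the signs cancel and the coordinate is `d`. At any other facet `linear` leaves a
      -- single summand, whose square is at most its weight because `g ≤ 1`. Every face has at most
      -- r such facets, which accounts for `d * ι r`.
      z-norm : dot z z ≤ d * (d + ι r)
      z-norm = ≤-trans (sum-mono bound) (≤-trans (≤-reflexive split) (≤-trans (+-mono-≤ ≤-refl last)
        (≤-reflexive (solve 2 (λ d r → d :* d :+ d :* r := d :* (d :+ r)) refl d (ι r)))))
        where
        c : Fin F → Carrier
        c η = ∑[ τ < T ] (g τ * m τ η)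

        zσ : z σ ≡ d
        zσ = sum-cong-≗ gm

        off : ∀ η → σ ≢ η → (z η) ² ≤ c η
        off η σ≢η = subst (_≤ c η)
          (sym (sum-atMostOne-² (λ τ → g τ * (B τ σ * B τ η)) λ τ ρ p q →
            linear σ≢η (λ e → p (trans (cong (λ b → g τ * (b * B τ η)) e) (solve 2 (λ g b → g :* (:ι 0 :* b) := :ι 0) refl (g τ) (B τ η))))
                       (λ e → p (trans (cong (λ b → g τ * (B τ σ * b)) e) (solve 2 (λ g b → g :* (b :* :ι 0) := :ι 0) refl (g τ) (B τ σ))))
                       (λ e → q (trans (cong (λ b → g ρ * (b * B ρ η)) e) (solve 2 (λ g b → g :* (:ι 0 :* b) := :ι 0) refl (g ρ) (B ρ η))))
                       (λ e → q (trans (cong (λ b → g ρ * (B ρ σ * b)) e) (solve 2 (λ g b → g :* (b :* :ι 0) := :ι 0) refl (g ρ) (B ρ σ))))))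
          (sum-mono λ τ → subst₂ _≤_
            (sym (trans (solve 3 (λ g a b → g :* (a :* b) :* (g :* (a :* b)) := g :* (a :* a) :* (g :* (b :* b))) refl (g τ) (B τ σ) (B τ η))
               (trans (cong (_* (g τ * m τ η)) (gm τ)) (*-comm (g τ) (g τ * m τ η)))))
            (*-identityʳ (g τ * m τ η))
            (*-monoˡ-≤ (g τ * m τ η) (*-nonNeg (g-nonNeg τ) (m-nonNeg τ η)) (g≤1 τ)))

        bound : ∀ η → (z η) ² ≤ δ σ η * d ² + O σ η * c η
        bound η with σ Fin.≟ η
        ... | yes refl = ≤-reflexive (trans (cong _² zσ)
                (solve 2 (λ d c → d :* d := :ι 1 :* (d :* d) :+ (:ι 1 :- :ι 1) :* c) refl d (c σ)))
        ... | no σ≢η = ≤-trans (off η σ≢η) (≤-reflexive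
                (solve 2 (λ d c → c := :ι 0 :* (d :* d) :+ (:ι 1 :- :ι 0) :* c) refl d (c η)))

        split : ∑[ η < F ] (δ σ η * d ² + O σ η * c η) ≡ d ² + ∑[ τ < T ] (g τ * ∑[ η < F ] (rest τ η))
        split = trans (∑-distrib-+ (λ η → δ σ η * d ²) (λ η → O σ η * c η)) (cong₂ _+_ (sum-δ σ (λ _ → d ²))
          (trans (sum-cong-≗ (λ η → trans (*-distribˡ-sum (O σ η) (λ τ → g τ * m τ η))
            (sum-cong-≗ (λ τ → solve 3 (λ o g m → o :* (g :* m) := g :* (o :* m)) refl (O σ η) (g τ) (m τ η)))))
            (trans (∑-comm (λ η τ → g τ * rest τ η)) (sum-cong-≗ (λ τ → sym (*-distribˡ-sum (g τ) (rest τ)))))))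

        last : ∑[ τ < T ] (g τ * ∑[ η < F ] (rest τ η)) ≤ d * ι r
        last = ≤-trans (sum-mono (λ τ → g*-mono τ (sum-rest τ))) (≤-reflexive (sym (*-distribʳ-sum (ι r) g)))

      d+r-nonNeg : 0# ≤ d + ι r
      d+r-nonNeg = +-nonNeg d-nonNeg (ι-nonNeg r)

      d+r≢0 : d + ι r ≢ 0#
      d+r≢0 = 1≤x⇒x≢0 (≤-trans (lemma 1≤r) (≤-by d d-nonNeg (+-comm (ι r) d)))
        where
        lemma : ∀ {n} → 1 ℕ.≤ n → 1# ≤ ι n
        lemma {suc n} _ = 1≤ι n

      -- With d the total weight of the star, ∑ gᵤ bᵤbᵤᵀ is dominated by r times the identity plus zzᵀ / (d + r),
      -- where z = ∑ gᵤ bᵤ (signs adjusted) is the top eigenvector of an unweighted star.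
      star-form : ∀ x → (d + ι r) * ∑[ τ < T ] (g τ * (dot (B τ) x) ²) ≤
        (d + ι r) * (ι r * ((x σ) ² + ∑[ τ < T ] (g τ * ∑[ η < F ] (rest τ η * (x η) ²)))) + (dot z x) ²
      star-form x = ≤-trans
        (≤-by ((S - ι r * X) ²) (²-nonNeg (S - ι r * X)) refl)
        (≤-trans (≤-reflexive identity)
          (+-mono-≤ (*-monoˡ-≤ (d + ι r) d+r-nonNeg
            (≤-trans (+-mono-≤ ≤-refl G≤) (≤-reflexive (sym (distribˡ (ι r) (X ²) R))))) ≤-refl))
        where
        X = x σ
        D : Fin T → Carrier
        D τ = dot (λ η → O σ η * B τ η) x
        s : Fin T → Carrier
        s τ = B τ σ * D τ
        S = ∑[ τ < T ] (g τ * s τ)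
        G = ∑[ τ < T ] (g τ * (D τ) ²)
        R = ∑[ τ < T ] (g τ * ∑[ η < F ] (rest τ η * (x η) ²))

        dotB : ∀ τ → dot (B τ) x ≡ B τ σ * X + D τ
        dotB τ = trans (solve 2 (λ a b → a := b :+ (a :- b)) refl (dot (B τ) x) (B τ σ * X))
          (cong (B τ σ * X +_) (trans (sym (sum-O σ (λ η → B τ η * x η)))
            (sum-cong-≗ (λ η → sym (*-assoc (O σ η) (B τ η) (x η))))))

        term : ∀ τ → g τ * (dot (B τ) x) ² ≡ g τ * X ² + ι 2 * X * (g τ * s τ) + g τ * (D τ) ²
        term τ = trans (cong (λ e → g τ * e ²) (dotB τ)) (trans
          (solve 4 (λ g b X D → g :* ((b :* X :+ D) :* (b :* X :+ D)) :=
             g :* (b :* b) :* (X :* X) :+ :ι 2 :* X :* (g :* (b :* D)) :+ g :* (D :* D)) refl (g τ) (B τ σ) X (D τ))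
          (cong (λ e → e * X ² + ι 2 * X * (g τ * s τ) + g τ * (D τ) ²) (gm τ)))

        Q-eq : ∑[ τ < T ] (g τ * (dot (B τ) x) ²) ≡ d * X ² + ι 2 * X * S + G
        Q-eq = trans (sum-cong-≗ term) (trans (∑-distrib-+ _ (λ τ → g τ * (D τ) ²)) (cong (_+ G)
          (trans (∑-distrib-+ (λ τ → g τ * X ²) (λ τ → ι 2 * X * (g τ * s τ)))
            (cong₂ _+_ (sym (*-distribʳ-sum (X ²) g)) (sym (*-distribˡ-sum (ι 2 * X) (λ τ → g τ * s τ)))))))

        z-eq : dot z x ≡ d * X + S
        z-eq = trans (sum-cong-≗ (λ η → trans (*-distribʳ-sum (x η) (λ τ → g τ * (B τ σ * B τ η)))
                       (sum-cong-≗ (λ τ → solve 4 (λ g a b x → g :* (a :* b) :* x := g :* a :* (b :* x)) refl (g τ) (B τ σ) (B τ η) (x η)))))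
          (trans (∑-comm (λ η τ → g τ * B τ σ * (B τ η * x η)))
          (trans (sum-cong-≗ (λ τ → trans (sym (*-distribˡ-sum (g τ * B τ σ) (λ η → B τ η * x η)))
            (trans (cong (g τ * B τ σ *_) (dotB τ))
            (trans (solve 4 (λ g b X D → g :* b :* (b :* X :+ D) := g :* (b :* b) :* X :+ g :* (b :* D)) refl (g τ) (B τ σ) X (D τ))
              (cong (λ e → e * X + g τ * s τ) (gm τ))))))
          (trans (∑-distrib-+ (λ τ → g τ * X) (λ τ → g τ * s τ)) (cong (_+ S) (sym (*-distribʳ-sum X g))))))

        -- The square on the left is what the estimate gives away. It vanishes for `x = z` if the
        -- weights in the star are 1 and each of its faces has exactly r further facets.
        identity : (d + ι r) * ∑[ τ < T ] (g τ * (dot (B τ) x) ²) + (S - ι r * X) ² ≡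
                   (d + ι r) * (ι r * X ² + G) + (dot z x) ²
        identity = trans (cong (λ e → (d + ι r) * e + (S - ι r * X) ²) Q-eq) (trans
          (solve 5 (λ d r X S G → (d :+ r) :* (d :* (X :* X) :+ :ι 2 :* X :* S :+ G) :+ (S :- r :* X) :* (S :- r :* X)
             := (d :+ r) :* (r :* (X :* X) :+ G) :+ (d :* X :+ S) :* (d :* X :+ S)) refl d (ι r) X S G)
          (cong (λ e → (d + ι r) * (ι r * X ² + G) + e ²) (sym z-eq)))

        rest-eq : ∀ τ η → (O σ η * B τ η) ² ≡ rest τ η
        rest-eq τ η = trans (solve 2 (λ o b → o :* b :* (o :* b) := o :* o :* (b :* b)) refl (O σ η) (B τ η))
          (cong (_* m τ η) (O-idem σ η))

        D≤ : ∀ τ → m τ σ ≡ 1# → (D τ) ² ≤ ι r * ∑[ η < F ] (rest τ η * (x η) ²)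
        D≤ τ h = ≤-trans (signed-cauchySchwarz (λ η → O σ η * B τ η) x
            (λ η → trans (solve 2 (λ o b → o :* b :* (o :* b) :* (o :* b) := o :* o :* o :* (b :* b :* b)) refl (O σ η) (B τ η))
               (cong₂ _*_ (trans (cong (_* O σ η) (O-idem σ η)) (O-idem σ η)) (B³≡B τ η))))
          (subst₂ _≤_ (trans (*-comm R′ _) (cong₂ _*_ (sum-cong-≗ (λ η → sym (rest-eq τ η)))
                      (sum-cong-≗ (λ η → cong (_* (x η) ²) (sym (rest-eq τ η))))))
            (*-comm R′ (ι r))
            (*-monoˡ-≤ R′ (sum-nonNeg (λ η → *-nonNeg (*-nonNeg (idem-nonNeg (O-idem σ η)) (m-nonNeg τ η)) (²-nonNeg (x η)))) (sum-rest τ h)))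
          where R′ = ∑[ η < F ] (rest τ η * (x η) ²)

        G≤ : G ≤ ι r * R
        G≤ = ≤-trans (sum-mono (λ τ → g*-mono τ (D≤ τ))) (≤-reflexive (trans
          (sum-cong-≗ (λ τ → solve 3 (λ g r x → g :* (r :* x) := r :* (g :* x)) refl (g τ) (ι r) (∑[ η < F ] (rest τ η * (x η) ²))))
          (sym (*-distribˡ-sum (ι r) (λ τ → g τ * ∑[ η < F ] (rest τ η * (x η) ²))))))

    -- Counting pairs of chosen facets

    off-diagonal : ∀ (f : Fin F → Carrier) → (∀ σ → Idempotent (f σ)) →
      ∑[ σ < F ] ∑[ η < F ] (O σ η * (f σ * f η)) ≡ (sum f) ² - sum f
    off-diagonal f f-idem = trans (sum-cong-≗ λ σ → sum-O σ (λ η → f σ * f η))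
      (trans (sum-sub (λ σ → ∑[ η < F ] (f σ * f η)) (λ σ → f σ * f σ))
        (cong₂ _-_ (sum-* f f) (sum-cong-≗ f-idem)))

    ι²-ι-nonNeg : ∀ l → 0# ≤ (ι l) ² - ι l
    ι²-ι-nonNeg zero    = ≤-reflexive (solve 0 (:ι 0 := :ι 0 :* :ι 0 :- :ι 0) refl)
    ι²-ι-nonNeg (suc l) = subst (0# ≤_) (solve 1 (λ x → (:ι 1 :+ x) :* x := (:ι 1 :+ x) :* (:ι 1 :+ x) :- (:ι 1 :+ x)) refl (ι l))
                            (*-nonNeg (ι-nonNeg (suc l)) (ι-nonNeg l))

    -- This is (l - 1)(l - 2) ≥ 0. Equality holds at l = 1 and l = 2, so faces with one or two
    -- chosen facets lose nothing.
    2ι≤2+ι²-ι : ∀ l → ι 2 * ι l ≤ ι 2 + ((ι l) ² - ι l)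
    2ι≤2+ι²-ι zero          = ≤-by (ι 2) (ι-nonNeg 2) (solve 0 (:ι 2 :* :ι 0 :+ :ι 2 := :ι 2 :+ (:ι 0 :* :ι 0 :- :ι 0)) refl)
    2ι≤2+ι²-ι (suc zero)    = ≤-reflexive (solve 0 (:ι 2 :* (:ι 1 :+ :ι 0) := :ι 2 :+ ((:ι 1 :+ :ι 0) :* (:ι 1 :+ :ι 0) :- (:ι 1 :+ :ι 0))) refl)
    2ι≤2+ι²-ι (suc (suc l)) = ≤-by ((1# + ι l) * ι l) (*-nonNeg (ι-nonNeg (suc l)) (ι-nonNeg l))
      (solve 1 (λ x → :ι 2 :* (:ι 1 :+ (:ι 1 :+ x)) :+ (:ι 1 :+ x) :* x :=
                 :ι 2 :+ ((:ι 1 :+ (:ι 1 :+ x)) :* (:ι 1 :+ (:ι 1 :+ x)) :- (:ι 1 :+ (:ι 1 :+ x)))) refl (ι l))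

    -- Two (r - 1)-faces lie in at most one common r-face, so each pair of chosen ones is counted at most once.
    sum-pairs : ∀ (s : Fin F → Carrier) → (∀ σ → Idempotent (s σ)) →
      ∑[ τ < T ] ((dot (m τ) s) ² - dot (m τ) s) ≤ (sum s) ² - sum s
    sum-pairs s s-idem = ≤-trans (≤-reflexive expand)
      (≤-trans (sum-mono λ σ → sum-mono (bound σ)) (≤-reflexive (off-diagonal s s-idem)))
      where
      expand : ∑[ τ < T ] ((dot (m τ) s) ² - dot (m τ) s) ≡
        ∑[ σ < F ] ∑[ η < F ] (O σ η * (s σ * s η) * ∑[ τ < T ] (m τ σ * m τ η))
      expand = trans (sum-cong-≗ λ τ → sym (off-diagonal (λ σ → m τ σ * s σ) (λ σ → idem-* (m-idem τ σ) (s-idem σ))))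
        (trans (∑-comm (λ τ σ → ∑[ η < F ] (O σ η * (m τ σ * s σ * (m τ η * s η)))))
          (sum-cong-≗ λ σ → trans (∑-comm (λ τ η → O σ η * (m τ σ * s σ * (m τ η * s η)))) (sum-cong-≗ λ η →
            trans (sum-cong-≗ λ τ → solve 5 (λ o a s b t → o :* (a :* s :* (b :* t)) := o :* (s :* t) :* (a :* b)) refl
                     (O σ η) (m τ σ) (s σ) (m τ η) (s η))
              (sym (*-distribˡ-sum (O σ η * (s σ * s η)) (λ τ → m τ σ * m τ η))))))

      codegree : ∀ {σ η} → σ ≢ η → ∑[ τ < T ] (m τ σ * m τ η) ≤ 1#
      codegree {σ} {η} σ≢η = sum-atMostOne-≤ (λ τ → m τ σ * m τ η)
        (λ τ ρ u v → linear σ≢η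
          (m-≢0⁻ (λ e → u (trans (cong (_* m τ η) e) (zeroˡ (m τ η))))) (m-≢0⁻ (λ e → u (trans (cong (m τ σ *_) e) (zeroʳ (m τ σ)))))
          (m-≢0⁻ (λ e → v (trans (cong (_* m ρ η) e) (zeroˡ (m ρ η))))) (m-≢0⁻ (λ e → v (trans (cong (m ρ σ *_) e) (zeroʳ (m ρ σ))))))
        0≤1 (λ τ → idem-≤1 (idem-* (m-idem τ σ) (m-idem τ η)))

      bound : ∀ σ η → O σ η * (s σ * s η) * ∑[ τ < T ] (m τ σ * m τ η) ≤ O σ η * (s σ * s η)
      bound σ η with σ Fin.≟ η
      ... | yes refl = ≤-reflexive (solve 2 (λ x y → (:ι 1 :- :ι 1) :* x :* y := (:ι 1 :- :ι 1) :* x) refl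
                         (s σ * s σ) (∑[ τ < T ] (m τ σ * m τ σ)))
      ... | no σ≢η = ≤-trans (*-monoˡ-≤ ((1# - 0#) * (s σ * s η))
                        (*-nonNeg (idem-nonNeg (idem-1- (zeroˡ 0#))) (idem-nonNeg (idem-* (s-idem σ) (s-idem η)))) (codegree σ≢η))
                        (≤-reflexive (*-identityʳ _))

    -- A set of at most M of the (r - 1)-faces contains at most M(M - 1)/2 pairs, and a face τ with l ≥ 1 chosen
    -- facets satisfies l ≤ 1 + l(l - 1)/2; topSelection-max reduces fractional choices v to such sets.
    module Rounding (L : Fin T → Carrier) (L-idem : ∀ τ → Idempotent (L τ)) where

      deg : Fin F → Carrier
      deg σ = ∑[ τ < T ] (L τ * m τ σ)

      deg-nonNeg : ∀ σ → 0# ≤ deg σ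
      deg-nonNeg σ = sum-nonNeg λ τ → *-nonNeg (idem-nonNeg (L-idem τ)) (m-nonNeg τ σ)

      dot-deg : ∀ v → dot deg v ≡ ∑[ τ < T ] (L τ * dot (m τ) v)
      dot-deg v = trans (sum-cong-≗ λ σ → *-distribʳ-sum (v σ) (λ τ → L τ * m τ σ))
        (trans (∑-comm (λ σ τ → L τ * m τ σ * v σ)) (sum-cong-≗ λ τ →
          trans (sum-cong-≗ λ σ → *-assoc (L τ) (m τ σ) (v σ)) (sym (*-distribˡ-sum (L τ) (λ σ → m τ σ * v σ)))))

      selection-bound : ∀ M (s : Fin F → Carrier) → (∀ σ → Idempotent (s σ)) → sum s ≤ ι M →
        ι 2 * dot deg s ≤ ι 2 * sum L + ((ι M) ² - ι M)
      selection-bound M s s-idem size≤ = ≤-trans (≤-reflexive (trans (cong (ι 2 *_) (dot-deg s)) (*-distribˡ-sum (ι 2) (λ τ → L τ * n τ))))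
        (≤-trans (sum-mono term)
          (≤-trans (≤-reflexive (trans (∑-distrib-+ (λ τ → ι 2 * L τ) (λ τ → (n τ) ² - n τ))
              (cong (_+ ∑[ τ < T ] ((n τ) ² - n τ)) (sym (*-distribˡ-sum (ι 2) L)))))
            (+-mono-≤ ≤-refl (≤-trans (sum-pairs s s-idem) (size² M size≤)))))
        where
        n : Fin T → Carrier
        n τ = dot (m τ) s

        term : ∀ τ → ι 2 * (L τ * n τ) ≤ ι 2 * L τ + ((n τ) ² - n τ)
        term τ with idem-sum (λ σ → m τ σ * s σ) (λ σ → idem-* (m-idem τ σ) (s-idem σ))
        ... | l , eq = subst (λ y → ι 2 * (L τ * y) ≤ ι 2 * L τ + (y ² - y)) (sym eq)
          (≤-by (L τ * (ι 2 + ((ι l) ² - ι l) - ι 2 * ι l) + (1# - L τ) * ((ι l) ² - ι l))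
            (+-nonNeg (*-nonNeg (idem-nonNeg (L-idem τ)) (x≤y⇒0≤y-x (2ι≤2+ι²-ι l)))
                      (*-nonNeg (idem-nonNeg (idem-1- (L-idem τ))) (ι²-ι-nonNeg l)))
            (solve 2 (λ y x → :ι 2 :* (y :* x) :+ (y :* (:ι 2 :+ (x :* x :- x) :- :ι 2 :* x) :+ (:ι 1 :- y) :* (x :* x :- x))
                        := :ι 2 :* y :+ (x :* x :- x)) refl (L τ) (ι l)))

        size² : ∀ M → sum s ≤ ι M → (sum s) ² - sum s ≤ (ι M) ² - ι M
        size² zero p = ≤-reflexive (cong (λ y → y ² - y) (antisym p (sum-nonNeg λ σ → idem-nonNeg (s-idem σ))))
        -- The gap between the two sides factors. For the bound 0 the second factor would be
        -- `sum s - 1#`, hence the separate case.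
        size² (suc M) p = ≤-by ((1# + ι M - sum s) * (ι M + sum s))
          (*-nonNeg (x≤y⇒0≤y-x p) (+-nonNeg (ι-nonNeg M) (sum-nonNeg λ σ → idem-nonNeg (s-idem σ))))
          (solve 2 (λ x y → (y :* y :- y) :+ (:ι 1 :+ x :- y) :* (x :+ y) := (:ι 1 :+ x) :* (:ι 1 :+ x) :- (:ι 1 :+ x)) refl (ι M) (sum s))

      rounding : ∀ M (v : Fin F → Carrier) → (∀ σ → 0# ≤ v σ) → (∀ σ → v σ ≤ 1#) → sum v ≤ ι M →
        ι 2 * ∑[ τ < T ] (L τ * dot (m τ) v) ≤ ι 2 * sum L + ((ι M) ² - ι M)
      rounding M v 0≤v v≤1 v≤M = subst (λ y → ι 2 * y ≤ ι 2 * sum L + ((ι M) ² - ι M)) (dot-deg v)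
        (helper (topSelection M deg deg-nonNeg))
        where
        helper : TopSelection M deg → ι 2 * dot deg v ≤ ι 2 * sum L + ((ι M) ² - ι M)
        helper S = ≤-trans (*-monoˡ-≤ (ι 2) (ι-nonNeg 2) (topSelection-max S v 0≤v v≤1 v≤M))
          (selection-bound M s s-idem size≤)
          where open TopSelection S

    -- Two faces share at most one facet, so a row of BBᵀ has absolute sum at most (r + 1) + (T -
    -- 1). This bounds the norm of `v = Bᵀy` for `y = Bx`, and `Y = dot v x` is then estimated by
    -- Cauchy-Schwarz.
    schur : ∀ x → ∑[ τ < T ] ((dot (B τ) x) ²) ≤ (ι T + ι r) * dot x x
    schur x = helper (Y ≟ 0#)
      where
      y : Fin T → Carrier
      y τ = dot (B τ) x

      Y : Carrier
      Y = ∑[ τ < T ] ((y τ) ²)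

      v : Fin F → Carrier
      v σ = ∑[ τ < T ] (y τ * B τ σ)

      W : Fin T → Fin T → Carrier
      W τ ρ = ∑[ σ < F ] (m τ σ * m ρ σ)

      Y≡v·x : Y ≡ dot v x
      Y≡v·x = trans (sum-cong-≗ λ τ → *-distribˡ-sum (y τ) (λ σ → B τ σ * x σ))
        (trans (∑-comm (λ τ σ → y τ * (B τ σ * x σ))) (sum-cong-≗ λ σ →
          trans (sum-cong-≗ λ τ → sym (*-assoc (y τ) (B τ σ) (x σ))) (sym (*-distribʳ-sum (x σ) (λ τ → y τ * B τ σ)))))

      W≤ : ∀ τ ρ → W τ ρ ≤ 1# + δ τ ρ * ι r
      W≤ τ ρ with τ Fin.≟ ρ
      ... | yes refl = ≤-trans (≤-reflexive (sum-cong-≗ (m-idem τ)))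
              (≤-trans (size τ) (≤-reflexive (cong (1# +_) (sym (*-identityˡ (ι r))))))
      ... | no τ≢ρ = ≤-trans (sum-atMostOne-≤ (λ σ → m τ σ * m ρ σ) unique 0≤1 (λ σ → idem-≤1 (idem-* (m-idem τ σ) (m-idem ρ σ))))
              (≤-reflexive (solve 1 (λ r → :ι 1 := :ι 1 :+ :ι 0 :* r) refl (ι r)))
        where
        unique : AtMostOne (λ σ → m τ σ * m ρ σ)
        unique σ η u u′ with σ Fin.≟ η
        ... | yes e = e
        ... | no σ≢η = contradiction (linear σ≢η
            (m-≢0⁻ (λ e → u (trans (cong (_* m ρ σ) e) (zeroˡ (m ρ σ))))) (m-≢0⁻ (λ e → u′ (trans (cong (_* m ρ η) e) (zeroˡ (m ρ η)))))
            (m-≢0⁻ (λ e → u (trans (cong (m τ σ *_) e) (zeroʳ (m τ σ))))) (m-≢0⁻ (λ e → u′ (trans (cong (m τ η *_) e) (zeroʳ (m τ η)))))) τ≢ρ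

      row : ∀ τ → ∑[ ρ < T ] (W τ ρ) ≤ ι T + ι r
      row τ = ≤-trans (sum-mono (W≤ τ)) (≤-reflexive (trans (∑-distrib-+ (λ _ → 1#) (λ ρ → δ τ ρ * ι r))
        (cong₂ _+_ (trans (sum-const T 1#) (*-identityʳ (ι T))) (sum-δ τ (λ _ → ι r)))))

      entry : ∀ τ ρ σ → ι 2 * ((y τ * B τ σ) * (y ρ * B ρ σ)) ≤ (y τ) ² * (m τ σ * m ρ σ) + (y ρ) ² * (m ρ σ * m τ σ)
      entry τ ρ σ = ≤-by ((u * y τ - t * y ρ) ²) (²-nonNeg (u * y τ - t * y ρ))
        (trans (solve 4 (λ b c y z → :ι 2 :* (y :* b :* (z :* c)) :+
                  (b :* b :* (c :* c) :* y :- b :* c :* z) :* (b :* b :* (c :* c) :* y :- b :* c :* z) :=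
                  y :* y :* (b :* b :* (c :* c) :* (b :* b :* (c :* c))) :+ z :* z :* (c :* c :* (b :* b))
                  :+ :ι 2 :* y :* z :* (b :* c :- b :* b :* b :* (c :* c :* c))) refl (B τ σ) (B ρ σ) (y τ) (y ρ))
          (trans (cong₂ (λ e f → (y τ) ² * e + (y ρ) ² * (m ρ σ * m τ σ) + ι 2 * y τ * y ρ * (t - f))
                   (idem-* (m-idem τ σ) (m-idem ρ σ)) (cong₂ _*_ (B³≡B τ σ) (B³≡B ρ σ)))
            (solve 3 (λ a s t → a :+ s :* (t :- t) := a) refl
              ((y τ) ² * (m τ σ * m ρ σ) + (y ρ) ² * (m ρ σ * m τ σ)) (ι 2 * y τ * y ρ) t)))
        where
        u = m τ σ * m ρ σ
        t = B τ σ * B ρ σ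

      v-norm : dot v v ≤ (ι T + ι r) * Y
      v-norm = *-cancelˡ-≤ (ι 2) (ι-nonNeg 2) (1≤x⇒x≢0 (1≤ι 1))
        (≤-trans (≤-reflexive expand) (≤-trans (sum-mono λ τ → sum-mono λ ρ → sum-mono (entry τ ρ))
          (≤-trans (≤-reflexive collect) (*-monoˡ-≤ (ι 2) (ι-nonNeg 2) rows))))
        where
        expand : ι 2 * dot v v ≡ ∑[ τ < T ] ∑[ ρ < T ] ∑[ σ < F ] (ι 2 * ((y τ * B τ σ) * (y ρ * B ρ σ)))
        expand = trans (cong (ι 2 *_) (trans (sum-cong-≗ λ σ → sym (sum-* (λ τ → y τ * B τ σ) (λ ρ → y ρ * B ρ σ)))
            (trans (∑-comm (λ σ τ → ∑[ ρ < T ] (y τ * B τ σ * (y ρ * B ρ σ))))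
              (sum-cong-≗ λ τ → ∑-comm (λ σ ρ → y τ * B τ σ * (y ρ * B ρ σ))))))
          (trans (*-distribˡ-sum (ι 2) (λ τ → ∑[ ρ < T ] ∑[ σ < F ] (y τ * B τ σ * (y ρ * B ρ σ)))) (sum-cong-≗ λ τ →
            trans (*-distribˡ-sum (ι 2) (λ ρ → ∑[ σ < F ] (y τ * B τ σ * (y ρ * B ρ σ)))) (sum-cong-≗ λ ρ →
              *-distribˡ-sum (ι 2) (λ σ → y τ * B τ σ * (y ρ * B ρ σ)))))

        half : ∑[ τ < T ] ∑[ ρ < T ] ∑[ σ < F ] ((y τ) ² * (m τ σ * m ρ σ)) ≡ ∑[ τ < T ] ((y τ) ² * ∑[ ρ < T ] (W τ ρ))
        half = sum-cong-≗ λ τ → trans (sum-cong-≗ λ ρ → sym (*-distribˡ-sum ((y τ) ²) (λ σ → m τ σ * m ρ σ)))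
                 (sym (*-distribˡ-sum ((y τ) ²) (W τ)))

        f : Fin T → Fin T → Carrier
        f τ ρ = ∑[ σ < F ] ((y τ) ² * (m τ σ * m ρ σ))

        collect : ∑[ τ < T ] ∑[ ρ < T ] ∑[ σ < F ] ((y τ) ² * (m τ σ * m ρ σ) + (y ρ) ² * (m ρ σ * m τ σ)) ≡
                  ι 2 * ∑[ τ < T ] ((y τ) ² * ∑[ ρ < T ] (W τ ρ))
        collect = trans (sum-cong-≗ λ τ → trans (sum-cong-≗ λ ρ →
            ∑-distrib-+ (λ σ → (y τ) ² * (m τ σ * m ρ σ)) (λ σ → (y ρ) ² * (m ρ σ * m τ σ)))
            (∑-distrib-+ (f τ) (λ ρ → f ρ τ)))
          (trans (∑-distrib-+ (λ τ → sum (f τ)) (λ τ → ∑[ ρ < T ] (f ρ τ)))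
            (trans (cong₂ _+_ half (trans (∑-comm (λ τ ρ → f ρ τ)) half))
              (solve 1 (λ a → a :+ a := :ι 2 :* a) refl (∑[ τ < T ] ((y τ) ² * ∑[ ρ < T ] (W τ ρ))))))

        rows : ∑[ τ < T ] ((y τ) ² * ∑[ ρ < T ] (W τ ρ)) ≤ (ι T + ι r) * Y
        rows = ≤-trans (sum-mono λ τ → *-monoˡ-≤ ((y τ) ²) (²-nonNeg (y τ)) (row τ))
          (≤-reflexive (trans (sym (*-distribʳ-sum (ι T + ι r) (λ τ → (y τ) ²))) (*-comm Y (ι T + ι r))))

      Y-nonNeg : 0# ≤ Y
      Y-nonNeg = sum-nonNeg λ τ → ²-nonNeg (y τ)

      helper : Dec (Y ≡ 0#) → Y ≤ (ι T + ι r) * dot x x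
      helper (yes e) = subst (_≤ (ι T + ι r) * dot x x) (sym e)
        (*-nonNeg (+-nonNeg (ι-nonNeg T) (ι-nonNeg r)) (dot-nonNeg x))
      helper (no ¬e) = *-cancelˡ-≤ Y Y-nonNeg ¬e (≤-trans (≤-reflexive (cong _² Y≡v·x)) (≤-trans (cauchySchwarz v x)
        (≤-trans (≤-reflexive (*-comm (dot v v) (dot x x))) (≤-trans (*-monoˡ-≤ (dot x x) (dot-nonNeg x) v-norm)
          (≤-reflexive (solve 3 (λ x t y → x :* (t :* y) := y :* (t :* x)) refl (dot x x) (ι T + ι r) Y))))))

    -- Distributing the faces among the stars of heavy facets

    module HeavyWeights (A : Fin F → Carrier) (A-idem : ∀ σ → Idempotent (A σ)) where

      Am-nonNeg : ∀ τ σ → 0# ≤ A σ * m τ σ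
      Am-nonNeg τ σ = *-nonNeg (idem-nonNeg (A-idem σ)) (m-nonNeg τ σ)

      h : Fin T → Carrier
      h τ = ∑[ σ < F ] (A σ * m τ σ)

      h-nonNeg : ∀ τ → 0# ≤ h τ
      h-nonNeg τ = sum-nonNeg (Am-nonNeg τ)

      H : Fin T → Carrier
      H τ = h τ * recip (h τ)

      H-idem : ∀ τ → Idempotent (H τ)
      H-idem τ = recip-idem (h τ)

      -- Every face is shared equally by the stars of its heavy facets. Hence a pair of heavy facets costs only half
      -- as much as a heavy and a light one, see star-overlap.
      g : Fin F → Fin T → Carrier
      g σ τ = A σ * m τ σ * recip (h τ)

      g-nonNeg : ∀ σ τ → 0# ≤ g σ τ
      g-nonNeg σ τ = *-nonNeg (Am-nonNeg τ σ) (recip-nonNeg (h-nonNeg τ))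

      sum-g : ∀ τ → ∑[ σ < F ] (g σ τ) ≡ H τ
      sum-g τ = sym (*-distribʳ-sum (recip (h τ)) (λ σ → A σ * m τ σ))

      g≤1 : ∀ σ τ → g σ τ ≤ 1#
      g≤1 σ τ = ≤-trans (term≤sum (λ σ → g σ τ) (λ σ → g-nonNeg σ τ) σ)
        (subst (_≤ 1#) (sym (sum-g τ)) (idem-≤1 (H-idem τ)))

      g-A : ∀ σ τ → A σ ≡ 0# → g σ τ ≡ 0#
      g-A σ τ e = trans (cong (λ y → y * m τ σ * recip (h τ)) e)
        (solve 2 (λ x y → :ι 0 :* x :* y := :ι 0) refl (m τ σ) (recip (h τ)))

      g-m : ∀ σ τ → m τ σ ≡ 0# → g σ τ ≡ 0#
      g-m σ τ e = trans (cong (λ y → A σ * y * recip (h τ)) e)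
        (solve 2 (λ x y → x :* :ι 0 :* y := :ι 0) refl (A σ) (recip (h τ)))

      g-support : ∀ σ τ → g σ τ ≢ 0# → B τ σ ≢ 0#
      g-support σ τ q = m-≢0⁻ (λ e → q (g-m σ τ e))

      g-1 : ∀ σ τ → A σ ≡ 1# → m τ σ ≡ 1# → g σ τ ≡ recip (h τ)
      g-1 σ τ e e′ = trans (cong₂ (λ y z → y * z * recip (h τ)) e e′)
        (solve 1 (λ y → :ι 1 :* :ι 1 :* y := y) refl (recip (h τ)))

      -- By `linear` at most one face contributes. Its weight is at most 1, and at most 1/2 if `η`
      -- is heavy as well, because then `σ` and `η` receive equal shares of it.
      star-overlap : ∀ {σ η} → σ ≢ η → ι 2 * ∑[ τ < T ] (g σ τ * m τ η) ≤ A σ * (ι 2 - A η)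
      star-overlap {σ} {η} σ≢η = subst (_≤ c′) (sym (*-distribˡ-sum (ι 2) (λ τ → g σ τ * m τ η)))
        (sum-atMostOne-≤ f unique c′-nonNeg f≤c)
        where
        c′ = A σ * (ι 2 - A η)
        f : Fin T → Carrier
        f τ = ι 2 * (g σ τ * m τ η)
        c′-nonNeg : 0# ≤ c′
        c′-nonNeg = *-nonNeg (idem-nonNeg (A-idem σ)) (x≤y⇒0≤y-x (≤-trans (idem-≤1 (A-idem η)) (1≤ι 1)))
        f-m : ∀ τ → m τ η ≡ 0# → f τ ≡ 0#
        f-m τ e = trans (cong (λ y → ι 2 * (g σ τ * y)) e) (solve 1 (λ x → :ι 2 :* (x :* :ι 0) := :ι 0) refl (g σ τ))
        f-g : ∀ τ → g σ τ ≡ 0# → f τ ≡ 0#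
        f-g τ e = trans (cong (λ y → ι 2 * (y * m τ η)) e) (solve 1 (λ x → :ι 2 :* (:ι 0 :* x) := :ι 0) refl (m τ η))
        unique : AtMostOne f
        unique τ ρ u v = linear σ≢η (g-support σ τ (λ e → u (f-g τ e))) (m-≢0⁻ (λ e → u (f-m τ e)))
                                    (g-support σ ρ (λ e → v (f-g ρ e))) (m-≢0⁻ (λ e → v (f-m ρ e)))
        f≤c : ∀ τ → f τ ≤ c′
        f≤c τ with m τ η ≟ 0# | m τ σ ≟ 0# | A σ ≟ 0# | A η ≟ 0#
        ... | yes e | _ | _ | _ = subst (_≤ c′) (sym (f-m τ e)) c′-nonNeg
        ... | no _ | yes e | _ | _ = subst (_≤ c′) (sym (f-g τ (g-m σ τ e))) c′-nonNeg
        ... | no _ | no _ | yes e | _ = subst (_≤ c′) (sym (f-g τ (g-A σ τ e))) c′-nonNeg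
        ... | no mη | no mσ | no aσ | yes aη = subst₂ _≤_
            (cong (λ y → ι 2 * (g σ τ * y)) (sym (idem-≢0 (m-idem τ η) mη)))
            (trans (solve 0 (:ι 2 :* (:ι 1 :* :ι 1) := :ι 1 :* (:ι 2 :- :ι 0)) refl)
              (cong₂ (λ y z → y * (ι 2 - z)) (sym (idem-≢0 (A-idem σ) aσ)) (sym aη)))
            (*-monoˡ-≤ (ι 2) (ι-nonNeg 2) (subst₂ _≤_ (sym (*-identityʳ (g σ τ))) (sym (*-identityʳ 1#)) (g≤1 σ τ)))
        ... | no mη | no mσ | no aσ | no aη = subst₂ _≤_
            (trans (cong₂ _+_ (g-1 σ τ aσ′ mσ′) (g-1 η τ aη′ mη′))
              (trans (solve 1 (λ y → y :+ y := :ι 2 :* (y :* :ι 1)) refl (recip (h τ)))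
                (cong₂ (λ y z → ι 2 * (y * z)) (sym (g-1 σ τ aσ′ mσ′)) (sym mη′))))
            (trans (solve 0 (:ι 1 := :ι 1 :* (:ι 2 :- :ι 1)) refl) (cong₂ (λ y z → y * (ι 2 - z)) (sym aσ′) (sym aη′)))
            (≤-trans (two-terms≤sum (λ σ → g σ τ) (λ σ → g-nonNeg σ τ) σ≢η)
              (subst (_≤ 1#) (sym (sum-g τ)) (idem-≤1 (H-idem τ))))
          where
          mη′ = idem-≢0 (m-idem τ η) mη
          mσ′ = idem-≢0 (m-idem τ σ) mσ
          aσ′ = idem-≢0 (A-idem σ) aσ
          aη′ = idem-≢0 (A-idem η) aη

    module HeavyStars
      (A : Fin F → Carrier) (A-idem : ∀ σ → Idempotent (A σ)) (H : Fin T → Carrier)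
      (g : Fin F → Fin T → Carrier) (g-nonNeg : ∀ σ τ → 0# ≤ g σ τ) (g≤1 : ∀ σ τ → g σ τ ≤ 1#)
      (g-support : ∀ σ τ → g σ τ ≢ 0# → B τ σ ≢ 0#) (g-A : ∀ σ τ → A σ ≡ 0# → g σ τ ≡ 0#)
      (sum-g : ∀ τ → ∑[ σ < F ] (g σ τ) ≡ H τ)
      (star-overlap : ∀ {σ η} → σ ≢ η → ι 2 * ∑[ τ < T ] (g σ τ * m τ η) ≤ A σ * (ι 2 - A η))
      (p : Fin F → Carrier) (p-nonNeg : ∀ σ → 0# ≤ p σ) (q : Fin T → Carrier)
      (star-bound : ∀ σ (g : Fin T → Carrier) → (∀ τ → 0# ≤ g τ) → (∀ τ → g τ ≤ 1#) → (∀ τ → g τ ≢ 0# → B τ σ ≢ 0#) →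
        ∑[ τ < T ] (g τ * q τ) ≤ sum g + ι r * (p σ + ∑[ τ < T ] (g τ * ∑[ η < F ] (O σ η * m τ η * p η))))
      where

      P : Carrier
      P = sum p

      a : Carrier
      a = sum A

      Pₐ : Carrier
      Pₐ = ∑[ σ < F ] (A σ * p σ)

      tail : Fin F → Carrier
      tail σ = ∑[ τ < T ] (g σ τ * ∑[ η < F ] (O σ η * m τ η * p η))

      star-bound-A : ∀ σ → ∑[ τ < T ] (g σ τ * q τ) ≤ sum (g σ) + ι r * (A σ * p σ + tail σ)
      star-bound-A σ with A σ ≟ 0#
      ... | no ¬e = subst (λ y → ∑[ τ < T ] (g σ τ * q τ) ≤ sum (g σ) + ι r * (y + tail σ))
              (trans (sym (*-identityˡ (p σ))) (cong (_* p σ) (sym (idem-≢0 (A-idem σ) ¬e))))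
              (star-bound σ (g σ) (g-nonNeg σ) (g≤1 σ) (g-support σ))
      ... | yes e = subst₂ _≤_
              (sym (sum-zero λ τ → trans (cong (_* q τ) (g-A σ τ e)) (zeroˡ (q τ)))) refl
              (+-nonNeg (sum-nonNeg (g-nonNeg σ)) (*-nonNeg (ι-nonNeg r) (+-nonNeg
                (*-nonNeg (idem-nonNeg (A-idem σ)) (p-nonNeg σ))
                (sum-nonNeg λ τ → *-nonNeg (g-nonNeg σ τ) (sum-nonNeg λ η →
                  *-nonNeg (*-nonNeg (idem-nonNeg (O-idem σ η)) (m-nonNeg τ η)) (p-nonNeg η))))))

      -- After an exchange of sums, each `p η` occurs once for every heavy `σ ≢ η`, with factor 2 if
      -- `η` is light and 1 if it is heavy. The final `- Pₐ` comes from the missing terms with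
      -- `σ ≡ η`.
      sum-tail : ι 2 * sum tail ≤ a * (ι 2 * P - Pₐ) - Pₐ
      sum-tail = ≤-trans (≤-reflexive expand) (≤-trans (sum-mono λ σ → sum-mono (bound σ)) (≤-reflexive collect))
        where
        expand : ι 2 * sum tail ≡ ∑[ σ < F ] ∑[ η < F ] (O σ η * p η * (ι 2 * ∑[ τ < T ] (g σ τ * m τ η)))
        expand = trans (*-distribˡ-sum (ι 2) tail) (sum-cong-≗ λ σ →
          trans (cong (ι 2 *_) (trans (sum-cong-≗ λ τ → *-distribˡ-sum (g σ τ) (λ η → O σ η * m τ η * p η))
            (∑-comm (λ τ η → g σ τ * (O σ η * m τ η * p η)))))
          (trans (*-distribˡ-sum (ι 2) (λ η → ∑[ τ < T ] (g σ τ * (O σ η * m τ η * p η)))) (sum-cong-≗ λ η →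
            trans (cong (ι 2 *_) (trans (sum-cong-≗ λ τ →
                solve 4 (λ g o m p → g :* (o :* m :* p) := o :* p :* (g :* m)) refl (g σ τ) (O σ η) (m τ η) (p η))
                (sym (*-distribˡ-sum (O σ η * p η) (λ τ → g σ τ * m τ η)))))
              (solve 3 (λ c x y → c :* (x :* y) := x :* (c :* y)) refl (ι 2) (O σ η * p η) (∑[ τ < T ] (g σ τ * m τ η))))))

        bound : ∀ σ η → O σ η * p η * (ι 2 * ∑[ τ < T ] (g σ τ * m τ η)) ≤ A σ * (O σ η * (p η * (ι 2 - A η)))
        bound σ η with σ Fin.≟ η
        ... | yes refl = ≤-reflexive (solve 4 (λ x y z u → (:ι 1 :- :ι 1) :* x :* y := z :* ((:ι 1 :- :ι 1) :* u)) refl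
                           (p σ) (ι 2 * ∑[ τ < T ] (g σ τ * m τ σ)) (A σ) (p σ * (ι 2 - A σ)))
        ... | no σ≢η = subst₂ _≤_
              (solve 2 (λ x y → x :* y := (:ι 1 :- :ι 0) :* x :* y) refl (p η) (ι 2 * ∑[ τ < T ] (g σ τ * m τ η)))
              (solve 3 (λ x z u → x :* (z :* u) := z :* ((:ι 1 :- :ι 0) :* (x :* u))) refl (p η) (A σ) (ι 2 - A η))
              (*-monoˡ-≤ (p η) (p-nonNeg η) (star-overlap σ≢η))

        f : Fin F → Carrier
        f η = p η * (ι 2 - A η)

        sum-f : sum f ≡ ι 2 * P - Pₐ
        sum-f = trans (sum-cong-≗ λ η → solve 2 (λ p a → p :* (:ι 2 :- a) := :ι 2 :* p :- a :* p) refl (p η) (A η))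
          (trans (sum-sub (λ η → ι 2 * p η) (λ η → A η * p η)) (cong (λ y → y - Pₐ) (sym (*-distribˡ-sum (ι 2) p))))

        collect : ∑[ σ < F ] ∑[ η < F ] (A σ * (O σ η * f η)) ≡ a * (ι 2 * P - Pₐ) - Pₐ
        collect = trans (sum-cong-≗ λ σ → trans (sym (*-distribˡ-sum (A σ) (λ η → O σ η * f η)))
            (trans (cong (A σ *_) (trans (sum-O σ f) (cong (λ y → y - f σ) sum-f)))
            (trans (solve 3 (λ a y p → a :* (y :- p :* (:ι 2 :- a)) := a :* y :- (:ι 2 :* a :- a :* a) :* p) refl (A σ) (ι 2 * P - Pₐ) (p σ))
              (cong (λ y → A σ * (ι 2 * P - Pₐ) - y * p σ) (trans (cong (λ y → ι 2 * A σ - y) (A-idem σ))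
                (solve 1 (λ a → :ι 2 :* a :- a := a) refl (A σ)))))))
          (trans (sum-sub (λ σ → A σ * (ι 2 * P - Pₐ)) (λ σ → A σ * p σ))
            (cong (λ y → y - Pₐ) (sym (*-distribʳ-sum (ι 2 * P - Pₐ) A))))

      heavy-bound : ι 2 * ∑[ τ < T ] (H τ * q τ) ≤ ι 2 * sum H + ι r * (Pₐ + a * (ι 2 * P - Pₐ))
      heavy-bound = ≤-trans (*-monoˡ-≤ (ι 2) (ι-nonNeg 2) (subst₂ _≤_ (sym lhs) rhs (sum-mono star-bound-A)))
        (≤-trans (≤-reflexive (solve 4 (λ h r p t → :ι 2 :* (h :+ r :* (p :+ t)) := :ι 2 :* h :+ r :* (:ι 2 :* p :+ :ι 2 :* t)) refl
                    (sum H) (ι r) Pₐ (sum tail)))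
          (≤-trans (+-mono-≤ ≤-refl (*-monoˡ-≤ (ι r) (ι-nonNeg r) (+-mono-≤ ≤-refl sum-tail)))
            (≤-reflexive (solve 4 (λ h r p y → :ι 2 :* h :+ r :* (:ι 2 :* p :+ (y :- p)) := :ι 2 :* h :+ r :* (p :+ y)) refl
                    (sum H) (ι r) Pₐ (a * (ι 2 * P - Pₐ))))))
        where
        lhs : ∑[ τ < T ] (H τ * q τ) ≡ ∑[ σ < F ] ∑[ τ < T ] (g σ τ * q τ)
        lhs = trans (sum-cong-≗ λ τ → trans (cong (_* q τ) (sym (sum-g τ))) (*-distribʳ-sum (q τ) (λ σ → g σ τ)))
                (sym (∑-comm (λ σ τ → g σ τ * q τ)))
        rhs : ∑[ σ < F ] (sum (g σ) + ι r * (A σ * p σ + tail σ)) ≡ sum H + ι r * (Pₐ + sum tail)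
        rhs = trans (∑-distrib-+ (λ σ → sum (g σ)) _) (cong₂ _+_ (trans (∑-comm g) (sum-cong-≗ sum-g))
          (trans (sym (*-distribˡ-sum (ι r) (λ σ → A σ * p σ + tail σ))) (cong (ι r *_) (∑-distrib-+ (λ σ → A σ * p σ) tail))))

    -- The form given by the `x i` with weights `c i` stands for the projection. It need not be
    -- idempotent: it suffices that it lies between 0 and the identity and has trace at most k.
    module Compression
      (1≤r : 1 ℕ.≤ r) (k : ℕ) (x : Fin k → Fin F → Carrier) (c : Fin k → Carrier) (c-nonNeg : ∀ i → 0# ≤ c i)
      (bessel : ∀ z → ∑[ i < k ] (c i * (dot z (x i)) ²) ≤ dot z z)
      (trace : ∑[ i < k ] (c i * dot (x i) (x i)) ≤ ι k)
      where

      p : Fin F → Carrier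
      p σ = ∑[ i < k ] (c i * (x i σ) ²)

      q : Fin T → Carrier
      q τ = ∑[ i < k ] (c i * (dot (B τ) (x i)) ²)

      p-nonNeg : ∀ σ → 0# ≤ p σ
      p-nonNeg σ = sum-nonNeg λ i → *-nonNeg (c-nonNeg i) (²-nonNeg (x i σ))

      average-mono : {f g : Fin k → Carrier} → (∀ i → f i ≤ g i) → ∑[ i < k ] (c i * f i) ≤ ∑[ i < k ] (c i * g i)
      average-mono h = sum-mono λ i → *-monoˡ-≤ (c i) (c-nonNeg i) (h i)

      average-* : ∀ a (f : Fin k → Carrier) → ∑[ i < k ] (c i * (a * f i)) ≡ a * ∑[ i < k ] (c i * f i)
      average-* a f = trans (sum-cong-≗ λ i → solve 3 (λ c a f → c :* (a :* f) := a :* (c :* f)) refl (c i) a (f i))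
                        (sym (*-distribˡ-sum a (λ i → c i * f i)))

      average-+ : ∀ (f g : Fin k → Carrier) → ∑[ i < k ] (c i * (f i + g i)) ≡
                  ∑[ i < k ] (c i * f i) + ∑[ i < k ] (c i * g i)
      average-+ f g = trans (sum-cong-≗ λ i → distribˡ (c i) (f i) (g i))
                        (∑-distrib-+ (λ i → c i * f i) (λ i → c i * g i))

      average-sum : ∀ {n} (a : Fin n → Carrier) (f : Fin k → Fin n → Carrier) →
        ∑[ i < k ] (c i * ∑[ j < n ] (a j * f i j)) ≡ ∑[ j < n ] (a j * ∑[ i < k ] (c i * f i j))
      average-sum a f = trans (sum-cong-≗ λ i → *-distribˡ-sum (c i) (λ j → a j * f i j))
        (trans (∑-comm (λ i j → c i * (a j * f i j)))
          (sum-cong-≗ λ j → average-* (a j) (λ i → f i j)))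

      P : Carrier
      P = sum p

      P≤k : P ≤ ι k
      P≤k = subst (_≤ ι k) (trans (sum-cong-≗ λ i → *-distribˡ-sum (c i) (λ σ → (x i σ) ²))
              (∑-comm (λ i σ → c i * (x i σ) ²))) trace

      q-bound : ∀ τ → q τ ≤ (1# + ι r) * ∑[ σ < F ] (m τ σ * p σ)
      q-bound τ = ≤-trans (average-mono λ i → ≤-trans (signed-cauchySchwarz (B τ) (x i) (B³≡B τ))
          (subst₂ _≤_ (*-comm (R i) (sum (m τ))) (*-comm (R i) (1# + ι r))
            (*-monoˡ-≤ (R i) (sum-nonNeg λ σ → *-nonNeg (m-nonNeg τ σ) (²-nonNeg (x i σ))) (size τ))))
        (≤-reflexive (trans (average-* (1# + ι r) R) (cong ((1# + ι r) *_) (average-sum (m τ) (λ i σ → (x i σ) ²)))))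
        where
        R : Fin k → Carrier
        R i = ∑[ σ < F ] (m τ σ * (x i σ) ²)

      -- Averaging `star-form` over the `x i` turns squares of coordinates into `p` and squares of
      -- inner products into `q`. Bessel's inequality for `z` bounds the remaining term by
      -- `d * (d + ι r)`, which contributes `sum g` after division by `d + ι r`.
      star-bound : ∀ σ (g : Fin T → Carrier) → (∀ τ → 0# ≤ g τ) → (∀ τ → g τ ≤ 1#) → (∀ τ → g τ ≢ 0# → B τ σ ≢ 0#) →
        ∑[ τ < T ] (g τ * q τ) ≤ sum g + ι r * (p σ + ∑[ τ < T ] (g τ * ∑[ η < F ] (O σ η * m τ η * p η)))
      star-bound σ g g-nonNeg g≤1 support = *-cancelˡ-≤ (d + ι r) d+r-nonNeg d+r≢0
        (≤-trans (≤-reflexive (sym lhs)) (≤-trans (average-mono (λ i → star-form (x i))) (≤-trans (≤-reflexive rhs)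
          (≤-trans (+-mono-≤ ≤-refl (≤-trans (bessel z) z-norm))
            (≤-reflexive (solve 3 (λ d r y → (d :+ r) :* y :+ d :* (d :+ r) := (d :+ r) :* (d :+ y)) refl d (ι r) _))))))
        where
        open Star σ g g-nonNeg g≤1 support 1≤r
        lhs : ∑[ i < k ] (c i * ((d + ι r) * ∑[ τ < T ] (g τ * (dot (B τ) (x i)) ²))) ≡ (d + ι r) * ∑[ τ < T ] (g τ * q τ)
        lhs = trans (average-* (d + ι r) (λ i → ∑[ τ < T ] (g τ * (dot (B τ) (x i)) ²)))
                (cong ((d + ι r) *_) (average-sum g (λ i τ → (dot (B τ) (x i)) ²)))
        R : Fin k → Carrier
        R i = ∑[ τ < T ] (g τ * ∑[ η < F ] (rest τ η * (x i η) ²))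
        rhs : ∑[ i < k ] (c i * ((d + ι r) * (ι r * ((x i σ) ² + R i)) + (dot z (x i)) ²)) ≡
          (d + ι r) * (ι r * (p σ + ∑[ τ < T ] (g τ * ∑[ η < F ] (rest τ η * p η)))) + ∑[ i < k ] (c i * (dot z (x i)) ²)
        rhs = trans (average-+ (λ i → (d + ι r) * (ι r * ((x i σ) ² + R i))) (λ i → (dot z (x i)) ²))
          (cong (_+ ∑[ i < k ] (c i * (dot z (x i)) ²)) (trans (average-* (d + ι r) (λ i → ι r * ((x i σ) ² + R i)))
          (cong ((d + ι r) *_) (trans (average-* (ι r) (λ i → (x i σ) ² + R i))
          (cong (ι r *_) (trans (average-+ (λ i → (x i σ) ²) R) (cong (p σ +_)
          (trans (average-sum g (λ i τ → ∑[ η < F ] (rest τ η * (x i η) ²)))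
            (sum-cong-≗ λ τ → cong (g τ *_) (average-sum (rest τ) (λ i η → (x i η) ²)))))))))))

      -- Heavy and light facets

      w : Fin F → Carrier
      w σ = (1# + ι r) * p σ

      w-nonNeg : ∀ σ → 0# ≤ w σ
      w-nonNeg σ = *-nonNeg (+-nonNeg 0≤1 (ι-nonNeg r)) (p-nonNeg σ)

      -- The indicator of the heavy facets.
      A : Fin F → Carrier
      A σ = if does (w σ ≤? 1#) then 0# else 1#

      A-idem : ∀ σ → Idempotent (A σ)
      A-idem σ with w σ ≤? 1#
      ... | yes _ = zeroˡ 0#
      ... | no _  = *-identityˡ 1#

      A-light : ∀ σ → (1# - A σ) * w σ ≤ 1#
      A-light σ with w σ ≤? 1#
      ... | yes p = ≤-trans (≤-reflexive (solve 1 (λ w → (:ι 1 :- :ι 0) :* w := w) refl (w σ))) p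
      ... | no _  = ≤-trans (≤-reflexive (solve 1 (λ w → (:ι 1 :- :ι 1) :* w := :ι 0) refl (w σ))) 0≤1

      A-heavy : ∀ σ → A σ ≤ A σ * w σ
      A-heavy σ with w σ ≤? 1#
      ... | yes _ = ≤-reflexive (sym (zeroˡ (w σ)))
      ... | no ¬p with total 1# (w σ)
      ...   | inj₁ p = ≤-trans p (≤-reflexive (sym (*-identityˡ (w σ))))
      ...   | inj₂ p = contradiction p ¬p

      private
        module W = HeavyWeights A A-idem
        module Stars = HeavyStars A A-idem W.H W.g W.g-nonNeg W.g≤1 W.g-support W.g-A W.sum-g W.star-overlap
                         p p-nonNeg q star-bound

      open W using (Am-nonNeg; H; H-idem)
      open Stars using (a; Pₐ; heavy-bound)
      L : Fin T → Carrier
      L τ = 1# - H τ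

      L-idem : ∀ τ → Idempotent (L τ)
      L-idem τ = idem-1- (H-idem τ)

      w′ : Fin F → Carrier
      w′ σ = (1# - A σ) * w σ

      w′-nonNeg : ∀ σ → 0# ≤ w′ σ
      w′-nonNeg σ = *-nonNeg (idem-nonNeg (idem-1- (A-idem σ))) (w-nonNeg σ)

      sum-w′ : sum w′ ≡ (1# + ι r) * (P - Pₐ)
      sum-w′ = trans (sum-cong-≗ λ σ → solve 3 (λ a r p → (:ι 1 :- a) :* (r :* p) := r :* (p :- a :* p)) refl (A σ) (1# + ι r) (p σ))
        (trans (sym (*-distribˡ-sum (1# + ι r) (λ σ → p σ - A σ * p σ))) (cong ((1# + ι r) *_) (sum-sub p (λ σ → A σ * p σ))))

      L-A : ∀ τ σ → L τ * (A σ * m τ σ) ≡ 0#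
      L-A τ σ = 1-recip-* (Am-nonNeg τ σ) (term≤sum (λ σ → A σ * m τ σ) (Am-nonNeg τ) σ)

      -- If `L τ` is not 0, no facet of `τ` is heavy, and `w` may be replaced by its light part in
      -- `q-bound`.
      L-q : ∀ τ → L τ * q τ ≤ L τ * dot (m τ) w′
      L-q τ = ≤-trans (*-monoˡ-≤ (L τ) (idem-nonNeg (L-idem τ)) (q-bound τ)) (≤-reflexive
        (trans (sym (*-assoc (L τ) (1# + ι r) _)) (trans (*-distribˡ-sum (L τ * (1# + ι r)) (λ σ → m τ σ * p σ))
          (trans (sum-cong-≗ λ σ → trans (solve 5 (λ l r m p a → l :* r :* (m :* p) := l :* (m :* ((:ι 1 :- a) :* (r :* p))) :+ l :* (a :* m) :* (r :* p))
               refl (L τ) (1# + ι r) (m τ σ) (p σ) (A σ))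
             (trans (cong (λ y → L τ * (m τ σ * w′ σ) + y * w σ) (L-A τ σ))
               (solve 2 (λ x y → x :+ :ι 0 :* y := x) refl (L τ * (m τ σ * w′ σ)) (w σ))))
            (sym (*-distribˡ-sum (L τ) (λ σ → m τ σ * w′ σ)))))))

      light-bound : ∀ M → sum w′ ≤ ι M → ι 2 * ∑[ τ < T ] (L τ * q τ) ≤ ι 2 * sum L + ((ι M) ² - ι M)
      light-bound M w′≤M = ≤-trans (*-monoˡ-≤ (ι 2) (ι-nonNeg 2) (sum-mono L-q))
        (Rounding.rounding L L-idem M w′ w′-nonNeg A-light w′≤M)

      -- Here `a′` is the number of heavy facets and `Q` their part of the trace `P`. The left-hand
      -- side is twice what light faces and stars together cost beyond 1 per face. For `a′ = 0` the
      -- hypotheses force `Q` to vanish.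
      excess-arithmetic : ∀ a′ Q → 2 ℕ.≤ k → a′ ℕ.≤ suc r ℕ.* k → ι a′ ≤ (1# + ι r) * Q → Q ≤ ι a′ * P →
        (ι (suc r ℕ.* k ℕ.∸ a′)) ² - ι (suc r ℕ.* k ℕ.∸ a′) + ι r * (Q + ι a′ * (ι 2 * P - Q)) ≤
        (ι (suc r ℕ.* k)) ² - ι (suc r ℕ.* k)
      excess-arithmetic zero Q 2≤k _ 0≤Q Q≤0 = ≤-reflexive (trans (cong (λ y → (ι M) ² - ι M + ι r * (y + 0# * (ι 2 * P - y))) Q≡0)
          (solve 3 (λ x r p → x :+ r :* (:ι 0 :+ :ι 0 :* (:ι 2 :* p :- :ι 0)) := x) refl ((ι M) ² - ι M) (ι r) P))
        where
        M = suc r ℕ.* k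
        Q≡0 : Q ≡ 0#
        Q≡0 = antisym (subst (Q ≤_) (zeroˡ P) Q≤0)
          (*-cancelˡ-≤ (1# + ι r) (ι-nonNeg (suc r)) (1≤x⇒x≢0 (1≤ι r)) (subst (_≤ (1# + ι r) * Q) (sym (zeroʳ (1# + ι r))) 0≤Q))
      excess-arithmetic (suc b) Q 2≤k a≤m a≤Q _ = subst (λ y → y ² - y + ι r * (Q + α * (ι 2 * P - Q)) ≤ (ι (suc r ℕ.* k)) ² - ι (suc r ℕ.* k)) (sym ιM)
        (subst (λ m → (m - α) ² - (m - α) + ι r * (Q + α * (ι 2 * P - Q)) ≤ m ² - m) (sym (ι-* (suc r) k))
          (*-cancelˡ-≤ (1# + ι r) (ι-nonNeg (suc r)) (1≤x⇒x≢0 (1≤ι r))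
            (≤-by certificate nonNeg
              (solve 5 (λ r k b p q → let s = :ι 1 :+ r ; a = :ι 1 :+ b ; m = s :* k in
                 s :* ((m :- a) :* (m :- a) :- (m :- a) :+ r :* (q :+ a :* (:ι 2 :* p :- q))) :+
                 (:ι 2 :* s :* r :* a :* (k :- p) :+ r :* b :* (s :* q :- a) :+ a :* ((m :- a) :+ (m :- (:ι 2 :* r :+ :ι 1))))
                 := s :* (m :* m :- m)) refl (ι r) (ι k) (ι b) P Q))))
        where
        α = ι (suc b)
        -- A combination of the slacks of `P ≤ k`, `α ≤ (r + 1)Q`, `α ≤ m` and `2r + 1 ≤ m`, with
        -- coefficients that cancel `P` and `Q`. The second coefficient is nonnegative because
        -- `b = α - 1` is, and `2 ≤ k` enters through the last slack.
        certificate = ι 2 * (1# + ι r) * ι r * α * (ι k - P) + ι r * ι b * ((1# + ι r) * Q - α)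
                      + α * (((1# + ι r) * ι k - α) + ((1# + ι r) * ι k - (ι 2 * ι r + 1#)))
        ιM : ι (suc r ℕ.* k ℕ.∸ suc b) ≡ ι (suc r ℕ.* k) - α
        ιM = trans (solve 2 (λ x y → x := x :+ y :- y) refl (ι (suc r ℕ.* k ℕ.∸ suc b)) α)
          (cong (λ y → y - α) (trans (sym (ι-+ (suc r ℕ.* k ℕ.∸ suc b) (suc b))) (cong ι (ℕ.m∸n+n≡m a≤m))))
        2r+1≤m : ι 2 * ι r + 1# ≤ (1# + ι r) * ι k
        2r+1≤m = ≤-trans (≤-by 1# 0≤1 (solve 1 (λ r → :ι 2 :* r :+ :ι 1 :+ :ι 1 := (:ι 1 :+ r) :* :ι 2) refl (ι r)))
          (*-monoˡ-≤ (1# + ι r) (ι-nonNeg (suc r)) (ι-mono-≤ 2≤k))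
        nonNeg : 0# ≤ certificate
        nonNeg = +-nonNeg (+-nonNeg
          (*-nonNeg (*-nonNeg (*-nonNeg (*-nonNeg (ι-nonNeg 2) (ι-nonNeg (suc r))) (ι-nonNeg r)) (ι-nonNeg (suc b))) (x≤y⇒0≤y-x P≤k))
          (*-nonNeg (*-nonNeg (ι-nonNeg r) (ι-nonNeg b)) (x≤y⇒0≤y-x a≤Q)))
          (*-nonNeg (ι-nonNeg (suc b)) (+-nonNeg (x≤y⇒0≤y-x (subst (α ≤_) (ι-* (suc r) k) (ι-mono-≤ a≤m))) (x≤y⇒0≤y-x 2r+1≤m)))

      Pₐ≤P : Pₐ ≤ P
      Pₐ≤P = sum-mono λ σ → ≤-by ((1# - A σ) * p σ) (*-nonNeg (idem-nonNeg (idem-1- (A-idem σ))) (p-nonNeg σ))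
        (solve 2 (λ a p → a :* p :+ (:ι 1 :- a) :* p := p) refl (A σ) (p σ))

      Pₐ≤aP : Pₐ ≤ a * P
      Pₐ≤aP = ≤-trans (sum-mono λ σ → *-monoˡ-≤ (A σ) (idem-nonNeg (A-idem σ)) (term≤sum p p-nonNeg σ))
        (≤-reflexive (sym (*-distribʳ-sum P A)))

      a≤Pₐ : a ≤ (1# + ι r) * Pₐ
      a≤Pₐ = ≤-trans (sum-mono A-heavy) (≤-reflexive (trans
        (sum-cong-≗ λ σ → solve 3 (λ a r p → a :* (r :* p) := r :* (a :* p)) refl (A σ) (1# + ι r) (p σ))
        (sym (*-distribˡ-sum (1# + ι r) (λ σ → A σ * p σ)))))

      sum-q-bound : 2 ℕ.≤ k → ι 2 * sum q ≤ ι 2 * ι T + ((ι (suc r ℕ.* k)) ² - ι (suc r ℕ.* k))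
      sum-q-bound 2≤k = helper (idem-sum A A-idem)
        where
        m′ = suc r ℕ.* k
        split : ι 2 * sum q ≡ ι 2 * ∑[ τ < T ] (H τ * q τ) + ι 2 * ∑[ τ < T ] (L τ * q τ)
        split = trans (cong (ι 2 *_) (trans (sum-cong-≗ λ τ → solve 2 (λ h q → q := h :* q :+ (:ι 1 :- h) :* q) refl (H τ) (q τ))
            (∑-distrib-+ (λ τ → H τ * q τ) (λ τ → L τ * q τ))))
          (distribˡ (ι 2) (∑[ τ < T ] (H τ * q τ)) (∑[ τ < T ] (L τ * q τ)))
        count : sum H + sum L ≡ ι T
        count = trans (cong (sum H +_) (trans (sum-sub (λ _ → 1#) H) (cong (λ y → y - sum H) (trans (sum-const T 1#) (*-identityʳ (ι T))))))
          (solve 2 (λ h t → h :+ (t :- h) := t) refl (sum H) (ι T))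
        helper : ∃[ a′ ] a ≡ ι a′ → ι 2 * sum q ≤ ι 2 * ι T + ((ι m′) ² - ι m′)
        helper (a′ , a≡ιa′) = ≤-trans (≤-reflexive split) (≤-trans (+-mono-≤ heavy-bound (light-bound (m′ ℕ.∸ a′) w′≤))
          (≤-trans (≤-reflexive (trans
              (solve 4 (λ h l e f → (:ι 2 :* h :+ e) :+ (:ι 2 :* l :+ f) := :ι 2 :* (h :+ l) :+ (f :+ e)) refl
                (sum H) (sum L) (ι r * (Pₐ + a * (ι 2 * P - Pₐ))) ((ι (m′ ℕ.∸ a′)) ² - ι (m′ ℕ.∸ a′)))
              (cong₂ (λ y z → ι 2 * y + ((ι (m′ ℕ.∸ a′)) ² - ι (m′ ℕ.∸ a′) + ι r * (Pₐ + z * (ι 2 * P - Pₐ)))) count a≡ιa′)))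
            (+-mono-≤ ≤-refl (excess-arithmetic a′ Pₐ 2≤k a′≤m a≤ (subst (λ y → Pₐ ≤ y * P) a≡ιa′ Pₐ≤aP)))))
          where
          a≤ : ι a′ ≤ (1# + ι r) * Pₐ
          a≤ = subst (_≤ (1# + ι r) * Pₐ) a≡ιa′ a≤Pₐ
          rP≤m : (1# + ι r) * P ≤ ι m′
          rP≤m = subst ((1# + ι r) * P ≤_) (sym (ι-* (suc r) k)) (*-monoˡ-≤ (1# + ι r) (ι-nonNeg (suc r)) P≤k)
          a′≤m : a′ ℕ.≤ m′
          a′≤m = ι-cancel-≤ (≤-trans a≤ (≤-trans (*-monoˡ-≤ (1# + ι r) (ι-nonNeg (suc r)) Pₐ≤P) rP≤m))
          -- The `a′` heavy facets take at least `a′` of the total weight, which is at most `m′`. By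
          -- `a′≤m` the truncated subtraction is exact.
          w′≤ : sum w′ ≤ ι (m′ ℕ.∸ a′)
          w′≤ = ≤-trans (≤-reflexive (trans sum-w′ (solve 3 (λ r p q → r :* (p :- q) := r :* p :- r :* q) refl (1# + ι r) P Pₐ)))
            (≤-by (ι m′ - (1# + ι r) * P + ((1# + ι r) * Pₐ - ι a′)) (+-nonNeg (x≤y⇒0≤y-x rP≤m) (x≤y⇒0≤y-x a≤))
              (trans (solve 4 (λ x y z u → (x :- y) :+ (z :- x :+ (y :- u)) := z :- u) refl
                       ((1# + ι r) * P) ((1# + ι r) * Pₐ) (ι m′) (ι a′))
                (trans (cong (λ y → y - ι a′) (trans (cong ι (sym (ℕ.m∸n+n≡m a′≤m))) (ι-+ (m′ ℕ.∸ a′) a′)))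
                  (solve 2 (λ x y → x :+ y :- y := x) refl (ι (m′ ℕ.∸ a′)) (ι a′)))))

      -- For k = 1 the inequality 2r + 1 ≤ (r + 1)k behind excess-arithmetic fails.
      sum-q-bound-1 : k ≡ 1 → ι 2 * sum q ≤ ι 2 * ι T + ((ι (suc r ℕ.* k)) ² - ι (suc r ℕ.* k))
      sum-q-bound-1 k≡1 = ≤-trans (*-monoˡ-≤ (ι 2) (ι-nonNeg 2) (≤-trans (≤-reflexive swap)
          (≤-trans (average-mono λ i → schur (x i)) (≤-trans (≤-reflexive (average-* (ι T + ι r) (λ i → dot (x i) (x i))))
            (*-monoˡ-≤ (ι T + ι r) (+-nonNeg (ι-nonNeg T) (ι-nonNeg r)) trace)))))
        (subst (λ y → ι 2 * ((ι T + ι r) * ι y) ≤ ι 2 * ι T + ((ι (suc r ℕ.* y)) ² - ι (suc r ℕ.* y))) (sym k≡1)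
          (subst (λ y → ι 2 * ((ι T + ι r) * ι 1) ≤ ι 2 * ι T + (y ² - y)) (sym (trans (ι-* (suc r) 1) refl))
            -- The bound T + r from `schur` lies below T + C(r + 1, 2), and twice the gap is r(r -
            -- 1).
            (≤-by (ι r * (ι r - 1#)) (*-nonNeg (ι-nonNeg r) (x≤y⇒0≤y-x (subst (_≤ ι r) (+-identityʳ 1#) (ι-mono-≤ 1≤r))))
              (solve 2 (λ t r → :ι 2 :* ((t :+ r) :* (:ι 1 :+ :ι 0)) :+ r :* (r :- :ι 1) :=
                 :ι 2 :* t :+ ((:ι 1 :+ r) :* (:ι 1 :+ :ι 0) :* ((:ι 1 :+ r) :* (:ι 1 :+ :ι 0)) :- (:ι 1 :+ r) :* (:ι 1 :+ :ι 0))) refl (ι T) (ι r)))))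
        where
        swap : sum q ≡ ∑[ i < k ] (c i * ∑[ τ < T ] ((dot (B τ) (x i)) ²))
        swap = trans (∑-comm (λ τ i → c i * (dot (B τ) (x i)) ²))
          (sum-cong-≗ λ i → sym (*-distribˡ-sum (c i) (λ τ → (dot (B τ) (x i)) ²)))

      compression-bound : 1 ℕ.≤ k → ι 2 * sum q ≤ ι 2 * ι T + ((ι (suc r ℕ.* k)) ² - ι (suc r ℕ.* k))
      compression-bound 1≤k with k ℕ.≟ 1
      ... | yes k≡1 = sum-q-bound-1 k≡1
      ... | no  k≢1 = sum-q-bound (ℕ.≤∧≢⇒< 1≤k (k≢1 ∘ sym))

  -- Bessel's inequality for almost orthogonal vectors

  module ApproximateBessel
    {k N : ℕ} (x : Fin k → Fin N → Carrier) (e : Carrier) (0≤e : 0# ≤ e)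
    (near⁺ : ∀ i j → i ≢ j → 0# ≤ e + dot (x i) (x j)) (near⁻ : ∀ i j → i ≢ j → 0# ≤ e - dot (x i) (x j))
    where

    -- The summand `ι k * e` restores diagonal dominance: it pays `e` for each of the k entries in a
    -- row of the Gram matrix.
    norm : Fin k → Carrier
    norm i = dot (x i) (x i) + ι k * e

    norm-nonNeg : ∀ i → 0# ≤ norm i
    norm-nonNeg i = +-nonNeg (dot-nonNeg (x i)) (*-nonNeg (ι-nonNeg k) 0≤e)

    c : Fin k → Carrier
    c i = recip (norm i)

    c-nonNeg : ∀ i → 0# ≤ c i
    c-nonNeg i = recip-nonNeg (norm-nonNeg i)

    c-norm≤1 : ∀ i → c i * norm i ≤ 1#
    c-norm≤1 i = subst (_≤ 1#) (*-comm (norm i) (c i)) (idem-≤1 (recip-idem (norm i)))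

    trace : ∑[ i < k ] (c i * dot (x i) (x i)) ≤ ι k
    trace = ≤-trans (sum-mono (λ i → ≤-trans
        (*-monoˡ-≤ (c i) (c-nonNeg i) (≤-by (ι k * e) (*-nonNeg (ι-nonNeg k) 0≤e) refl)) (c-norm≤1 i)))
      (≤-reflexive (trans (sum-const k 1#) (*-identityʳ (ι k))))

    -- Almost orthogonal vectors have an almost diagonal Gram matrix, so it is dominated by the matrix of the norms.
    gram-bound : ∀ (t : Fin k → Carrier) →
      ∑[ i < k ] ∑[ j < k ] (t i * t j * dot (x i) (x j)) ≤ ∑[ i < k ] ((t i) ² * norm i)
    gram-bound t = *-cancelˡ-≤ (ι 2) (ι-nonNeg 2) (1≤x⇒x≢0 (1≤ι 1))
      (≤-trans (≤-reflexive (trans (*-distribˡ-sum (ι 2) (λ i → ∑[ j < k ] (t i * t j * dot (x i) (x j))))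
        (sum-cong-≗ λ i → *-distribˡ-sum (ι 2) (λ j → t i * t j * dot (x i) (x j)))))
        (≤-trans (sum-mono λ i → sum-mono (entry i)) (≤-reflexive collect)))
      where
      d : Fin k → Fin k → Carrier
      d i j = δ i j * (ι 2 * (t i) ² * dot (x i) (x i))

      entry : ∀ i j → ι 2 * (t i * t j * dot (x i) (x j)) ≤ d i j + e * ((t i) ² + (t j) ²)
      entry i j with i Fin.≟ j
      ... | yes refl = ≤-by (e * ((t i) ² + (t i) ²)) (*-nonNeg 0≤e (+-nonNeg (²-nonNeg (t i)) (²-nonNeg (t i))))
              (solve 3 (λ t g e → :ι 2 :* (t :* t :* g) :+ e :* (t :* t :+ t :* t) := :ι 1 :* (:ι 2 :* (t :* t) :* g) :+ e :* (t :* t :+ t :* t))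
                refl (t i) (dot (x i) (x i)) e)
      ... | no i≢j = *-cancelˡ-≤ (ι 2) (ι-nonNeg 2) (1≤x⇒x≢0 (1≤ι 1)) (≤-by
              ((e + g) * (t i - t j) ² + (e - g) * (t i + t j) ²)
              (+-nonNeg (*-nonNeg (near⁺ i j i≢j) (²-nonNeg (t i - t j))) (*-nonNeg (near⁻ i j i≢j) (²-nonNeg (t i + t j))))
              (solve 5 (λ s t g e d → :ι 2 :* (:ι 2 :* (s :* t :* g)) :+ ((e :+ g) :* ((s :- t) :* (s :- t)) :+ (e :- g) :* ((s :+ t) :* (s :+ t)))
                 := :ι 2 :* (:ι 0 :* d :+ e :* (s :* s :+ t :* t))) refl (t i) (t j) g e (ι 2 * (t i) ² * dot (x i) (x i))))
        where g = dot (x i) (x j)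

      t² : Fin k → Carrier
      t² i = (t i) ²

      collect : ∑[ i < k ] ∑[ j < k ] (d i j + e * ((t i) ² + (t j) ²)) ≡ ι 2 * ∑[ i < k ] ((t i) ² * norm i)
      collect = begin
        ∑[ i < k ] ∑[ j < k ] (d i j + e * (t² i + t² j))
          ≡⟨ sum-cong-≗ (λ i → trans (∑-distrib-+ (d i) (λ j → e * (t² i + t² j))) (cong₂ _+_ (sum-δ i (λ _ → ι 2 * t² i * dot (x i) (x i)))
               (trans (sym (*-distribˡ-sum e (λ j → t² i + t² j))) (cong (e *_) (trans (∑-distrib-+ (λ _ → t² i) t²) (cong (_+ sum t²) (sum-const k (t² i)))))))) ⟩
        ∑[ i < k ] (ι 2 * t² i * dot (x i) (x i) + e * (ι k * t² i + sum t²))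
          ≡⟨ sum-cong-≗ (λ i → solve 5 (λ t g e k s → :ι 2 :* t :* g :+ e :* (k :* t :+ s) := :ι 2 :* (t :* (g :+ k :* e)) :+ (e :* s :- k :* e :* t))
               refl (t² i) (dot (x i) (x i)) e (ι k) (sum t²)) ⟩
        ∑[ i < k ] (ι 2 * (t² i * norm i) + (e * sum t² - ι k * e * t² i))
          ≡⟨ trans (∑-distrib-+ (λ i → ι 2 * (t² i * norm i)) _) (cong₂ _+_ (sym (*-distribˡ-sum (ι 2) (λ i → t² i * norm i)))
               (trans (sum-sub (λ _ → e * sum t²) (λ i → ι k * e * t² i)) (cong₂ _-_ (sum-const k (e * sum t²)) (sym (*-distribˡ-sum (ι k * e) t²))))) ⟩
        ι 2 * ∑[ i < k ] (t² i * norm i) + (ι k * (e * sum t²) - ι k * e * sum t²)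
          ≡⟨ solve 4 (λ a k e s → :ι 2 :* a :+ (k :* (e :* s) :- k :* e :* s) := :ι 2 :* a) refl (∑[ i < k ] (t² i * norm i)) (ι k) e (sum t²) ⟩
        ι 2 * ∑[ i < k ] (t² i * norm i) ∎
        where open ≡-Reasoning

    -- With `y` in place of the projection of `z`, the left-hand side `S` is `dot z y`, while
    -- `gram-bound` gives `dot y y ≤ S`. Cauchy-Schwarz then bounds `S ²` by `dot z z * S`.
    bessel : ∀ z → ∑[ i < k ] (c i * (dot z (x i)) ²) ≤ dot z z
    bessel z = helper (S ≟ 0#)
      where
      b : Fin k → Carrier
      b i = dot z (x i)
      S : Carrier
      S = ∑[ i < k ] (c i * (b i) ²)
      y : Fin N → Carrier
      y a = ∑[ i < k ] (c i * b i * x i a)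

      S-nonNeg : 0# ≤ S
      S-nonNeg = sum-nonNeg λ i → *-nonNeg (c-nonNeg i) (²-nonNeg (b i))

      S≡ : S ≡ dot z y
      S≡ = trans (sum-cong-≗ λ i → trans (solve 2 (λ c b → c :* (b :* b) := c :* b :* b) refl (c i) (b i))
             (*-distribˡ-sum (c i * b i) (λ a → z a * x i a)))
        (trans (∑-comm (λ i a → c i * b i * (z a * x i a))) (sum-cong-≗ λ a →
          trans (sum-cong-≗ λ i → solve 3 (λ t z x → t :* (z :* x) := z :* (t :* x)) refl (c i * b i) (z a) (x i a))
            (sym (*-distribˡ-sum (z a) (λ i → c i * b i * x i a)))))

      y-norm : dot y y ≡ ∑[ i < k ] ∑[ j < k ] (c i * b i * (c j * b j) * dot (x i) (x j))
      y-norm = trans (sum-cong-≗ λ a → sym (sum-* (λ i → c i * b i * x i a) (λ j → c j * b j * x j a)))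
        (trans (∑-comm (λ a i → ∑[ j < k ] (c i * b i * x i a * (c j * b j * x j a)))) (sum-cong-≗ λ i →
          trans (∑-comm (λ a j → c i * b i * x i a * (c j * b j * x j a))) (sum-cong-≗ λ j →
            trans (sum-cong-≗ λ a → solve 4 (λ s t x y → s :* x :* (t :* y) := s :* t :* (x :* y)) refl (c i * b i) (c j * b j) (x i a) (x j a))
              (sym (*-distribˡ-sum (c i * b i * (c j * b j)) (λ a → x i a * x j a))))))

      y-norm≤ : dot y y ≤ S
      y-norm≤ = ≤-trans (≤-reflexive y-norm) (≤-trans (gram-bound (λ i → c i * b i)) (sum-mono λ i →
        subst₂ _≤_ (solve 3 (λ c b n → c :* (b :* b) :* (c :* n) := c :* b :* (c :* b) :* n) refl (c i) (b i) (norm i)) (*-identityʳ (c i * (b i) ²))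
          (*-monoˡ-≤ (c i * (b i) ²) (*-nonNeg (c-nonNeg i) (²-nonNeg (b i))) (c-norm≤1 i))))

      helper : Dec (S ≡ 0#) → S ≤ dot z z
      helper (yes S≡0) = subst (_≤ dot z z) (sym S≡0) (dot-nonNeg z)
      helper (no S≢0)  = *-cancelˡ-≤ S S-nonNeg S≢0 (≤-trans (≤-reflexive (cong _² S≡)) (≤-trans (cauchySchwarz z y)
        (≤-trans (*-monoˡ-≤ (dot z z) (dot-nonNeg z) y-norm≤) (≤-reflexive (*-comm (dot z z) S)))))

open import Defs
import Data.Bool.Properties as Bool
open import Data.Fin.Subset using (Subset; inside; outside; ∣_∣; _∩_; _∪_; _─_; _⊆_; _∈_; _∉_)
  renaming (_-_ to _∖_)
open import Data.Fin.Subset.Properties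
open import Data.List as List using (List; []; _∷_; filter; length)
open import Data.List.Membership.Propositional using () renaming (_∈_ to _∈ₗ_)
open import Data.List.Membership.Propositional.Properties
  using (∈-filter⁺; ∈-filter⁻; ∈-lookup; ∈-map⁺; ∈-map⁻; ∈-++⁺ˡ; ∈-++⁺ʳ)
import Data.List.Relation.Unary.All as All
open import Data.List.Relation.Unary.AllPairs using ([]; _∷_)
open import Data.List.Relation.Unary.Any as Any using (here)
import Data.List.Relation.Unary.Any.Properties as Any
open import Data.List.Relation.Unary.Unique.Propositional using (Unique)
import Data.List.Relation.Unary.Unique.Propositional.Properties as Unique
import Data.Vec.Properties as Vec

-- Faces, facets and incidence numbers

⊆-card⇒≡ : ∀ {n} {p q : Subset n} → p ⊆ q → ∣ q ∣ ℕ.≤ ∣ p ∣ → p ≡ q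
⊆-card⇒≡ {p = p} {q} p⊆q q≤p = ⊆-antisym p⊆q q⊆p
  where
  q⊆p : q ⊆ p
  q⊆p {x} x∈q with x ∈? p
  ... | yes x∈p = x∈p
  ... | no  x∉p = contradiction (p⊂q⇒∣p∣<∣q∣ (p⊆q , x , x∈q , x∉p)) (ℕ.≤⇒≯ q≤p)

∣∪∣+∣∩∣ : ∀ {n} (p q : Subset n) → ∣ p ∪ q ∣ ℕ.+ ∣ p ∩ q ∣ ≡ ∣ p ∣ ℕ.+ ∣ q ∣
∣∪∣+∣∩∣ []            []            = refl
∣∪∣+∣∩∣ (outside ∷ p) (outside ∷ q) = ∣∪∣+∣∩∣ p q
∣∪∣+∣∩∣ (outside ∷ p) (inside  ∷ q) = trans (cong suc (∣∪∣+∣∩∣ p q)) (sym (ℕ.+-suc ∣ p ∣ ∣ q ∣))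
∣∪∣+∣∩∣ (inside  ∷ p) (outside ∷ q) = cong suc (∣∪∣+∣∩∣ p q)
∣∪∣+∣∩∣ (inside  ∷ p) (inside  ∷ q) = cong suc (trans (ℕ.+-suc ∣ p ∪ q ∣ ∣ p ∩ q ∣)
  (trans (cong suc (∣∪∣+∣∩∣ p q)) (sym (ℕ.+-suc ∣ p ∣ ∣ q ∣))))

∣[]≔∩∣ : ∀ {n} (p b : Subset n) v → v ∉ p →
  ∣ (p Vec.[ v ]≔ inside) ∩ b ∣ ≡ ∣ p ∩ b ∣ ℕ.+ (if Vec.lookup b v then 1 else 0)
∣[]≔∩∣ (inside  ∷ p) b             zero    v∉p = contradiction here v∉p
∣[]≔∩∣ (outside ∷ p) (outside ∷ b) zero    v∉p = sym (ℕ.+-identityʳ ∣ p ∩ b ∣)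
∣[]≔∩∣ (outside ∷ p) (inside  ∷ b) zero    v∉p = sym (ℕ.+-comm ∣ p ∩ b ∣ 1)
∣[]≔∩∣ (outside ∷ p) (_       ∷ b) (suc v) v∉p = ∣[]≔∩∣ p b v (v∉p ∘ there)
∣[]≔∩∣ (inside  ∷ p) (outside ∷ b) (suc v) v∉p = ∣[]≔∩∣ p b v (v∉p ∘ there)
∣[]≔∩∣ (inside  ∷ p) (inside  ∷ b) (suc v) v∉p = cong suc (∣[]≔∩∣ p b v (v∉p ∘ there))

∈-─⁻ : ∀ {n} (p q : Subset n) {x} → x ∈ p ─ q → x ∈ p × x ∉ q
∈-─⁻ (inside ∷ p) (outside ∷ q) {zero}  here      = here , λ ()
∈-─⁻ (s ∷ p)      (outside ∷ q) {suc x} (there h) with ∈-─⁻ p q h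
... | x∈p , x∉q = there x∈p , λ { (there x∈q) → x∉q x∈q }
∈-─⁻ (s ∷ p)      (inside ∷ q)  {suc x} (there h) with ∈-─⁻ p q h
... | x∈p , x∉q = there x∈p , λ { (there x∈q) → x∉q x∈q }

module Facet {n} {σ τ : Subset n} (σ⊆τ : σ ⊆ τ) (card : ∣ τ ∣ ≡ suc ∣ σ ∣) where

  ≡-remove : ∀ {u} → u ∈ τ → u ∉ σ → σ ≡ τ ∖ u
  ≡-remove {u} u∈τ u∉σ = ⊆-card⇒≡
    (λ {x} x∈σ → x∈p∧x≢y⇒x∈p-y (σ⊆τ x∈σ) (λ { refl → u∉σ x∈σ }))
    (ℕ.s≤s⁻¹ (subst (∣ τ ∖ u ∣ ℕ.<_) card (x∈p⇒∣p-x∣<∣p∣ u∈τ)))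

  extra : ∃[ u ] u ∈ τ × u ∉ σ
  extra with nonempty? (τ ─ σ)
  ... | yes (u , u∈τ─σ) = u , ∈-─⁻ τ σ u∈τ─σ
  ... | no empty = contradiction (p⊆q⇒∣p∣≤∣q∣ τ⊆σ) (subst (λ k → ¬ k ℕ.≤ ∣ σ ∣) (sym card) ℕ.1+n≰n)
    where
    τ⊆σ : τ ⊆ σ
    τ⊆σ {x} x∈τ with x ∈? σ
    ... | yes x∈σ = x∈σ
    ... | no  x∉σ = contradiction (x , x∈p∧x∉q⇒x∈p─q x∈τ x∉σ) empty

  extra-unique : ∀ {u v} → u ∈ τ → u ∉ σ → v ∈ τ → v ∉ σ → u ≡ v
  extra-unique {u} {v} u∈τ u∉σ v∈τ v∉σ with v Fin.≟ u
  ... | yes v≡u = sym v≡u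
  ... | no  v≢u = contradiction (subst (v ∈_) (sym (≡-remove u∈τ u∉σ)) (x∈p∧x≢y⇒x∈p-y v∈τ v≢u)) v∉σ

  ≡-insert : ∀ {u} → u ∈ τ → u ∉ σ → τ ≡ σ Vec.[ u ]≔ inside
  ≡-insert {u} u∈τ u∉σ = ⊆-antisym to from
    where
    to : τ ⊆ σ Vec.[ u ]≔ inside
    to {x} x∈τ with x Fin.≟ u
    ... | yes refl = Vec.[]≔-updates σ u
    ... | no  x≢u with x ∈? σ
    ...   | yes x∈σ = Vec.[]≔-minimal σ x u x≢u x∈σ
    ...   | no  x∉σ = contradiction (extra-unique x∈τ x∉σ u∈τ u∉σ) x≢u
    from : σ Vec.[ u ]≔ inside ⊆ τ
    from {x} x∈ with x Fin.≟ u
    ... | yes refl = u∈τ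
    ... | no  x≢u = σ⊆τ (Vec.lookup⇒[]= x σ (trans (sym (Vec.lookup∘update′ x≢u σ inside)) (Vec.[]=⇒lookup x∈)))

module Incidence {n : ℕ} {_<_ : Rel (Fin n) 0ℓ} (ord : IsStrictTotalOrder _≡_ _<_) where
  open IsStrictTotalOrder ord using (_<?_; compare)
  open IntegerSolver ℤ.+-*-commutativeRing using (solve)

  sign : ℕ → ℤ
  sign k = -1ℤ ℤ.^ k

  sign² : ∀ k → sign k ℤ.* sign k ≡ 1ℤ
  sign² zero    = refl
  sign² (suc k) = trans (solve 2 (λ a b → a :* b :* (a :* b) := a :* a :* (b :* b)) refl -1ℤ (sign k))
                    (cong (λ z → -1ℤ ℤ.* -1ℤ ℤ.* z) (sign² k))

  incidence-extra : ∀ {σ τ} → σ ⊆ τ → ∣ τ ∣ ≡ suc ∣ σ ∣ → ∀ {u} → u ∈ τ → u ∉ σ →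
    incidence ord τ σ ≡ sign ∣ τ ∩ below ord u ∣
  incidence-extra {σ} {τ} σ⊆τ card {u} u∈τ u∉σ with nonempty? (τ ─ σ)
  ... | yes (v , h) = cong (λ w → sign ∣ τ ∩ below ord w ∣)
                        (let v∈τ , v∉σ = ∈-─⁻ τ σ h in Facet.extra-unique σ⊆τ card v∈τ v∉σ u∈τ u∉σ)
  ... | no empty = contradiction (u , x∈p∧x∉q⇒x∈p─q u∈τ u∉σ) empty

  incidence² : ∀ {σ τ} → σ ⊆ τ → ∣ τ ∣ ≡ suc ∣ σ ∣ → incidence ord τ σ ℤ.* incidence ord τ σ ≡ 1ℤ
  incidence² {σ} {τ} σ⊆τ card = let u , u∈τ , u∉σ = Facet.extra σ⊆τ card in
    trans (cong (λ z → z ℤ.* z) (incidence-extra σ⊆τ card u∈τ u∉σ)) (sign² ∣ τ ∩ below ord u ∣)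

  lookup-below : ∀ u v → Vec.lookup (below ord u) v ≡ does (v <? u)
  lookup-below u v = Vec.lookup∘tabulate (λ v → does (v <? u)) v

  before : Fin n → Fin n → ℕ
  before x y = if does (x <? y) then 1 else 0

  before-swap : ∀ {u v} → u ≢ v → sign (before u v) ℤ.* sign (before v u) ≡ -1ℤ
  before-swap {u} {v} u≢v = helper (compare u v)
    where
    signs : Bool → Bool → ℤ
    signs a b = sign (if a then 1 else 0) ℤ.* sign (if b then 1 else 0)
    helper : Tri (u < v) (u ≡ v) (v < u) → signs (does (u <? v)) (does (v <? u)) ≡ -1ℤ
    helper (tri< u<v _ v≮u) = cong₂ signs (dec-true (u <? v) u<v) (dec-false (v <? u) v≮u)
    helper (tri≈ _ u≡v _)   = contradiction u≡v u≢v
    helper (tri> u≮v _ v<u) = cong₂ signs (dec-false (u <? v) u≮v) (dec-true (v <? u) v<u)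

  -- The sign in front of the off-diagonal entries: passing from σ to σ ∪ η and from η to σ ∪ η inserts the
  -- vertices v and u in the opposite order, which costs exactly one transposition.
  incidence-square : ∀ {σ η} → ∣ σ ∪ η ∣ ≡ suc ∣ σ ∣ → ∣ σ ∪ η ∣ ≡ suc ∣ η ∣ →
    ∣ σ ∣ ≡ suc ∣ σ ∩ η ∣ → ∣ η ∣ ≡ suc ∣ σ ∩ η ∣ →
    incidence ord (σ ∪ η) σ ℤ.* incidence ord (σ ∪ η) η ≡
    ℤ.- (incidence ord σ (σ ∩ η) ℤ.* incidence ord η (σ ∩ η))
  incidence-square {σ} {η} cσ cη dσ dη = begin
    incidence ord ρ σ ℤ.* incidence ord ρ η
      ≡⟨ cong₂ ℤ._*_ (trans (incidence-extra σ⊆ρ cσ (η⊆ρ v∈η) v∉σ) (cong sign (count η⊆ρ cη (σ⊆ρ u∈σ) u∉η v)))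
                     (trans (incidence-extra η⊆ρ cη (σ⊆ρ u∈σ) u∉η) (cong sign (count σ⊆ρ cσ (η⊆ρ v∈η) v∉σ u))) ⟩
    sign (∣ η ∩ below ord v ∣ ℕ.+ before u v) ℤ.* sign (∣ σ ∩ below ord u ∣ ℕ.+ before v u)
      ≡⟨ cong₂ ℤ._*_ (ℤ.^-distribˡ-+-* -1ℤ ∣ η ∩ below ord v ∣ (before u v))
                     (ℤ.^-distribˡ-+-* -1ℤ ∣ σ ∩ below ord u ∣ (before v u)) ⟩
    (sign ∣ η ∩ below ord v ∣ ℤ.* sign (before u v)) ℤ.* (sign ∣ σ ∩ below ord u ∣ ℤ.* sign (before v u))
      ≡⟨ solve 4 (λ a b c d → (a :* b) :* (c :* d) := (b :* d) :* (c :* a)) refl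
           (sign ∣ η ∩ below ord v ∣) (sign (before u v)) (sign ∣ σ ∩ below ord u ∣) (sign (before v u)) ⟩
    (sign (before u v) ℤ.* sign (before v u)) ℤ.* (sign ∣ σ ∩ below ord u ∣ ℤ.* sign ∣ η ∩ below ord v ∣)
      ≡⟨ cong (ℤ._* (sign ∣ σ ∩ below ord u ∣ ℤ.* sign ∣ η ∩ below ord v ∣)) (before-swap λ u≡v → u∉η (subst (_∈ η) (sym u≡v) v∈η)) ⟩
    -1ℤ ℤ.* (sign ∣ σ ∩ below ord u ∣ ℤ.* sign ∣ η ∩ below ord v ∣)
      ≡⟨ ℤ.-1*i≡-i _ ⟩
    ℤ.- (sign ∣ σ ∩ below ord u ∣ ℤ.* sign ∣ η ∩ below ord v ∣)
      ≡⟨ cong ℤ.-_ (cong₂ ℤ._*_ (sym (incidence-extra κ⊆σ dσ u∈σ u∉κ)) (sym (incidence-extra κ⊆η dη v∈η v∉κ))) ⟩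
    ℤ.- (incidence ord σ κ ℤ.* incidence ord η κ) ∎
    where
    open ≡-Reasoning
    ρ = σ ∪ η
    κ = σ ∩ η
    σ⊆ρ : σ ⊆ ρ
    σ⊆ρ = p⊆p∪q η
    η⊆ρ : η ⊆ ρ
    η⊆ρ = q⊆p∪q σ η
    κ⊆σ : κ ⊆ σ
    κ⊆σ = p∩q⊆p σ η
    κ⊆η : κ ⊆ η
    κ⊆η = p∩q⊆q σ η
    extraσ = Facet.extra κ⊆σ dσ
    extraη = Facet.extra κ⊆η dη
    u = proj₁ extraσ
    v = proj₁ extraη
    u∈σ = proj₁ (proj₂ extraσ)
    u∉κ = proj₂ (proj₂ extraσ)
    v∈η = proj₁ (proj₂ extraη)
    v∉κ = proj₂ (proj₂ extraη)
    u∉η : u ∉ η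
    u∉η u∈η = u∉κ (x∈p∩q⁺ (u∈σ , u∈η))
    v∉σ : v ∉ σ
    v∉σ v∈σ = v∉κ (x∈p∩q⁺ (v∈σ , v∈η))
    count : ∀ {α} → α ⊆ ρ → ∣ ρ ∣ ≡ suc ∣ α ∣ → ∀ {x} → x ∈ ρ → x ∉ α → ∀ y →
      ∣ ρ ∩ below ord y ∣ ≡ ∣ α ∩ below ord y ∣ ℕ.+ before x y
    count {α} α⊆ρ card {x} x∈ρ x∉α y = trans (cong (λ z → ∣ z ∩ below ord y ∣) (Facet.≡-insert α⊆ρ card x∈ρ x∉α))
      (trans (∣[]≔∩∣ α (below ord y) x x∉α)
        (cong (λ b → ∣ α ∩ below ord y ∣ ℕ.+ (if b then 1 else 0)) (lookup-below y x)))

∈-subsets : ∀ {n} (σ : Subset n) → σ ∈ₗ subsets n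
∈-subsets []                      = here refl
∈-subsets {suc n} (outside ∷ σ) = ∈-++⁺ˡ (∈-map⁺ (outside ∷_) (∈-subsets σ))
∈-subsets {suc n} (inside  ∷ σ) = ∈-++⁺ʳ (List.map (outside ∷_) (subsets n)) (∈-map⁺ (inside ∷_) (∈-subsets σ))

subsets-unique : ∀ n → Unique (subsets n)
subsets-unique zero    = All.[] ∷ []
subsets-unique (suc n) = Unique.++⁺ (Unique.map⁺ Vec.∷-injectiveʳ (subsets-unique n))
  (Unique.map⁺ Vec.∷-injectiveʳ (subsets-unique n)) disjoint
  where
  disjoint : ∀ {σ} → ¬ (σ ∈ₗ List.map (outside ∷_) (subsets n) × σ ∈ₗ List.map (inside ∷_) (subsets n))
  disjoint (p , q) with ∈-map⁻ (outside ∷_) p | ∈-map⁻ (inside ∷_) q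
  ... | _ , _ , refl | _ , _ , ()

lookup-injective : ∀ {A : Set} {xs : List A} → Unique xs → ∀ i j → List.lookup xs i ≡ List.lookup xs j → i ≡ j
lookup-injective (x∉ ∷ u) zero    zero    eq = refl
lookup-injective (x∉ ∷ u) zero    (suc j) eq = contradiction eq (All.lookup x∉ (∈-lookup j))
lookup-injective (x∉ ∷ u) (suc i) zero    eq = contradiction (sym eq) (All.lookup x∉ (∈-lookup i))
lookup-injective (x∉ ∷ u) (suc i) (suc j) eq = cong suc (lookup-injective u i j eq)

simplices-unique : ∀ {n} (X : SimplicialComplex n) i → Unique (simplices X i)
simplices-unique {n} X i = Unique.filter⁺ _ (subsets-unique n)

dimension⇒card : ∀ {n} (σ : Subset n) {i} → dimension σ ≡ ℤ.+ i → ∣ σ ∣ ≡ suc i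
dimension⇒card σ eq with ∣ σ ∣
dimension⇒card σ () | zero
dimension⇒card σ refl | suc k = refl

card⇒dimension : ∀ {n} (σ : Subset n) {i} → ∣ σ ∣ ≡ suc i → dimension σ ≡ ℤ.+ i
card⇒dimension σ eq rewrite eq = refl

-- The Laplacian as a Gram matrix

module Complex (K : OrderedField) where

  open OrderedFieldProperties K
  open TraceBound K

  indicator : ∀ {P : Set} → Dec P → Carrier
  indicator P? = if does P? then 1# else 0#

  indicator-yes : ∀ {P : Set} (P? : Dec P) → P → indicator P? ≡ 1#
  indicator-yes P? p = cong (if_then 1# else 0#) (dec-true P? p)

  indicator-≢0 : ∀ {P : Set} (P? : Dec P) → indicator P? ≢ 0# → P
  indicator-≢0 (yes p) _   = p
  indicator-≢0 (no _)  neq = contradiction refl neq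

  indicator-nonNeg : ∀ {P : Set} (P? : Dec P) → 0# ≤ indicator P?
  indicator-nonNeg (yes _) = 0≤1
  indicator-nonNeg (no _)  = ≤-refl

  length-filter : ∀ {A : Set} {P : Pred A 0ℓ} (P? : Decidable P) (xs : List A) →
    ι (length (filter P? xs)) ≡ ∑[ i < length xs ] (indicator (P? (List.lookup xs i)))
  length-filter P? [] = refl
  length-filter P? (x ∷ xs) with P? x
  ... | yes _ = cong (1# +_) (length-filter P? xs)
  ... | no _  = trans (length-filter P? xs) (sym (+-identityˡ _))

  sum-∈ : ∀ {n} (τ : Subset n) → ∑[ u < n ] (indicator (u ∈? τ)) ≡ ι ∣ τ ∣
  sum-∈ []            = refl
  sum-∈ (inside ∷ τ)  = cong (1# +_) (sum-∈ τ)
  sum-∈ (outside ∷ τ) = trans (+-identityˡ _) (sum-∈ τ)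

  module SignedIncidence {n : ℕ} {_<_ : Rel (Fin n) 0ℓ} (ord : IsStrictTotalOrder _≡_ _<_)
                         (X : SimplicialComplex n) (s : ℕ) where
    open SimplicialComplex X
    open Incidence ord

    r = suc s

    facet : Fin (f X s) → Subset n
    facet = List.lookup (simplices X s)

    face : Fin (f X r) → Subset n
    face = List.lookup (simplices X r)

    card-simplex : ∀ i j → ∣ List.lookup (simplices X i) j ∣ ≡ suc i
    card-simplex i j = dimension⇒card (List.lookup (simplices X i) j) (proj₂ (proj₂ (∈-filter⁻ (λ σ → face? σ ×-dec (dimension σ ℤ.≟ ℤ.+ i)) {xs = subsets n} (∈-lookup {xs = simplices X i} j))))

    face-face : ∀ t → Face (face t)
    face-face t = proj₁ (proj₂ (∈-filter⁻ (λ σ → face? σ ×-dec (dimension σ ℤ.≟ ℤ.+ r)) {xs = subsets n} (∈-lookup {xs = simplices X r} t)))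

    index-face : ∀ ρ → Face ρ → ∣ ρ ∣ ≡ suc r → ∃[ t ] face t ≡ ρ
    index-face ρ Fρ card = Any.index ρ∈ , sym (Any.lookup-index ρ∈)
      where
      ρ∈ : ρ ∈ₗ simplices X r
      ρ∈ = ∈-filter⁺ (λ σ → face? σ ×-dec (dimension σ ℤ.≟ ℤ.+ r)) (∈-subsets ρ) (Fρ , card⇒dimension ρ card)

    card-facet-face : ∀ t i → ∣ face t ∣ ≡ suc ∣ facet i ∣
    card-facet-face t i = trans (card-simplex r t) (cong suc (sym (card-simplex s i)))

    Bℤ : Fin (f X r) → Fin (f X s) → ℤ
    Bℤ t i = if does (facet i ⊆? face t) then incidence ord (face t) (facet i) else 0ℤ

    B : Fin (f X r) → Fin (f X s) → Carrier
    B t i = ⟦ Bℤ t i ⟧ℤ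

    Bℤ-⊆ : ∀ {t i} → facet i ⊆ face t → Bℤ t i ≡ incidence ord (face t) (facet i)
    Bℤ-⊆ {t} {i} h = cong (if_then incidence ord (face t) (facet i) else 0ℤ) (dec-true (facet i ⊆? face t) h)

    Bℤ-⊈ : ∀ {t i} → ¬ (facet i ⊆ face t) → Bℤ t i ≡ 0ℤ
    Bℤ-⊈ {t} {i} h = cong (if_then incidence ord (face t) (facet i) else 0ℤ) (dec-false (facet i ⊆? face t) h)

    B-≢0 : ∀ {t i} → B t i ≢ 0# → facet i ⊆ face t
    B-≢0 {t} {i} h with facet i ⊆? face t
    ... | yes p = p
    ... | no ¬p = contradiction refl h

    B² : ∀ t i → (B t i) ² ≡ indicator (facet i ⊆? face t)
    B² t i = trans (sym (*-homo (Bℤ t i) (Bℤ t i))) (helper (facet i ⊆? face t))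
      where
      helper : (d : Dec (facet i ⊆ face t)) → ⟦ Bℤ t i ℤ.* Bℤ t i ⟧ℤ ≡ indicator d
      helper (yes p) = trans (cong ⟦_⟧ℤ (trans (cong (λ z → z ℤ.* z) (Bℤ-⊆ p)) (incidence² p (card-facet-face t i)))) (+-identityʳ 1#)
      helper (no ¬p) = cong ⟦_⟧ℤ (cong (λ z → z ℤ.* z) (Bℤ-⊈ ¬p))

    B³≡B : ∀ t i → B t i * B t i * B t i ≡ B t i
    B³≡B t i = trans (cong (_* B t i) (B² t i)) (helper (facet i ⊆? face t))
      where
      helper : (d : Dec (facet i ⊆ face t)) → indicator d * B t i ≡ B t i
      helper (yes _) = *-identityˡ (B t i)
      helper (no ¬p) = trans (zeroˡ (B t i)) (sym (cong ⟦_⟧ℤ (Bℤ-⊈ ¬p)))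

    facet-injective : ∀ {i j} → facet i ≡ facet j → i ≡ j
    facet-injective {i} {j} = lookup-injective (simplices-unique X s) i j

    face-injective : ∀ {t u} → face t ≡ face u → t ≡ u
    face-injective {t} {u} = lookup-injective (simplices-unique X r) t u

    -- A facet of a face arises by deleting a vertex and is determined by it. Counting the pairs `N`
    -- of facets and deleted vertices in both orders gives at most one facet per vertex.
    size : ∀ t → ∑[ i < f X s ] ((B t i) ²) ≤ 1# + ι r
    size t = ≤-trans (sum-mono bound) (≤-trans (≤-reflexive (∑-comm (λ i u → N i u)))
      (≤-trans (sum-mono column) (≤-reflexive (trans (sum-∈ (face t)) (cong ι (card-simplex r t))))))
      where
      N? : ∀ i u → Dec (u ∈ face t × facet i ≡ face t ∖ u)
      N? i u = (u ∈? face t) ×-dec (Vec.≡-dec Bool._≟_ (facet i) (face t ∖ u))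
      N : Fin (f X s) → Fin n → Carrier
      N i u = indicator (N? i u)
      bound : ∀ i → (B t i) ² ≤ sum (N i)
      bound i = subst (_≤ sum (N i)) (sym (B² t i)) (helper (facet i ⊆? face t))
        where
        helper : (d : Dec (facet i ⊆ face t)) → indicator d ≤ sum (N i)
        helper (no _)  = sum-nonNeg λ u → indicator-nonNeg (N? i u)
        helper (yes p) = let u , u∈ , u∉ = Facet.extra p (card-facet-face t i) in
          ≤-trans (≤-reflexive (sym (indicator-yes (N? i u) (u∈ , Facet.≡-remove p (card-facet-face t i) u∈ u∉))))
            (term≤sum (N i) (λ u → indicator-nonNeg (N? i u)) u)
      column : ∀ u → ∑[ i < f X s ] (N i u) ≤ indicator (u ∈? face t)
      column u = sum-atMostOne-≤ (λ i → N i u)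
        (λ i j p q → facet-injective (trans (proj₂ (indicator-≢0 (N? i u) p)) (sym (proj₂ (indicator-≢0 (N? j u) q)))))
        (indicator-nonNeg (u ∈? face t)) term
        where
        term : ∀ i → N i u ≤ indicator (u ∈? face t)
        term i = helper (N? i u)
          where
          helper : (d : Dec (u ∈ face t × facet i ≡ face t ∖ u)) → indicator d ≤ indicator (u ∈? face t)
          helper (no _)         = indicator-nonNeg (u ∈? face t)
          helper (yes (u∈ , _)) = ≤-reflexive (sym (indicator-yes (u ∈? face t) u∈))

    module _ {i j : Fin (f X s)} (i≢j : i ≢ j) where

      -- The union of two distinct sets of equal size is strictly larger than each of them, and the
      -- face has only one vertex more than a facet.
      union-card : ∀ {t} → facet i ⊆ face t → facet j ⊆ face t → face t ≡ facet i ∪ facet j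
      union-card {t} p q = sym (⊆-card⇒≡ ∪⊆ (subst (ℕ._≤ ∣ facet i ∪ facet j ∣) (sym (card-facet-face t i)) larger))
        where
        ∪⊆ : facet i ∪ facet j ⊆ face t
        ∪⊆ x∈ with x∈p∪q⁻ (facet i) (facet j) x∈
        ... | inj₁ x∈i = p x∈i
        ... | inj₂ x∈j = q x∈j
        larger : ∣ facet i ∣ ℕ.< ∣ facet i ∪ facet j ∣
        larger = ℕ.≤∧≢⇒< (p⊆q⇒∣p∣≤∣q∣ (p⊆p∪q {p = facet i} (facet j))) λ eq → i≢j (facet-injective (sym
          (⊆-card⇒≡ (subst (facet j ⊆_) (sym (⊆-card⇒≡ (p⊆p∪q {p = facet i} (facet j)) (ℕ.≤-reflexive (sym eq)))) (q⊆p∪q (facet i) (facet j)))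
            (ℕ.≤-reflexive (trans (card-simplex s i) (sym (card-simplex s j)))))))

      product-≢0 : ∀ {t} → B t i * B t j ≢ 0# → face t ≡ facet i ∪ facet j
      product-≢0 {t} h = union-card
        (B-≢0 (λ e → h (trans (cong (_* B t j) e) (zeroˡ (B t j)))))
        (B-≢0 (λ e → h (trans (cong (B t i *_) e) (zeroʳ (B t i)))))

      card-∩ : ∣ facet i ∪ facet j ∣ ≡ suc r → ∣ facet i ∩ facet j ∣ ≡ s
      card-∩ eq = ℕ.+-cancelˡ-≡ (suc r) _ _ (trans (cong (ℕ._+ ∣ facet i ∩ facet j ∣) (sym eq))
        (trans (∣∪∣+∣∩∣ (facet i) (facet j)) (trans (cong₂ ℕ._+_ (card-simplex s i) (card-simplex s j)) (ℕ.+-suc (suc s) s))))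

      card-∪ : ∣ facet i ∩ facet j ∣ ≡ s → ∣ facet i ∪ facet j ∣ ≡ suc r
      card-∪ eq = ℕ.+-cancelʳ-≡ s _ _ (trans (cong (∣ facet i ∪ facet j ∣ ℕ.+_) (sym eq))
        (trans (∣∪∣+∣∩∣ (facet i) (facet j)) (trans (cong₂ ℕ._+_ (card-simplex s i) (card-simplex s j)) (ℕ.+-suc (suc s) s))))

    linear : ∀ {i j t u} → i ≢ j → B t i ≢ 0# → B t j ≢ 0# → B u i ≢ 0# → B u j ≢ 0# → t ≡ u
    linear i≢j a b c d = face-injective
      (trans (union-card i≢j (B-≢0 a) (B-≢0 b)) (sym (union-card i≢j (B-≢0 c) (B-≢0 d))))

    -- Off the diagonal only the union of the two facets can contribute. It is an r-face exactly
    -- under the condition in `entry`, and `incidence-square` matches the signs. On the diagonal the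
    -- squares count the r-faces.
    laplacian : ∀ i j → ⟦ entry ord X r (facet i) (facet j) ⟧ℤ ≡ ∑[ t < f X r ] (B t i * B t j)
    laplacian i j = helper (Vec.≡-dec Bool._≟_ (facet i) (facet j)) ((∣ facet i ∩ facet j ∣ ℕ.≟ s) ×-dec face? (facet i ∪ facet j))
      where
      off : ℤ
      off = ℤ.- (incidence ord (facet i) (facet i ∩ facet j) ℤ.* incidence ord (facet j) (facet i ∩ facet j))
      helper : (d : Dec (facet i ≡ facet j)) (e : Dec (∣ facet i ∩ facet j ∣ ≡ s × Face (facet i ∪ facet j))) →
        ⟦ if does d then ℤ.+ degree X r (facet i) else if does e then off else 0ℤ ⟧ℤ ≡ ∑[ t < f X r ] (B t i * B t j)
      helper (yes eq) _ with facet-injective eq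
      ... | refl = trans (length-filter (facet i ⊆?_) (simplices X r)) (sum-cong-≗ (λ t → sym (B² t i)))
      helper (no neq) (no ¬e) = sym (sum-zero (λ t → decidable-stable (B t i * B t j ≟ 0#) λ h →
        let eq = product-≢0 i≢j h in
        ¬e (card-∩ i≢j (trans (cong ∣_∣ (sym eq)) (card-simplex r t)) , subst Face eq (face-face t))))
        where
        i≢j : i ≢ j
        i≢j = neq ∘ cong facet
      helper (no neq) (yes (eq , Fρ)) with index-face (facet i ∪ facet j) Fρ (card-∪ (neq ∘ cong facet) eq)
      ... | t₀ , face≡ = sym (trans (sum-single (λ t → B t i * B t j) t₀ (λ t t≢t₀ → decidable-stable (B t i * B t j ≟ 0#) λ h →
              t≢t₀ (face-injective (trans (product-≢0 i≢j h) (sym face≡)))))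
            (trans (sym (*-homo (Bℤ t₀ i) (Bℤ t₀ j))) (cong ⟦_⟧ℤ (trans
              (cong₂ ℤ._*_ (trans (Bℤ-⊆ (subst (facet i ⊆_) (sym face≡) (p⊆p∪q (facet j)))) (cong (λ ρ → incidence ord ρ (facet i)) face≡))
                           (trans (Bℤ-⊆ (subst (facet j ⊆_) (sym face≡) (q⊆p∪q (facet i) (facet j)))) (cong (λ ρ → incidence ord ρ (facet j)) face≡)))
              (incidence-square (trans (card-∪ i≢j eq) (cong suc (sym (card-simplex s i)))) (trans (card-∪ i≢j eq) (cong suc (sym (card-simplex s j))))
                (trans (card-simplex s i) (cong suc (sym eq))) (trans (card-simplex s j) (cong suc (sym eq))))))))
        where
        i≢j : i ≢ j
        i≢j = neq ∘ cong facet

  module LaplacianBound {n : ℕ} {_<_ : Rel (Fin n) 0ℓ} (ord : IsStrictTotalOrder _≡_ _<_) (X : SimplicialComplex n) (s : ℕ)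
    where

    open SignedIncidence ord X s using (r; facet; B; B³≡B; size; linear; laplacian)

    Λ : Fin (f X s) → Fin (f X s) → Carrier
    Λ i j = ⟦ entry ord X r (facet i) (facet j) ⟧ℤ

    Λ-sym : ∀ i j → Λ i j ≡ Λ j i
    Λ-sym i j = trans (laplacian i j) (trans (sum-cong-≗ λ t → *-comm (B t i) (B t j)) (sym (laplacian j i)))

    quadratic : (Fin (f X s) → Carrier) → Carrier
    quadratic x = dot x (λ i → dot (Λ i) x)

    quadratic≡ : ∀ x → quadratic x ≡ ∑[ t < f X r ] ((dot (B t) x) ²)
    quadratic≡ x = begin
      ∑[ i < f X s ] (x i * ∑[ j < f X s ] (Λ i j * x j))
        ≡⟨ sum-cong-≗ (λ i → trans (*-distribˡ-sum (x i) (λ j → Λ i j * x j)) (sum-cong-≗ λ j →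
             trans (cong (λ l → x i * (l * x j)) (laplacian i j))
             (trans (cong (x i *_) (*-distribʳ-sum (x j) (λ t → B t i * B t j)))
             (trans (*-distribˡ-sum (x i) (λ t → B t i * B t j * x j))
             (sum-cong-≗ λ t → solve 4 (λ a b c d → a :* (b :* c :* d) := b :* a :* (c :* d)) refl (x i) (B t i) (B t j) (x j)))))) ⟩
      ∑[ i < f X s ] ∑[ j < f X s ] ∑[ t < f X r ] (B t i * x i * (B t j * x j))
        ≡⟨ sum-cong-≗ (λ i → ∑-comm (λ j t → B t i * x i * (B t j * x j))) ⟩
      ∑[ i < f X s ] ∑[ t < f X r ] ∑[ j < f X s ] (B t i * x i * (B t j * x j))
        ≡⟨ ∑-comm (λ i t → ∑[ j < f X s ] (B t i * x i * (B t j * x j))) ⟩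
      ∑[ t < f X r ] ∑[ i < f X s ] ∑[ j < f X s ] (B t i * x i * (B t j * x j))
        ≡⟨ sum-cong-≗ (λ t → sum-* (λ i → B t i * x i) (λ j → B t j * x j)) ⟩
      ∑[ t < f X r ] ((dot (B t) x) ²) ∎
      where open ≡-Reasoning

    module _ {k : ℕ} (1≤k : 1 ℕ.≤ k) (x : Fin k → Fin (f X s) → Carrier) (e : Carrier) (0≤e : 0# ≤ e)
             (near⁺ : ∀ i j → i ≢ j → 0# ≤ e + dot (x i) (x j)) (near⁻ : ∀ i j → i ≢ j → 0# ≤ e - dot (x i) (x j)) where

      open ApproximateBessel x e 0≤e near⁺ near⁻

      quadratic-bound : ∑[ i < k ] (c i * quadratic (x i)) ≤ ι (f X r ℕ.+ ((r ℕ.+ 1) ℕ.* k) ℕ.C 2)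
      quadratic-bound = *-cancelˡ-≤ (ι 2) (ι-nonNeg 2) (1≤x⇒x≢0 (1≤ι 1))
        (≤-trans (≤-reflexive (cong (ι 2 *_) lhs)) (≤-trans bound (≤-reflexive rhs)))
        where
        q : Fin (f X r) → Carrier
        q t = ∑[ i < k ] (c i * (dot (B t) (x i)) ²)
        bound : ι 2 * sum q ≤ ι 2 * ι (f X r) + ((ι (suc r ℕ.* k)) ² - ι (suc r ℕ.* k))
        bound = SignedHypergraph.Compression.compression-bound r B B³≡B size linear (ℕ.s≤s ℕ.z≤n) k x c c-nonNeg bessel trace 1≤k
        lhs : ∑[ i < k ] (c i * quadratic (x i)) ≡ sum q
        lhs = trans (sum-cong-≗ λ i → trans (cong (c i *_) (quadratic≡ (x i))) (*-distribˡ-sum (c i) (λ t → (dot (B t) (x i)) ²)))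
          (∑-comm (λ i t → c i * (dot (B t) (x i)) ²))
        m = (r ℕ.+ 1) ℕ.* k
        m≡ : suc r ℕ.* k ≡ m
        m≡ = cong (ℕ._* k) (ℕ.+-comm 1 r)
        rhs : ι 2 * ι (f X r) + ((ι (suc r ℕ.* k)) ² - ι (suc r ℕ.* k)) ≡ ι 2 * ι (f X r ℕ.+ m ℕ.C 2)
        rhs = trans (cong (λ l → ι 2 * ι (f X r) + ((ι l) ² - ι l)) m≡)
          (trans (cong (λ y → ι 2 * ι (f X r) + (y - ι m)) (trans (sym (ι-* m m)) (trans (cong ι (sym (2*[nC2]+n m)))
              (trans (ι-+ (2 ℕ.* (m ℕ.C 2)) m) (cong (_+ ι m) (ι-* 2 (m ℕ.C 2)))))))
            (trans (solve 3 (λ f c m → :ι 2 :* f :+ (:ι 2 :* c :+ m :- m) := :ι 2 :* (f :+ c)) refl (ι (f X r)) (ι (m ℕ.C 2)) (ι m))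
              (cong (ι 2 *_) (sym (ι-+ (f X r) (m ℕ.C 2))))))

    module _ {k : ℕ} (1≤k : 1 ℕ.≤ k) (x : Fin k → Fin (f X s) → Carrier) (e : Carrier) (0≤e : 0# ≤ e)
             (near⁺ : ∀ i j → i ≢ j → 0# ≤ e + dot (x i) (x j)) (near⁻ : ∀ i j → i ≢ j → 0# ≤ e - dot (x i) (x j)) where

      open ApproximateBessel x e 0≤e near⁺ near⁻

      approximate-eigenvalue-bound : ∀ (μ d : Fin k → Carrier) ε → 0# ≤ ε → (∀ i → 0# ≤ d i) → (∀ i → d i ≢ 0#) →
        (∀ i → d i ≤ norm i) → (∀ i → μ i * norm i - quadratic (x i) ≤ d i * ε) →
        sum μ ≤ ι (f X r ℕ.+ ((r ℕ.+ 1) ℕ.* k) ℕ.C 2) + ι k * ε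
      approximate-eigenvalue-bound μ d ε 0≤ε 0≤d d≢0 d≤norm h =
        ≤-trans (sum-mono λ i → rayleigh {N = norm i} {Q = quadratic (x i)} (0≤d i) (d≢0 i) 0≤ε (d≤norm i) (h i))
          (≤-trans (≤-reflexive (trans (∑-distrib-+ (λ i → c i * quadratic (x i)) (λ _ → ε)) (cong₂ _+_ refl (sum-const k ε))))
            (+-monoˡ-≤ (ι k * ε) (quadratic-bound 1≤k x e 0≤e near⁺ near⁻)))

open import Data.Rational as ℚ using (ℚ; 0ℚ; 1ℚ; ½)
import Data.Rational.Properties as ℚ
import Data.Rational.Unnormalised as ℚᵘ
import Data.Rational.Unnormalised.Properties as ℚᵘ
open import Data.Vec.Functional using (Vector)

-- From rational approximations to real eigenvalues

ℚ-orderedField : OrderedField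
ℚ-orderedField = record
  { isCommutativeRing = ℚ.+-*-isCommutativeRing
  ; isDecTotalOrder   = ℚ.≤-isDecTotalOrder
  ; +-monoˡ-≤         = λ z → ℚ.+-monoˡ-≤ z
  ; *-nonNeg          = λ {x} {y} 0≤x 0≤y → subst (ℚ._≤ x ℚ.* y) (ℚ.*-zeroʳ x)
                          (ℚ.*-monoˡ-≤-nonNeg x {{ℚ.nonNegative 0≤x}} 0≤y)
  ; 1≰0               = λ { (ℚ.*≤* (ℤ.+≤+ ())) }
  ; inverse           = λ x x≢0 → let instance _ = ℚ.≢-nonZero x≢0 in ℚ.1/ x , ℚ.*-inverseʳ x
  }

module Q = OrderedFieldProperties ℚ-orderedField

/1-homo-+ : ∀ i j → (i ℤ.+ j) ℚ./ 1 ≡ i ℚ./ 1 ℚ.+ j ℚ./ 1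
/1-homo-+ i j = ℚ.toℚᵘ-injective (ℚᵘ.≃-trans (ℚ.toℚᵘ-fromℚᵘ (ℚᵘ.mkℚᵘ (i ℤ.+ j) 0)) (ℚᵘ.≃-trans
  (ℚᵘ.*≡* (solve 2 (λ i j → (i :+ j) :* :ι 1 := (i :* :ι 1 :+ j :* :ι 1) :* :ι 1) refl i j))
  (ℚᵘ.≃-sym (ℚᵘ.≃-trans (ℚ.toℚᵘ-homo-+ (i ℚ./ 1) (j ℚ./ 1))
    (ℚᵘ.+-cong (ℚ.toℚᵘ-fromℚᵘ (ℚᵘ.mkℚᵘ i 0)) (ℚ.toℚᵘ-fromℚᵘ (ℚᵘ.mkℚᵘ j 0)))))))
  where
  open IntegerSolver ℤ.+-*-commutativeRing using (solve)

ι≡/1 : ∀ n → Q.ι n ≡ ℤ.+ n ℚ./ 1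
ι≡/1 zero    = refl
ι≡/1 (suc n) = trans (cong (1ℚ ℚ.+_) (ι≡/1 n)) (sym (/1-homo-+ (ℤ.+ 1) (ℤ.+ n)))

⟦⟧ℤ≡/1 : ∀ i → Q.⟦ i ⟧ℤ ≡ i ℚ./ 1
⟦⟧ℤ≡/1 (ℤ.+ n)      = ι≡/1 n
⟦⟧ℤ≡/1 ℤ.-[1+ n ]   = cong ℚ.-_ (ι≡/1 (suc n))

-- Null sequences of rationals

Eventually : (ℕ → Set) → Set
Eventually P = ∃[ N ] (∀ n → N ℕ.≤ n → P n)

eventually-map : ∀ {P P′ : ℕ → Set} → (∀ n → P n → P′ n) → Eventually P → Eventually P′
eventually-map g (N , h) = N , λ n p → g n (h n p)

eventually-× : ∀ {P P′ : ℕ → Set} → Eventually P → Eventually P′ → Eventually (λ n → P n × P′ n)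
eventually-× (M , g) (N , h) = M ℕ.⊔ N , λ n p → g n (ℕ.m⊔n≤o⇒m≤o M N p) , h n (ℕ.m⊔n≤o⇒n≤o M N p)

eventually-∀ : ∀ {k} {P : Fin k → ℕ → Set} → (∀ i → Eventually (P i)) → Eventually (λ n → ∀ i → P i n)
eventually-∀ {zero}  h = 0 , λ _ _ ()
eventually-∀ {suc k} h = eventually-map (λ n → λ { (p , ps) zero → p ; (p , ps) (suc i) → ps i })
  (eventually-× (h zero) (eventually-∀ (h ∘ suc)))

0<½* : ∀ {ε} → 0ℚ ℚ.< ε → 0ℚ ℚ.< ½ ℚ.* ε
0<½* {ε} 0<ε = subst (ℚ._< ½ ℚ.* ε) (ℚ.*-zeroʳ ½) (ℚ.*-monoʳ-<-pos ½ {0ℚ} {ε} 0<ε)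

halves : ∀ ε → ½ ℚ.* ε ℚ.+ ½ ℚ.* ε ≡ ε
halves ε = trans (sym (ℚ.*-distribʳ-+ ε ½ ½)) (ℚ.*-identityˡ ε)

open Q using (solve)

p≤∣p∣ : ∀ p → p ℚ.≤ ℚ.∣ p ∣
p≤∣p∣ p with ℚ.≤-total 0ℚ p
... | inj₁ 0≤p = ℚ.≤-reflexive (sym (ℚ.0≤p⇒∣p∣≡p 0≤p))
... | inj₂ p≤0 = ℚ.≤-trans p≤0 (ℚ.0≤∣p∣ p)

Null : (ℕ → ℚ) → Set
Null s = ∀ ε → 0ℚ ℚ.< ε → Eventually (λ n → ℚ.∣ s n ∣ ℚ.≤ ε)

null-≗ : ∀ {s t} → (∀ n → s n ≡ t n) → Null s → Null t
null-≗ eq h ε 0<ε = eventually-map (λ n → subst (λ y → ℚ.∣ y ∣ ℚ.≤ ε) (eq n)) (h ε 0<ε)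

null-0 : Null (λ _ → 0ℚ)
null-0 ε 0<ε = 0 , λ _ _ → ℚ.<⇒≤ 0<ε

null-+ : ∀ {s t} → Null s → Null t → Null (λ n → s n ℚ.+ t n)
null-+ {s} {t} hs ht ε 0<ε = eventually-map
  (λ { n (p , q) → ℚ.≤-trans (ℚ.∣p+q∣≤∣p∣+∣q∣ (s n) (t n)) (subst (ℚ.∣ s n ∣ ℚ.+ ℚ.∣ t n ∣ ℚ.≤_) (halves ε) (ℚ.+-mono-≤ p q)) })
  (eventually-× (hs (½ ℚ.* ε) (0<½* 0<ε)) (ht (½ ℚ.* ε) (0<½* 0<ε)))

null-neg : ∀ {s} → Null s → Null (λ n → ℚ.- s n)
null-neg {s} h ε 0<ε = eventually-map (λ n → subst (ℚ._≤ ε) (sym (ℚ.∣-p∣≡∣p∣ (s n)))) (h ε 0<ε)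

null-≤ : ∀ {s t} → (∀ n → ℚ.∣ s n ∣ ℚ.≤ ℚ.∣ t n ∣) → Null t → Null s
null-≤ le h ε 0<ε = eventually-map (λ n → ℚ.≤-trans (le n)) (h ε 0<ε)

null-sum : ∀ {k} {s : Fin k → ℕ → ℚ} → (∀ i → Null (s i)) → Null (λ n → Q.sum (λ i → s i n))
null-sum {zero}  h = null-0
null-sum {suc k} h = null-+ (h zero) (null-sum (h ∘ suc))

bounded : ∀ x → ∃[ c ] 0ℚ ℚ.< c × Eventually (λ n → ℚ.∣ seq x n ∣ ℚ.≤ c)
bounded x with cauchy x 1ℚ (ℚ.positive⁻¹ 1ℚ)
... | N , h = 1ℚ ℚ.+ ℚ.∣ seq x N ∣ , ℚ.+-mono-<-≤ (ℚ.positive⁻¹ 1ℚ) (ℚ.0≤∣p∣ (seq x N)) , N , λ n p → begin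
  ℚ.∣ seq x n ∣                               ≡⟨ cong ℚ.∣_∣ (solve 2 (λ a b → a := (a :- b) :+ b) refl (seq x n) (seq x N)) ⟩
  ℚ.∣ (seq x n ℚ.- seq x N) ℚ.+ seq x N ∣     ≤⟨ ℚ.∣p+q∣≤∣p∣+∣q∣ (seq x n ℚ.- seq x N) (seq x N) ⟩
  ℚ.∣ seq x n ℚ.- seq x N ∣ ℚ.+ ℚ.∣ seq x N ∣ ≤⟨ ℚ.+-monoˡ-≤ ℚ.∣ seq x N ∣ (h n N p ℕ.≤-refl) ⟩
  1ℚ ℚ.+ ℚ.∣ seq x N ∣                        ∎
  where open ℚ.≤-Reasoning

scaled : ∀ {c ε} → 0ℚ ℚ.< c → 0ℚ ℚ.< ε → ∃[ d ] 0ℚ ℚ.< d × c ℚ.* d ≡ ε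
scaled {c} {ε} 0<c 0<ε = ℚ.1/ c ℚ.* ε , subst (ℚ._< ℚ.1/ c ℚ.* ε) (ℚ.*-zeroʳ (ℚ.1/ c)) (ℚ.*-monoʳ-<-pos (ℚ.1/ c) 0<ε) ,
  trans (sym (ℚ.*-assoc c (ℚ.1/ c) ε)) (trans (cong (ℚ._* ε) (ℚ.*-inverseʳ c)) (ℚ.*-identityˡ ε))
  where
  instance
    _ = ℚ.positive 0<c
    _ = ℚ.pos⇒nonZero c
    _ = ℚ.1/pos⇒pos c

∣*∣-mono-≤ : ∀ {a b c d} → 0ℚ ℚ.≤ c → ℚ.∣ a ∣ ℚ.≤ c → ℚ.∣ b ∣ ℚ.≤ d → ℚ.∣ a ℚ.* b ∣ ℚ.≤ c ℚ.* d
∣*∣-mono-≤ {a} {b} {c} {d} 0≤c p q = ℚ.≤-trans (ℚ.≤-reflexive (ℚ.∣p*q∣≡∣p∣*∣q∣ a b))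
  (ℚ.≤-trans (ℚ.*-monoʳ-≤-nonNeg ℚ.∣ b ∣ {{ℚ.nonNegative (ℚ.0≤∣p∣ b)}} p)
             (ℚ.*-monoˡ-≤-nonNeg c {{ℚ.nonNegative 0≤c}} q))

null-* : ∀ x {t} → Null t → Null (λ n → seq x n ℚ.* t n)
null-* x {t} h ε 0<ε =
  let c , 0<c , bound = bounded x
      d , 0<d , cd≡ε  = scaled 0<c 0<ε
  in eventually-map (λ n pq → subst (ℚ.∣ seq x n ℚ.* t n ∣ ℚ.≤_) cd≡ε
       (∣*∣-mono-≤ {seq x n} {t n} (ℚ.<⇒≤ 0<c) (proj₁ pq) (proj₂ pq)))
     (eventually-× bound (h d 0<d))

-- The commutative ring of Cauchy reals

-ᵣ_ : ℝ → ℝ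
seq    (-ᵣ x) n = ℚ.- seq x n
cauchy (-ᵣ x) ε 0<ε = let N , h = cauchy x ε 0<ε in N , λ m n p q → subst (ℚ._≤ ε)
  (trans (sym (ℚ.∣-p∣≡∣p∣ (seq x m ℚ.- seq x n)))
    (cong ℚ.∣_∣ (solve 2 (λ a b → :- (a :- b) := :- a :- (:- b)) refl (seq x m) (seq x n)))) (h m n p q)

≈-pointwise : ∀ {x y} → (∀ n → seq x n ≡ seq y n) → x ≈ᵣ y
≈-pointwise {x} {y} eq = null-≗ (λ n → trans (sym (ℚ.+-inverseʳ (seq x n))) (cong (λ z → seq x n ℚ.- z) (eq n))) null-0

≈ᵣ-isEquivalence : IsEquivalence _≈ᵣ_
≈ᵣ-isEquivalence = record
  { refl  = λ {x} → ≈-pointwise {x} {x} (λ _ → refl)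
  ; sym   = λ {x} {y} h → null-≗ (λ n → solve 2 (λ a b → :- (a :- b) := b :- a) refl (seq x n) (seq y n)) (null-neg h)
  ; trans = λ {x} {y} {z} h h′ → null-≗ (λ n → solve 3 (λ a b c → (a :- b) :+ (b :- c) := a :- c) refl (seq x n) (seq y n) (seq z n)) (null-+ h h′)
  }

ℝ-commutativeRing : CommutativeRing 0ℓ 0ℓ
ℝ-commutativeRing = record
  { Carrier = ℝ ; _≈_ = _≈ᵣ_ ; _+_ = _+ᵣ_ ; _*_ = _*ᵣ_ ; -_ = -ᵣ_ ; 0# = 0ᵣ ; 1# = fromℕ 1
  ; isCommutativeRing = record
    { isRing = record
      { +-isAbelianGroup = record
        { isGroup = record
          { isMonoid = record
            { isSemigroup = record
              { isMagma = record
                { isEquivalence = ≈ᵣ-isEquivalence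
                ; ∙-cong = λ {x} {y} {u} {v} h h′ → null-≗ (λ n → solve 4 (λ a b c d → (a :- b) :+ (c :- d) := (a :+ c) :- (b :+ d)) refl
                             (seq x n) (seq y n) (seq u n) (seq v n)) (null-+ h h′)
                }
              ; assoc = λ x y z → ≈-pointwise {(x +ᵣ y) +ᵣ z} {x +ᵣ (y +ᵣ z)} (λ n → ℚ.+-assoc (seq x n) (seq y n) (seq z n))
              }
            ; identity = (λ x → ≈-pointwise {0ᵣ +ᵣ x} {x} (λ n → ℚ.+-identityˡ (seq x n)))
                       , (λ x → ≈-pointwise {x +ᵣ 0ᵣ} {x} (λ n → ℚ.+-identityʳ (seq x n)))
            }
          ; inverse = (λ x → ≈-pointwise {(-ᵣ x) +ᵣ x} {0ᵣ} (λ n → ℚ.+-inverseˡ (seq x n)))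
                    , (λ x → ≈-pointwise {x +ᵣ (-ᵣ x)} {0ᵣ} (λ n → ℚ.+-inverseʳ (seq x n)))
          ; ⁻¹-cong = λ {x} {y} h → null-≗ (λ n → solve 2 (λ a b → :- (a :- b) := :- a :- (:- b)) refl (seq x n) (seq y n)) (null-neg h)
          }
        ; comm = λ x y → ≈-pointwise {x +ᵣ y} {y +ᵣ x} (λ n → ℚ.+-comm (seq x n) (seq y n))
        }
      ; *-cong = λ {x} {y} {u} {v} h h′ → null-≗ (λ n → solve 4 (λ a b c d → a :* (c :- d) :+ d :* (a :- b) := a :* c :- b :* d) refl
                   (seq x n) (seq y n) (seq u n) (seq v n)) (null-+ (null-* x h′) (null-* v h))
      ; *-assoc = λ x y z → ≈-pointwise {(x *ᵣ y) *ᵣ z} {x *ᵣ (y *ᵣ z)} (λ n → ℚ.*-assoc (seq x n) (seq y n) (seq z n))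
      ; *-identity = (λ x → ≈-pointwise {fromℕ 1 *ᵣ x} {x} (λ n → ℚ.*-identityˡ (seq x n)))
                   , (λ x → ≈-pointwise {x *ᵣ fromℕ 1} {x} (λ n → ℚ.*-identityʳ (seq x n)))
      ; distrib = (λ x y z → ≈-pointwise {x *ᵣ (y +ᵣ z)} {x *ᵣ y +ᵣ x *ᵣ z} (λ n → ℚ.*-distribˡ-+ (seq x n) (seq y n) (seq z n)))
                , (λ x y z → ≈-pointwise {(y +ᵣ z) *ᵣ x} {y *ᵣ x +ᵣ z *ᵣ x} (λ n → ℚ.*-distribʳ-+ (seq x n) (seq y n) (seq z n)))
      }
    ; *-comm = λ x y → ≈-pointwise {x *ᵣ y} {y *ᵣ x} (λ n → ℚ.*-comm (seq x n) (seq y n))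
    }
  }

-- Comparisons of reals and double negation

EventuallyPositive : (ℕ → ℚ) → Set
EventuallyPositive s = ∃[ d ] 0ℚ ℚ.< d × Eventually (λ n → d ℚ.≤ s n)

-- One rational term, from which later ones differ by at most ε/4, is compared with ε/2. Either
-- outcome leaves a margin of ε/4.
dichotomy : ∀ s → IsCauchy s → ∀ ε → 0ℚ ℚ.< ε → Eventually (λ n → s n ℚ.≤ ε) ⊎ EventuallyPositive s
dichotomy s cs ε 0<ε with cs (½ ℚ.* (½ ℚ.* ε)) (0<½* (0<½* 0<ε))
... | N , h with s N ℚ.≤? ½ ℚ.* ε
...   | yes p = inj₁ (N , λ n q → begin
  s n                                       ≡⟨ solve 2 (λ a b → a := b :+ (a :- b)) refl (s n) (s N) ⟩
  s N ℚ.+ (s n ℚ.- s N)                     ≤⟨ ℚ.+-mono-≤ p (ℚ.≤-trans (p≤∣p∣ (s n ℚ.- s N)) (h n N q ℕ.≤-refl)) ⟩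
  ½ ℚ.* ε ℚ.+ ½ ℚ.* (½ ℚ.* ε)              ≤⟨ ℚ.+-monoʳ-≤ (½ ℚ.* ε) (Q.≤-by (½ ℚ.* (½ ℚ.* ε)) (ℚ.<⇒≤ (0<½* (0<½* 0<ε))) (halves (½ ℚ.* ε))) ⟩
  ½ ℚ.* ε ℚ.+ ½ ℚ.* ε                       ≡⟨ halves ε ⟩
  ε                                         ∎)
  where open ℚ.≤-Reasoning
...   | no ¬p = inj₂ (½ ℚ.* (½ ℚ.* ε) , 0<½* (0<½* 0<ε) , N , λ n q → begin
  ½ ℚ.* (½ ℚ.* ε)                                 ≡⟨ solve 1 (λ e → e := e :+ e :- e) refl (½ ℚ.* (½ ℚ.* ε)) ⟩
  ½ ℚ.* (½ ℚ.* ε) ℚ.+ ½ ℚ.* (½ ℚ.* ε) ℚ.- ½ ℚ.* (½ ℚ.* ε)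
    ≤⟨ ℚ.+-mono-≤ (ℚ.≤-trans (ℚ.≤-reflexive (halves (½ ℚ.* ε))) (ℚ.<⇒≤ (ℚ.≰⇒> ¬p)))
         (ℚ.neg-antimono-≤ (ℚ.≤-trans (p≤∣p∣ (s N ℚ.- s n)) (h N n ℕ.≤-refl q))) ⟩
  s N ℚ.- (s N ℚ.- s n)                           ≡⟨ solve 2 (λ a b → b :- (b :- a) := a) refl (s n) (s N) ⟩
  s n                                             ∎)
  where open ℚ.≤-Reasoning

seq-∑ : ∀ {k} (g : Vector ℝ k) n → seq (∑ g) n ≡ Q.sum (λ i → seq (g i) n)
seq-∑ {zero}  g n = refl
seq-∑ {suc k} g n = cong (seq (g zero) n ℚ.+_) (seq-∑ (g ∘ suc) n)

≈0⇒null : ∀ x → x ≈ᵣ 0ᵣ → Null (seq x)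
≈0⇒null x = null-≗ (λ n → ℚ.+-identityʳ (seq x n))

null⇒≈0 : ∀ x → Null (seq x) → x ≈ᵣ 0ᵣ
null⇒≈0 x = null-≗ (λ n → sym (ℚ.+-identityʳ (seq x n)))

½*≱ : ∀ {d} → 0ℚ ℚ.< d → ¬ d ℚ.≤ ½ ℚ.* d
½*≱ {d} 0<d p = ℚ.<-irrefl refl (ℚ.<-≤-trans
  (subst₂ ℚ._<_ (ℚ.+-identityʳ (½ ℚ.* d)) (halves d) (ℚ.+-monoʳ-< (½ ℚ.* d) (0<½* 0<d))) p)

positive-not-small : ∀ {s} (pos : EventuallyPositive s) → ¬ Eventually (λ n → s n ℚ.≤ ½ ℚ.* proj₁ pos)
positive-not-small (d , 0<d , M , h) (N , g) =
  ½*≱ 0<d (ℚ.≤-trans (h (M ℕ.⊔ N) (ℕ.m≤m⊔n M N)) (g (M ℕ.⊔ N) (ℕ.m≤n⊔m M N)))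

∣cauchy∣ : ∀ x → IsCauchy (λ n → ℚ.∣ seq x n ∣)
∣cauchy∣ x ε 0<ε = let N , h = cauchy x ε 0<ε in N , λ m n p q → ℚ.≤-trans (reverse (seq x m) (seq x n)) (h m n p q)
  where
  half : ∀ a b → ℚ.∣ a ∣ ℚ.- ℚ.∣ b ∣ ℚ.≤ ℚ.∣ a ℚ.- b ∣
  half a b = subst₂ ℚ._≤_ refl (solve 2 (λ x y → x :+ y :- y := x) refl ℚ.∣ a ℚ.- b ∣ ℚ.∣ b ∣) (ℚ.+-monoˡ-≤ (ℚ.- ℚ.∣ b ∣)
    (subst (λ y → ℚ.∣ y ∣ ℚ.≤ ℚ.∣ a ℚ.- b ∣ ℚ.+ ℚ.∣ b ∣) (solve 2 (λ a b → (a :- b) :+ b := a) refl a b) (ℚ.∣p+q∣≤∣p∣+∣q∣ (a ℚ.- b) b)))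
  reverse : ∀ a b → ℚ.∣ ℚ.∣ a ∣ ℚ.- ℚ.∣ b ∣ ∣ ℚ.≤ ℚ.∣ a ℚ.- b ∣
  reverse a b with ℚ.∣p∣≡p∨∣p∣≡-p (ℚ.∣ a ∣ ℚ.- ℚ.∣ b ∣)
  ... | inj₁ eq = subst (ℚ._≤ ℚ.∣ a ℚ.- b ∣) (sym eq) (half a b)
  ... | inj₂ eq = subst₂ ℚ._≤_ (trans (solve 2 (λ x y → y :- x := :- (x :- y)) refl ℚ.∣ a ∣ ℚ.∣ b ∣) (sym eq))
                    (trans (sym (ℚ.∣-p∣≡∣p∣ (b ℚ.- a))) (cong ℚ.∣_∣ (solve 2 (λ a b → :- (b :- a) := a :- b) refl a b))) (half b a)

null-or-positive : ∀ x → ¬ EventuallyPositive (λ n → ℚ.∣ seq x n ∣) → Null (seq x)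
null-or-positive x ¬pos ε 0<ε with dichotomy (λ n → ℚ.∣ seq x n ∣) (∣cauchy∣ x) ε 0<ε
... | inj₁ small = small
... | inj₂ pos   = contradiction pos ¬pos

null-stable : ∀ x → ¬ ¬ Null (seq x) → Null (seq x)
null-stable x ¬¬null = null-or-positive x λ pos → ¬¬null λ null →
  positive-not-small pos (null (½ ℚ.* proj₁ pos) (0<½* (proj₁ (proj₂ pos))))

apart : ∀ x → ¬ x ≈ᵣ 0ᵣ → ¬ ¬ EventuallyPositive (λ n → ℚ.∣ seq x n ∣)
apart x x≉0 ¬pos = x≉0 (null⇒≈0 x (null-or-positive x ¬pos))

null-quotient : ∀ (s t : ℕ → ℚ) → EventuallyPositive (λ n → ℚ.∣ s n ∣) → Null (λ n → s n ℚ.* t n) → Null t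
null-quotient s t (d , 0<d , pos) h ε 0<ε = eventually-map le (eventually-× pos (h (d ℚ.* ε) 0<dε))
  where
  instance
    _ = ℚ.positive 0<d
  0<dε : 0ℚ ℚ.< d ℚ.* ε
  0<dε = subst (ℚ._< d ℚ.* ε) (ℚ.*-zeroʳ d) (ℚ.*-monoʳ-<-pos d 0<ε)
  le : ∀ n → (d ℚ.≤ ℚ.∣ s n ∣) × (ℚ.∣ s n ℚ.* t n ∣ ℚ.≤ d ℚ.* ε) → ℚ.∣ t n ∣ ℚ.≤ ε
  le n (p , q) = ℚ.*-cancelˡ-≤-pos d (ℚ.≤-trans
    (ℚ.*-monoʳ-≤-nonNeg ℚ.∣ t n ∣ {{ℚ.nonNegative (ℚ.0≤∣p∣ (t n))}} p)
    (ℚ.≤-trans (ℚ.≤-reflexive (sym (ℚ.∣p*q∣≡∣p∣*∣q∣ (s n) (t n)))) q))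

-- The hypothesis on `x` gives a positive lower bound for its absolute value only up to double
-- negation. This is enough because being a null sequence is stable.
*ᵣ-cancel : ∀ x y → ¬ x ≈ᵣ 0ᵣ → x *ᵣ y ≈ᵣ 0ᵣ → y ≈ᵣ 0ᵣ
*ᵣ-cancel x y x≉0 xy≈0 = null⇒≈0 y (null-stable y λ ¬null →
  apart x x≉0 λ pos → ¬null (null-quotient (seq x) (seq y) pos (≈0⇒null (x *ᵣ y) xy≈0)))

1≉0 : ¬ fromℕ 1 ≈ᵣ 0ᵣ
1≉0 h = let N , le = h ½ (ℚ.positive⁻¹ ½) in ½*≱ (ℚ.positive⁻¹ 1ℚ) (le N ℕ.≤-refl)

definite : ∀ {N} (x : Vector ℝ N) → ∑ (λ a → x a *ᵣ x a) ≈ᵣ 0ᵣ → ∀ a → x a ≈ᵣ 0ᵣ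
definite {N} x h a = null⇒≈0 (x a) (null-stable (x a) λ ¬null →
  ¬null (≈0⇒null (x a) (*ᵣ-cancel (x a) (x a) (λ z → ¬null (≈0⇒null (x a) z))
    (null⇒≈0 (x a *ᵣ x a) (null-≤ bound (≈0⇒null (∑ (λ a → x a *ᵣ x a)) h))))))
  where
  square : ℕ → Fin N → ℚ
  square n b = seq (x b) n ℚ.* seq (x b) n
  square-nonNeg : ∀ n b → 0ℚ ℚ.≤ square n b
  square-nonNeg n b = Q.²-nonNeg (seq (x b) n)
  bound : ∀ n → ℚ.∣ square n a ∣ ℚ.≤ ℚ.∣ seq (∑ (λ a → x a *ᵣ x a)) n ∣
  bound n = subst₂ ℚ._≤_ (sym (ℚ.0≤p⇒∣p∣≡p (square-nonNeg n a)))
    (trans (sym (ℚ.0≤p⇒∣p∣≡p (Q.sum-nonNeg (square-nonNeg n)))) (cong ℚ.∣_∣ (sym (seq-∑ (λ a → x a *ᵣ x a) n))))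
    (Q.term≤sum (square n) (square-nonNeg n) a)

-- By `dichotomy`, the difference is eventually at most ε or bounded below by some positive number;
-- the hypothesis at half that number excludes the second case.
≤ᵣ-stable : ∀ x y → (∀ ε → 0ℚ ℚ.< ε → ¬ ¬ Eventually (λ n → seq x n ℚ.≤ seq y n ℚ.+ ε)) → x ≤ᵣ y
≤ᵣ-stable x y h ε 0<ε = helper (dichotomy (seq d) (cauchy d) ε 0<ε)
  where
  d : ℝ
  d = x +ᵣ (-ᵣ y)
  helper : Eventually (λ n → seq d n ℚ.≤ ε) ⊎ EventuallyPositive (seq d) → Eventually (λ n → seq x n ℚ.≤ seq y n ℚ.+ ε)
  helper (inj₁ small) = eventually-map (λ n p → subst (ℚ._≤ seq y n ℚ.+ ε)
    (solve 2 (λ a b → b :+ (a :- b) := a) refl (seq x n) (seq y n)) (ℚ.+-monoʳ-≤ (seq y n) p)) small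
  helper (inj₂ pos) = contradiction (λ ev → positive-not-small {seq d} pos (eventually-map (λ n p →
      subst (seq x n ℚ.- seq y n ℚ.≤_) (solve 2 (λ b e → b :+ e :- b := e) refl (seq y n) (½ ℚ.* proj₁ pos)) (ℚ.+-monoˡ-≤ (ℚ.- seq y n) p)) ev))
    (h (½ ℚ.* proj₁ pos) (0<½* (proj₁ (proj₂ pos))))

¬¬-∀ : ∀ {k} {P : Fin k → Set} → (∀ i → ¬ ¬ P i) → ¬ ¬ (∀ i → P i)
¬¬-∀ {zero}  h ¬all = ¬all λ ()
¬¬-∀ {suc k} h ¬all = h zero λ p → ¬¬-∀ (h ∘ suc) λ ps → ¬all λ { zero → p ; (suc i) → ps i }

-- The sum of the k largest eigenvalues

module EigenvalueSum {n : ℕ} {_<_ : Rel (Fin n) 0ℓ} (ord : IsStrictTotalOrder _≡_ _<_) (X : SimplicialComplex n) (s : ℕ)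
  (μ : Vector ℝ (f X s)) (isEig : IsEigenvalueList (upperLaplacian ord X (suc s)) μ)
  (k : ℕ) (1≤k : 1 ℕ.≤ k) (k≤f : k ℕ.≤ f X s) where

  open IsEigenvalueList isEig
  open Complex.LaplacianBound ℚ-orderedField ord X s using (Λ; Λ-sym; quadratic; approximate-eigenvalue-bound)
  open Complex.SignedIncidence ℚ-orderedField ord X s using (facet)

  M : Matrix (f X s)
  M = upperLaplacian ord X (suc s)

  -- The entries of the matrix are constant sequences, so the rational bound applies to the exact
  -- Laplacian at every stage `n`.
  M≡Λ : ∀ i j n → seq (M i j) n ≡ Λ i j
  M≡Λ i j n = sym (⟦⟧ℤ≡/1 (entry ord X (suc s) (facet i) (facet j)))

  M-sym : ∀ i j → M i j ≈ᵣ M j i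
  M-sym i j = ≈-pointwise {M i j} {M j i} (λ n → trans (M≡Λ i j n) (trans (Λ-sym i j) (sym (M≡Λ j i n))))

  open GramSchmidt.Eigenvectors ℝ-commutativeRing 1≉0 *ᵣ-cancel definite M M-sym using (⟨_,_⟩; apply; eigen-⟨⟩; gramSchmidt)

  open GramSchmidt.Eigenvectors.OrthogonalEigenvectors (gramSchmidt μ eigenvector isEigenvector independent)

  x : ℕ → Fin k → Fin (f X s) → ℚ
  x n i a = seq (u (inject≤ i k≤f) a) n

  ν : Fin k → ℝ
  ν i = μ (inject≤ i k≤f)

  seq-⟨⟩ : ∀ v w n → seq ⟨ v , w ⟩ n ≡ Q.dot (λ a → seq (v a) n) (λ a → seq (w a) n)
  seq-⟨⟩ v w n = seq-∑ (λ a → v a *ᵣ w a) n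

  seq-quadratic : ∀ i n → seq ⟨ u (inject≤ i k≤f) , apply (u (inject≤ i k≤f)) ⟩ n ≡ quadratic (x n i)
  seq-quadratic i n = trans (seq-⟨⟩ (u (inject≤ i k≤f)) (apply (u (inject≤ i k≤f))) n) (Q.sum-cong-≗ λ a → cong (x n i a ℚ.*_)
    (trans (seq-⟨⟩ (M a) (u (inject≤ i k≤f)) n) (Q.sum-cong-≗ λ b → cong (ℚ._* x n i b) (M≡Λ a b n))))

  -- Diagonal Gram entries are squared norms, which do not tend to 0 and must not count as errors.
  -- The decision is an argument so that proofs can match on it separately.
  error-term : ∀ {i j : Fin k} → Dec (i ≡ j) → ℚ → ℚ
  error-term (yes _) q = 0ℚ
  error-term (no _)  q = ℚ.∣ q ∣

  error-nonNeg : ∀ {i j : Fin k} (d : Dec (i ≡ j)) q → 0ℚ ℚ.≤ error-term d q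
  error-nonNeg (yes _) q = ℚ.≤-refl
  error-nonNeg (no _)  q = ℚ.0≤∣p∣ q

  pair : ℕ → Fin k → Fin k → ℚ
  pair n i j = error-term (i Fin.≟ j) (Q.dot (x n i) (x n j))

  pair-nonNeg : ∀ n i j → 0ℚ ℚ.≤ pair n i j
  pair-nonNeg n i j = error-nonNeg (i Fin.≟ j) (Q.dot (x n i) (x n j))

  -- The total failure of the n-th approximations to be orthogonal.
  e : ℕ → ℚ
  e n = Q.sum (λ i → Q.sum (pair n i))

  e-nonNeg : ∀ n → 0ℚ ℚ.≤ e n
  e-nonNeg n = Q.sum-nonNeg λ i → Q.sum-nonNeg (pair-nonNeg n i)

  e-null : Null e
  e-null = null-sum λ i → null-sum λ j → term (i Fin.≟ j)
    where
    term : ∀ {i j : Fin k} (d : Dec (i ≡ j)) → Null (λ n → error-term d (Q.dot (x n i) (x n j)))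
    term (yes _) = null-0
    term {i} {j} (no i≢j) = null-≤ (λ n → ℚ.≤-reflexive (ℚ.∣∣p∣∣≡∣p∣ (Q.dot (x n i) (x n j))))
      (null-≗ (seq-⟨⟩ (u (inject≤ i k≤f)) (u (inject≤ j k≤f)))
        (≈0⇒null ⟨ u (inject≤ i k≤f) , u (inject≤ j k≤f) ⟩
          (orthogonal (inject≤ i k≤f) (inject≤ j k≤f) (λ eq → i≢j (Fin.inject≤-injective k≤f k≤f i j eq)))))

  ∣dot∣≤e : ∀ n {i j} → i ≢ j → ℚ.∣ Q.dot (x n i) (x n j) ∣ ℚ.≤ e n
  ∣dot∣≤e n {i} {j} i≢j = ℚ.≤-trans (ℚ.≤-reflexive (term (i Fin.≟ j)))
    (ℚ.≤-trans (Q.term≤sum (pair n i) (pair-nonNeg n i) j) (Q.term≤sum (λ i → Q.sum (pair n i)) (λ i → Q.sum-nonNeg (pair-nonNeg n i)) i))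
    where
    term : (d : Dec (i ≡ j)) → ℚ.∣ Q.dot (x n i) (x n j) ∣ ≡ error-term d (Q.dot (x n i) (x n j))
    term (yes i≡j) = contradiction i≡j i≢j
    term (no _)    = refl

  near⁻ : ∀ n i j → i ≢ j → 0ℚ ℚ.≤ e n ℚ.- Q.dot (x n i) (x n j)
  near⁻ n i j i≢j = Q.x≤y⇒0≤y-x (ℚ.≤-trans (p≤∣p∣ (Q.dot (x n i) (x n j))) (∣dot∣≤e n i≢j))

  near⁺ : ∀ n i j → i ≢ j → 0ℚ ℚ.≤ e n ℚ.+ Q.dot (x n i) (x n j)
  near⁺ n i j i≢j = subst (0ℚ ℚ.≤_) (solve 2 (λ e g → e :- (:- g) := e :+ g) refl (e n) (Q.dot (x n i) (x n j)))
    (Q.x≤y⇒0≤y-x (ℚ.≤-trans (p≤∣p∣ (ℚ.- Q.dot (x n i) (x n j)))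
      (ℚ.≤-trans (ℚ.≤-reflexive (ℚ.∣-p∣≡∣p∣ (Q.dot (x n i) (x n j)))) (∣dot∣≤e n i≢j))))

  norm : ℕ → Fin k → ℚ
  norm n i = Q.dot (x n i) (x n i) ℚ.+ Q.ι k ℚ.* e n

  defect : ℕ → Fin k → ℚ
  defect n i = seq (ν i) n ℚ.* norm n i ℚ.- quadratic (x n i)

  -- Two errors are added: that of the equation `eigen-⟨⟩` at stage `n`, and the enlargement of the
  -- norm by `k * e n`, which is multiplied by a bounded sequence.
  defect-null : ∀ i → Null (λ n → defect n i)
  defect-null i = null-≗ {t = λ n → defect n i} (λ n → trans
      (cong₂ (λ a b → ℚ.- (a ℚ.- seq (ν i) n ℚ.* b) ℚ.+ Q.ι k ℚ.* (seq (ν i) n ℚ.* e n)) (seq-quadratic i n) (seq-⟨⟩ v v n))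
      (solve 5 (λ q ν d k e → :- (q :- ν :* d) :+ k :* (ν :* e) := ν :* (d :+ k :* e) :- q) refl
        (quadratic (x n i)) (seq (ν i) n) (Q.dot (x n i) (x n i)) (Q.ι k) (e n)))
    (null-+ (null-neg (eigen-⟨⟩ {ν i} {v} (eigen (inject≤ i k≤f)) v))
            (null-≗ (λ n → cong (ℚ._* (seq (ν i) n ℚ.* e n)) (sym (ι≡/1 k))) (null-* (fromℕ k) (null-* (ν i) e-null))))
    where
    v = u (inject≤ i k≤f)

  Positive : Fin k → Set
  Positive i = EventuallyPositive (λ n → Q.dot (x n i) (x n i))

  -- Gram-Schmidt only refutes that a norm is 0. The explicit lower bounds needed for `rayleigh`
  -- follow under a double negation, which passes through the finite conjunction.
  norms-positive : ¬ ¬ (∀ i → Positive i)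
  norms-positive = ¬¬-∀ λ i ¬pos → apart ⟨ u (inject≤ i k≤f) , u (inject≤ i k≤f) ⟩ (nonzero (inject≤ i k≤f))
    λ { (d , 0<d , ev) → ¬pos (d , 0<d , eventually-map (λ n → subst (d ℚ.≤_) (trans
      (cong ℚ.∣_∣ (seq-⟨⟩ (u (inject≤ i k≤f)) (u (inject≤ i k≤f)) n)) (ℚ.0≤p⇒∣p∣≡p (Q.dot-nonNeg (x n i))))) ev) }

  bound : ℕ
  bound = f X (suc s) ℕ.+ ((suc s ℕ.+ 1) ℕ.* k) C 2

  eventually-bounded : (∀ i → Positive i) → ∀ ε → 0ℚ ℚ.< ε →
    Eventually (λ n → seq (∑ ν) n ℚ.≤ seq (fromℕ bound) n ℚ.+ ε)
  eventually-bounded pos ε 0<ε = eventually-map conclude (eventually-× (eventually-∀ (λ i → proj₂ (proj₂ (pos i))))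
      (eventually-∀ (λ i → defect-null i (d i ℚ.* ε′) (0<dε i))))
    where
    0<k : 0ℚ ℚ.< Q.ι k
    0<k = ℚ.<-≤-trans (ℚ.positive⁻¹ 1ℚ) (subst (ℚ._≤ Q.ι k) (ℚ.+-identityʳ 1ℚ) (Q.ι-mono-≤ 1≤k))
    -- The tolerance is ε/k, since each of the k eigenvalues contributes its own error.
    split = scaled 0<k 0<ε
    ε′ = proj₁ split
    0<ε′ = proj₁ (proj₂ split)
    d : Fin k → ℚ
    d i = proj₁ (pos i)
    0<d : ∀ i → 0ℚ ℚ.< d i
    0<d i = proj₁ (proj₂ (pos i))
    0<dε : ∀ i → 0ℚ ℚ.< d i ℚ.* ε′
    0<dε i = subst (ℚ._< d i ℚ.* ε′) (ℚ.*-zeroʳ (d i)) (ℚ.*-monoʳ-<-pos (d i) {{ℚ.positive (0<d i)}} 0<ε′)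
    conclude : ∀ n → (∀ i → d i ℚ.≤ Q.dot (x n i) (x n i)) × (∀ i → ℚ.∣ defect n i ∣ ℚ.≤ d i ℚ.* ε′) →
      seq (∑ ν) n ℚ.≤ seq (fromℕ bound) n ℚ.+ ε
    conclude n (large , small) = subst₂ ℚ._≤_ (sym (seq-∑ ν n)) (cong₂ ℚ._+_ (ι≡/1 bound) (proj₂ (proj₂ split)))
      (approximate-eigenvalue-bound 1≤k (x n) (e n) (e-nonNeg n) (near⁺ n) (near⁻ n) (λ i → seq (ν i) n) d ε′ (ℚ.<⇒≤ 0<ε′)
        (λ i → ℚ.<⇒≤ (0<d i)) (λ i d≡0 → ℚ.<⇒≢ (0<d i) (sym d≡0))
        (λ i → ℚ.≤-trans (large i) (Q.≤-by (Q.ι k ℚ.* e n) (Q.*-nonNeg (Q.ι-nonNeg k) (e-nonNeg n)) refl))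
        (λ i → ℚ.≤-trans (p≤∣p∣ (defect n i)) (small i)))

  eigenvalue-sum : ∑ ν ≤ᵣ fromℕ bound
  eigenvalue-sum = ≤ᵣ-stable (∑ ν) (fromℕ bound) λ ε 0<ε ¬ev → norms-positive λ pos → ¬ev (eventually-bounded pos ε 0<ε)

open import Data.Nat using (ℕ; _+_; _*_; _∸_; _≤_)
open import Data.Integer as ℤ using (+_)

corollary1p7 : ∀ {n : ℕ} {_<_ : Rel (Fin n) 0ℓ} (ord : IsStrictTotalOrder _≡_ _<_)
    (X : SimplicialComplex n) (r : ℕ) → 1 ≤ r → + r ℤ.≤ dim X →
    (μ : Vector ℝ (f X (r ∸ 1))) → IsEigenvalueList (upperLaplacian ord X r) μ →
    (k : ℕ) → 1 ≤ k → (k≤f : k ≤ f X (r ∸ 1)) →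
    ∑ (λ (i : Fin k) → μ (inject≤ i k≤f)) ≤ᵣ fromℕ (f X r + ((r + 1) * k) C 2)
corollary1p7 ord X (suc s) _ _ μ isEig k 1≤k k≤f = EigenvalueSum.eigenvalue-sum ord X s μ isEig k 1≤k k≤f
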